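{- Let $G^\sigma$ be a signed complete graph (underlying graph $K_n$) whose adjacency matrix has all but at most two eigenvalues (counted with multiplicity) equal to $\pm 1$. Then $G^\sigma$ is determined by its spectrum up to switching: every signed graph whose adjacency matrix has the same spectrum as that of $G^\sigma$ is switching isomorphic with $G^\sigma$.
   Context: A signed graph $G^\sigma$ is a finite simple graph $G$ with a signature $\sigma:E(G)\to\{ -1,+1\}$; its adjacency matrix has entry $\sigma(\{u,v\})$ for edges and $0$ otherwise, and its spectrum is the multiset of eigenvalues of this matrix. Switching with respect to a vertex subset $X$ changes the sign of every edge between $X$ and $V\setminus X$; two signed graphs are switching isomorphic if one can be switched into an isomorphic copy of the other. -}

module Defs where

open import Data.Nat using (ℕ; zero; suc)
open import Data.Fin using (Fin; zero; suc; punchIn; toℕ)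
open import Data.Integer using (ℤ; _+_; _*_; -_; _-_; _^_; 0ℤ; 1ℤ; -1ℤ)
open import Data.Vec using (Vec; []; _∷_)
open import Data.Product using (Σ; _×_; _,_)
open import Data.Sum using (_⊎_)
open import Function.Bundles using (_↔_; Inverse)
open import Relation.Binary.PropositionalEquality using (_≡_; _≢_)

Matrix : ℕ → Set
Matrix n = Fin n → Fin n → ℤ

sumFin : ∀ {n} → (Fin n → ℤ) → ℤ
sumFin {zero}  f = 0ℤ
sumFin {suc n} f = f zero + sumFin (λ i → f (suc i))

negOnePow : ℕ → ℤ
negOnePow zero    = 1ℤ
negOnePow (suc k) = - negOnePow k

det : ∀ {n} → Matrix n → ℤ
det {zero}  A = 1ℤ
det {suc n} A =
  sumFin (λ j → negOnePow (toℕ j) * A zero j * det (λ i k → A (suc i) (punchIn j k)))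

δ : ∀ {n} → Fin n → Fin n → ℤ
δ zero    zero    = 1ℤ
δ zero    (suc _) = 0ℤ
δ (suc _) zero    = 0ℤ
δ (suc i) (suc j) = δ i j

charPolyAt : ∀ {n} → Matrix n → ℤ → ℤ
charPolyAt A t = det (λ i j → t * δ i j - A i j)

record SignedGraph (n : ℕ) : Set where
  field
    adj      : Matrix n
    symm     : ∀ i j → adj i j ≡ adj j i
    loopless : ∀ i → adj i i ≡ 0ℤ
    entries  : ∀ i j → adj i j ≡ 0ℤ ⊎ (adj i j ≡ 1ℤ ⊎ adj i j ≡ -1ℤ)
open SignedGraph public

IsComplete : ∀ {n} → SignedGraph n → Set
IsComplete {n} G = ∀ (i j : Fin n) → i ≢ j → adj G i j ≢ 0ℤ

-- cospectral: same spectrum, i.e. same characteristic polynomial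
-- (two integer polynomials agreeing at every integer are equal)
Cospectral : ∀ {n} → SignedGraph n → SignedGraph n → Set
Cospectral G H = ∀ (t : ℤ) → charPolyAt (adj G) t ≡ charPolyAt (adj H) t

-- monic integer polynomial t^k + c_{k-1} t^{k-1} + ... + c_0,
-- coefficients listed from the constant term upward
monicAt : ∀ {k} → Vec ℤ k → ℤ → ℤ
monicAt []       t = 1ℤ
monicAt (c ∷ cs) t = c + t * monicAt cs t

-- all but at most two eigenvalues (with multiplicity) are ±1:
-- the characteristic polynomial is (x-1)^a (x+1)^b q(x) with q monic of degree k ≤ 2
AllButTwoEigenvaluesPM1 : ∀ {n} → SignedGraph n → Set
AllButTwoEigenvaluesPM1 {n} G =
  Σ ℕ λ a → Σ ℕ λ b → Σ ℕ λ k →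
    (a Data.Nat.+ b Data.Nat.+ k ≡ n) × (k Data.Nat.≤ 2) ×
    Σ (Vec ℤ k) λ q →
      ∀ (t : ℤ) → charPolyAt (adj G) t ≡ ((t - 1ℤ) ^ a) * ((t + 1ℤ) ^ b) * monicAt q t

IsSign : ℤ → Set
IsSign s = s ≡ 1ℤ ⊎ s ≡ -1ℤ

SwitchingIsomorphic : ∀ {n} → SignedGraph n → SignedGraph n → Set
SwitchingIsomorphic {n} G H =
  Σ (Fin n ↔ Fin n) λ π → Σ (Fin n → ℤ) λ s →
    (∀ i → IsSign (s i)) ×
    (∀ i j → adj H i j ≡ s i * adj G (Inverse.to π i) (Inverse.to π j) * s j)

{-# OPTIONS --safe #-}

-- Let A be the adjacency matrix, with charpoly (t − 1)^a (t + 1)^b q(t), q = t² − ct + p.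
-- Cayley–Hamilton and symmetry give (A² − 1) q(A) = 0, and the derivative of the characteristic
-- polynomial gives the traces of A, A², A³.  Hence c = b − a and p = −(2ab + a + b + 1), a graph
-- cospectral with a complete one is complete, and N = A² − 1 has rank two with
-- q(1), q(−1) ≤ 0.  If both are negative, each of the forms 1 − A and 1 + A has exactly one
-- negative eigenvalue.  For an edge ij the vector e_i + A_ij e_j is isotropic for 1 − A, and two
-- edges of a negative triangle give orthogonal isotropic vectors, which must be proportional modulo
-- the radical; likewise for 1 + A and positive triangles.  This forces a partition of the vertices
-- into P ∪ Q such that, up to switching, exactly the edges inside Q are negative.  Finally tr A³
-- determines |Q|.
module Submission where

open import Defs
open import Algebra.Bundles using (CommutativeRing)
open import Algebra.Solver.Ring.AlmostCommutativeRing using (_-Raw-AlmostCommutative⟶_; fromCommutativeRing)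
open import Data.Empty using (⊥)
open import Data.Maybe using (Maybe; just; nothing)
open import Data.Nat as ℕ using (ℕ; zero; suc)
open import Data.Product
open import Level using (0ℓ)
open import Relation.Nullary using (contradiction; Dec; yes; no; ¬_; _×-dec_; _⊎-dec_; ⌊_⌋)
import Data.Integer as ℤ
import Data.Integer.Properties as ℤₚ
import Relation.Binary.PropositionalEquality as ≡

-- The exceptional eigenvalues θ₁, θ₂ are in general irrational while all matrices are integral, so
-- no eigenvector is ever formed. Statements about eigenspaces become identities between polynomials
-- in A modulo (A² - 1) q(A), denominators are cleared by D = q(1) q(-1), and positivity enters only
-- through sums of squares. The signature argument takes this shape. For ∇ = q(-1) < 0 the matrix Y
-- = (A - 1) q(A) is -2∇ times a projection, hence positive semidefinite. On a totally isotropic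
-- plane of L = 1 - A it agrees with the form N · A′, where A′ acts on the two-dimensional range of
-- N = A² - 1 with determinant ∇. So the determinant of Y on the plane is ∇ times that of N, and N
-- agrees there with L², whose determinant is a Gram determinant. A nonnegative number equals a
-- nonpositive one, both vanish, and L maps the plane onto at most a line. The form 1 + A is covered
-- by passing to -A, which exchanges a with b and the two signs of triangles. If a or b is 0, then D
-- = 0 and the argument breaks down; instead A + 1 or 1 - A has rank one, and all triangles have the
-- same sign.

-- Polynomial identities in a commutative ring

module RingIdentities (R : CommutativeRing 0ℓ 0ℓ)
  (hom : CommutativeRing.rawRing ℤₚ.+-*-commutativeRing -Raw-AlmostCommutative⟶ fromCommutativeRing R) where

  open ℤ using (ℤ; 0ℤ; 1ℤ; +_)

  open CommutativeRing R
  open _-Raw-AlmostCommutative⟶_ hom using () renaming (⟦_⟧ to ι)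
  open import Relation.Binary.Reasoning.Setoid setoid

  private
    weak : ∀ c d → Maybe (ι c ≈ ι d)
    weak c d with c ℤ.≟ d
    ... | yes ≡.refl = just refl
    ... | no _ = nothing

  open import Algebra.Solver.Ring (CommutativeRing.rawRing ℤₚ.+-*-commutativeRing) (fromCommutativeRing R) hom weak
    using (solve; con; _:=_; _:+_; _:*_; _:-_; :-_)

  one two : Carrier
  one = ι 1ℤ
  two = ι (+ 2)

  pow : Carrier → ℕ → Carrier
  pow x zero    = one
  pow x (suc k) = x * pow x k

  pow-+ : ∀ x j k → pow x (j ℕ.+ k) ≈ pow x j * pow x k
  pow-+ x zero k = solve 1 (λ y → y := con 1ℤ :* y) refl (pow x k)
  pow-+ x (suc j) k = trans (*-cong refl (pow-+ x j k)) (sym (*-assoc x _ _))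

  pow-* : ∀ x y k → pow (x * y) k ≈ pow x k * pow y k
  pow-* x y zero = solve 0 (con 1ℤ := con 1ℤ :* con 1ℤ) refl
  pow-* x y (suc k) = trans (*-cong refl (pow-* x y k))
    (solve 4 (λ x y p q → x :* y :* (p :* q) := x :* p :* (y :* q)) refl x y (pow x k) (pow y k))

  quad quartic : Carrier → Carrier → Carrier → Carrier
  quad c p x = x * x - c * x + p
  quartic c p x = (x * x - one) * quad c p x

  poly : ℕ → ℕ → Carrier → Carrier → Carrier → Carrier
  poly a b c p x = pow (x - one) a * pow (x + one) b * quad c p x

  -- The quotient is data: for `d` = t - A it is the integer matrix that `cayley-hamilton` compares
  -- with the adjugate of t - A.
  CongMod : Carrier → Carrier → Carrier → Set
  CongMod d u v = Σ Carrier λ q → u ≈ v + d * q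

  CongMod-* : ∀ {d u v u′ v′} → CongMod d u v → CongMod d u′ v′ → CongMod d (u * u′) (v * v′)
  CongMod-* {d} {u} {v} {u′} {v′} (q , h) (q′ , h′) =
    q * v′ + v * q′ + d * q * q′ , trans (*-cong h h′)
    (solve 5 (λ d v q v′ q′ → (v :+ d :* q) :* (v′ :+ d :* q′) :=
      v :* v′ :+ d :* (q :* v′ :+ v :* q′ :+ d :* q :* q′)) refl d v q v′ q′)

  CongMod-pow : ∀ {d u v} k → CongMod d u v → CongMod d (pow u k) (pow v k)
  CongMod-pow {d} zero h = ι 0ℤ , solve 1 (λ d → con 1ℤ := con 1ℤ :+ d :* con 0ℤ) refl d
  CongMod-pow (suc k) h = CongMod-* h (CongMod-pow k h)

  poly-CongMod : ∀ a b c p t x → CongMod (t - x) (poly a b c p t) (poly a b c p x)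
  poly-CongMod a b c p t x = CongMod-* (CongMod-*
    (CongMod-pow a (one , solve 2 (λ t x → t :- con 1ℤ := x :- con 1ℤ :+ (t :- x) :* con 1ℤ) refl t x))
    (CongMod-pow b (one , solve 2 (λ t x → t :+ con 1ℤ := x :+ con 1ℤ :+ (t :- x) :* con 1ℤ) refl t x)))
    (t + x - c , solve 4 (λ t x c p → t :* t :- c :* t :+ p :=
       x :* x :- c :* x :+ p :+ (t :- x) :* (t :+ x :- c)) refl t x c p)

  -- The divided difference (F(t) - F(x)) / (t - x) of F = `quartic c p`, sorted by powers of x so
  -- that its trace at x = A is linear in the traces of A, A² and A³.
  quartic-quotient : Carrier → Carrier → Carrier → Carrier → Carrier
  quartic-quotient c p t x =
    x * (x * x) + (t - c) * (x * x) + (t * t - c * t + p - one) * x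
    + (t * t * t - c * (t * t) + (p - one) * t + c)

  quartic-factor : ∀ c p t x → quartic c p t - quartic c p x ≈ (t - x) * quartic-quotient c p t x
  quartic-factor = solve 4 (λ c p t x →
    (t :* t :- con 1ℤ) :* (t :* t :- c :* t :+ p) :- (x :* x :- con 1ℤ) :* (x :* x :- c :* x :+ p) :=
    (t :- x) :* (x :* (x :* x) :+ (t :- c) :* (x :* x) :+ (t :* t :- c :* t :+ p :- con 1ℤ) :* x
      :+ (t :* t :* t :- c :* (t :* t) :+ (p :- con 1ℤ) :* t :+ c))) refl

  -- The exponent a + b + 1 is at least a, b and 1, so this power of (x - 1)(x + 1) q(x) is a
  -- multiple of `poly`.
  quartic-nilpotent : ∀ a b c p x → poly a b c p x ≈ 0# → pow (quartic c p x) (suc (a ℕ.+ b)) ≈ 0#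
  quartic-nilpotent a b c p x h = begin
    pow (quartic c p x) (suc (a ℕ.+ b))
      ≈⟨ *-cong (solve 2 (λ x w → (x :* x :- con 1ℤ) :* w := (x :- con 1ℤ) :* (x :+ con 1ℤ) :* w) refl x w)
           (trans (pow-cong (a ℕ.+ b)
             (solve 2 (λ x w → (x :* x :- con 1ℤ) :* w := (x :- con 1ℤ) :* (x :+ con 1ℤ) :* w) refl x w))
           (trans (pow-* (u * v) w (a ℕ.+ b)) (*-cong (trans (pow-* u v (a ℕ.+ b))
             (*-cong (pow-+ u a b) (pow-+ v a b))) refl))) ⟩
    u * v * w * (pow u a * pow u b * (pow v a * pow v b) * pow w (a ℕ.+ b))
      ≈⟨ solve 8 (λ u v w ua ub va vb wk →
           u :* v :* w :* (ua :* ub :* (va :* vb) :* wk) := ua :* vb :* w :* (u :* v :* ub :* va :* wk))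
           refl u v w (pow u a) (pow u b) (pow v a) (pow v b) (pow w (a ℕ.+ b)) ⟩
    poly a b c p x * (u * v * pow u b * pow v a * pow w (a ℕ.+ b))
      ≈⟨ trans (*-cong h refl) (zeroˡ _) ⟩
    0# ∎
    where
      u = x - one
      v = x + one
      w = quad c p x
      pow-cong : ∀ {y z} k → y ≈ z → pow y k ≈ pow z k
      pow-cong zero    e = refl
      pow-cong (suc k) e = *-cong e (pow-cong k e)

  pow-zero⇒zero : (∀ y → y * y ≈ 0# → y ≈ 0#) → ∀ x k → pow x (suc k) ≈ 0# → x ≈ 0#
  pow-zero⇒zero reduced x zero h = trans (solve 1 (λ x → x := x :* con 1ℤ) refl x) h
  pow-zero⇒zero reduced x (suc k) h = pow-zero⇒zero reduced x k (reduced _ (begin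
    pow x (suc k) * pow x (suc k)
      ≈⟨ solve 2 (λ x y → x :* y :* (x :* y) := x :* (x :* y) :* y) refl x (pow x k) ⟩
    pow x (suc (suc k)) * pow x k ≈⟨ trans (*-cong h refl) (zeroˡ _) ⟩
    0# ∎))

  -- For a = 0 the first and the last term vanish at x = A and c + 2 = n, which leaves (A + 1)² = n
  -- (A + 1).
  shift-square : ∀ c p x → (x + one) * (x + one) ≈ quad c p x + (c + two) * (x + one) + - (p + one + c)
  shift-square = solve 3 (λ c p x → (x :+ con 1ℤ) :* (x :+ con 1ℤ) :=
    x :* x :- c :* x :+ p :+ (c :+ con (+ 2)) :* (x :+ con 1ℤ) :+ :- (p :+ con 1ℤ :+ c)) refl

  module Quartic (c p x : Carrier) (root : quartic c p x ≈ 0#) where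

    private
      -- Reduction modulo `quartic`: each use supplies the cofactor of the polynomial division and
      -- leaves a plain identity to the solver.
      drop : ∀ {u v} q → u ≈ v + quartic c p x * q → u ≈ v
      drop {u} {v} q e = trans e (trans (+-cong refl (trans (*-cong root refl) (zeroˡ q))) (+-identityʳ v))

    -- x is one of ±1, θ₁, θ₂ where θ₁, θ₂ are the roots of quad.  M is D times the projection onto
    -- the θ-part, where D = (θ₁² − 1)(θ₂² − 1), and ∇ = quad(−1).
    N ℓ M A′ W Y L D ∇ s : Carrier
    N  = x * x - one
    ℓ  = (c * c - p - one) - c * x
    D  = (p + one) * (p + one) - c * c
    M  = N * ℓ
    A′ = x - c - one
    W  = M * A′
    L  = one - x
    ∇  = one + c + p
    s  = - (c + two)
    Y  = (x - one) * quad c p x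

    -- Since c = θ₁ + θ₂ and p = θ₁θ₂, the factor `ℓ` takes the value θ₂² - 1 at θ₁ and θ₁² - 1 at
    -- θ₂. So N ℓ is D at both, while N vanishes at ±1.
    M*N : M * N ≈ D * N
    M*N = drop (- (p + one) - c * x) (solve 3 (λ c p x →
      let n = x :* x :- con 1ℤ ; l = (c :* c :- p :- con 1ℤ) :- c :* x in
      n :* l :* n := ((p :+ con 1ℤ) :* (p :+ con 1ℤ) :- c :* c) :* n :+
        n :* (x :* x :- c :* x :+ p) :* (:- (p :+ con 1ℤ) :- c :* x)) refl c p x)

    M*M : M * M ≈ D * M
    M*M = trans (solve 3 (λ m n l → m :* (n :* l) := m :* n :* l) refl M N ℓ)
      (trans (*-cong M*N refl) (*-assoc D N ℓ))

    W*M : W * M ≈ D * W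
    W*M = trans (solve 2 (λ m a → m :* a :* m := m :* m :* a) refl M A′)
      (trans (*-cong M*M refl) (*-assoc D M A′))

    W*N : W * N ≈ D * (N * A′)
    W*N = trans (solve 3 (λ m a n → m :* a :* n := m :* n :* a) refl M A′ N)
      (trans (*-cong M*N refl) (*-assoc D N A′))

    -- `A′` takes the values -(1 + θ₂) and -(1 + θ₁) at θ₁ and θ₂. On the θ-part W / D therefore has
    -- trace `s` and determinant `∇`; this is its Cayley-Hamilton equation with denominators
    -- cleared.
    W*W : W * W ≈ D * (s * W - ∇ * M)
    W*W = trans (solve 2 (λ m a → m :* a :* (m :* a) := m :* m :* (a :* a)) refl M A′)
      (trans (*-cong M*M refl) (trans (*-assoc D M (A′ * A′)) (*-cong refl M*A′²)))
      where
        M*A′² : M * (A′ * A′) ≈ s * W - ∇ * M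
        M*A′² = drop ℓ (solve 3 (λ c p x →
          let n = x :* x :- con 1ℤ ; l = (c :* c :- p :- con 1ℤ) :- c :* x
              m = n :* l ; a = x :- c :- con 1ℤ in
          m :* (a :* a) := (:- (c :+ con (+ 2))) :* (m :* a) :- (con 1ℤ :+ c :+ p) :* m :+
            n :* (x :* x :- c :* x :+ p) :* l) refl c p x)

    -- The link between the three forms: wherever the form of `L` vanishes, those of `Y` and N · A′
    -- agree.
    Y-N : Y ≈ N * A′ - ∇ * L
    Y-N = solve 3 (λ c p x → (x :- con 1ℤ) :* (x :* x :- c :* x :+ p) :=
      (x :* x :- con 1ℤ) :* (x :- c :- con 1ℤ) :- (con 1ℤ :+ c :+ p) :* (con 1ℤ :- x)) refl c p x

    -- `Y` vanishes at 1, θ₁, θ₂ and takes the value -2∇ at -1.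
    Y*Y : Y * Y ≈ - (two * ∇) * Y
    Y*Y = drop (x * x - (c + two) * x + (two * c + p + two)) (solve 3 (λ c p x →
      let q = x :* x :- c :* x :+ p ; y = (x :- con 1ℤ) :* q in
      y :* y := (:- (con (+ 2) :* (con 1ℤ :+ c :+ p))) :* y :+ (x :* x :- con 1ℤ) :* q :*
        (x :* x :- (c :+ con (+ 2)) :* x :+ (con (+ 2) :* c :+ p :+ con (+ 2)))) refl c p x)

    N-L : N ≈ L * L - two * L
    N-L = solve 1 (λ x → x :* x :- con 1ℤ :=
      (con 1ℤ :- x) :* (con 1ℤ :- x) :- con (+ 2) :* (con 1ℤ :- x)) refl x

    M-expand : M ≈ - c * (x * (x * x)) + (c * c - p - one) * (x * x) + c * x + - (c * c - p - one)
    M-expand = solve 3 (λ c p x →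
      (x :* x :- con 1ℤ) :* ((c :* c :- p :- con 1ℤ) :- c :* x) :=
      :- c :* (x :* (x :* x)) :+ (c :* c :- p :- con 1ℤ) :* (x :* x) :+ c :* x
        :+ :- (c :* c :- p :- con 1ℤ)) refl c p x

    -- The degree is brought down from four to three because only the traces of A, A² and A³ are
    -- known.
    Mx-expand : M * x ≈ - (p + one) * (x * (x * x)) + c * p * (x * x) + (p + one) * x + - (c * p)
    Mx-expand = drop (- c) (solve 3 (λ c p x →
      (x :* x :- con 1ℤ) :* ((c :* c :- p :- con 1ℤ) :- c :* x) :* x :=
      :- (p :+ con 1ℤ) :* (x :* (x :* x)) :+ c :* p :* (x :* x) :+ (p :+ con 1ℤ) :* x :+ :- (c :* p)
        :+ (x :* x :- con 1ℤ) :* (x :* x :- c :* x :+ p) :* (:- c)) refl c p x)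

    quad²-expand : quad c p x * quad c p x ≈
      - c * (x * (x * x)) + (one + p + c * c) * (x * x) + - (c * (one + p) + c * p) * x + (one + p) * p
    quad²-expand = drop one (solve 3 (λ c p x →
      let q = x :* x :- c :* x :+ p in
      q :* q := :- c :* (x :* (x :* x)) :+ (con 1ℤ :+ p :+ c :* c) :* (x :* x)
        :+ :- (c :* (con 1ℤ :+ p) :+ c :* p) :* x :+ (con 1ℤ :+ p) :* p
        :+ (x :* x :- con 1ℤ) :* q :* con 1ℤ) refl c p x)

    W-expand : W ≈ M * x + - (c + one) * M
    W-expand = solve 3 (λ m x c → m :* (x :- c :- con 1ℤ) := m :* x :+ (:- (c :+ con 1ℤ)) :* m) refl M x c

import Data.Bool.Properties as Bool
import Data.Fin.Permutation as Perm
import Data.Nat.Properties as ℕ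
open import Data.Bool using (Bool; true; false; not)
open import Data.Fin using (Fin; zero; suc; punchIn; toℕ; _≟_)
open import Data.Fin.Permutation using (Permutation′; insert; insert-punchIn; _⟨$⟩ʳ_)
open import Data.Fin.Properties using (any?)
open import Data.Integer hiding (suc; _≟_)
open import Data.Integer.Properties hiding (_≟_)
open import Data.Integer.Tactic.RingSolver using (solve-∀)
open import Data.Sum using (_⊎_; inj₁; inj₂; [_,_]′)
open import Data.Vec using (Vec; []; _∷_)
open import Function.Bundles using (_↔_; Inverse)
open import Relation.Binary.Definitions using (tri<; tri≈; tri>)
open import Relation.Binary.PropositionalEquality
open ≡-Reasoning


-- Finite sums

sum-cong : ∀ {n} {f g : Fin n → ℤ} → (∀ i → f i ≡ g i) → sumFin f ≡ sumFin g
sum-cong {zero}  h = refl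
sum-cong {suc n} h = cong₂ _+_ (h zero) (sum-cong (λ i → h (suc i)))

sum-0 : ∀ {n} {f : Fin n → ℤ} → (∀ i → f i ≡ 0ℤ) → sumFin f ≡ 0ℤ
sum-0 {zero}  h = refl
sum-0 {suc n} h = cong₂ _+_ (h zero) (sum-0 (λ i → h (suc i)))

+-interchange : ∀ a b c d → (a + b) + (c + d) ≡ (a + c) + (b + d)
+-interchange = solve-∀

sum-+ : ∀ {n} (f g : Fin n → ℤ) → sumFin (λ i → f i + g i) ≡ sumFin f + sumFin g
sum-+ {zero}  f g = refl
sum-+ {suc n} f g = trans (cong (λ w → (f zero + g zero) + w) (sum-+ (λ i → f (suc i)) (λ i → g (suc i))))
  (+-interchange (f zero) (g zero) (sumFin (λ i → f (suc i))) (sumFin (λ i → g (suc i))))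

sum-*ˡ : ∀ {n} c (f : Fin n → ℤ) → sumFin (λ i → c * f i) ≡ c * sumFin f
sum-*ˡ {zero}  c f = sym (*-zeroʳ c)
sum-*ˡ {suc n} c f = trans (cong (λ w → c * f zero + w) (sum-*ˡ c (λ i → f (suc i))))
  (sym (*-distribˡ-+ c (f zero) _))

sum-*ʳ : ∀ {n} c (f : Fin n → ℤ) → sumFin (λ i → f i * c) ≡ sumFin f * c
sum-*ʳ c f = trans (sum-cong (λ i → *-comm (f i) c)) (trans (sum-*ˡ c f) (*-comm c _))

sum-swap : ∀ {m n} (f : Fin m → Fin n → ℤ) →
  sumFin (λ i → sumFin (λ j → f i j)) ≡ sumFin (λ j → sumFin (λ i → f i j))
sum-swap {zero} {n} f = sym (sum-0 {n} {λ _ → 0ℤ} (λ _ → refl))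
sum-swap {suc m} f = trans (cong (λ w → sumFin (f zero) + w) (sum-swap (λ i → f (suc i))))
  (sym (sum-+ (f zero) _))

sum-δ : ∀ {n} (i : Fin n) (f : Fin n → ℤ) → sumFin (λ j → δ i j * f j) ≡ f i
sum-δ zero f = trans (cong₂ _+_ (*-identityˡ (f zero)) (sum-0 (λ j → *-zeroˡ (f (suc j))))) (+-identityʳ (f zero))
sum-δ (suc i) f = trans (cong₂ _+_ (*-zeroˡ (f zero)) (sum-δ i (λ j → f (suc j)))) (+-identityˡ (f (suc i)))

δ-sym : ∀ {n} (i j : Fin n) → δ i j ≡ δ j i
δ-sym zero zero = refl
δ-sym zero (suc j) = refl
δ-sym (suc i) zero = refl
δ-sym (suc i) (suc j) = δ-sym i j

δ-diag : ∀ {n} (i : Fin n) → δ i i ≡ 1ℤ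
δ-diag zero = refl
δ-diag (suc i) = δ-diag i

δ-off : ∀ {n} {i j : Fin n} → i ≢ j → δ i j ≡ 0ℤ
δ-off {i = zero} {zero} ne with () ← ne refl
δ-off {i = zero} {suc j} ne = refl
δ-off {i = suc i} {zero} ne = refl
δ-off {i = suc i} {suc j} ne = δ-off (λ e → ne (cong suc e))

sum-mono : ∀ {n} {f g : Fin n → ℤ} → (∀ i → f i ≤ g i) → sumFin f ≤ sumFin g
sum-mono {zero}  h = ≤-refl
sum-mono {suc n} h = +-mono-≤ (h zero) (sum-mono (λ i → h (suc i)))

sum-const : ∀ {n} c → sumFin {n} (λ _ → c) ≡ + n * c
sum-const {zero}  c = refl
sum-const {suc n} c = trans (cong (λ w → c + w) (sum-const {n} c)) (lem c (+ n))
  where lem : ∀ c m → c + m * c ≡ (1ℤ + m) * c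
        lem = solve-∀

sum-nonneg : ∀ {n} {f : Fin n → ℤ} → (∀ i → 0ℤ ≤ f i) → 0ℤ ≤ sumFin f
sum-nonneg {zero}  h = ≤-refl
sum-nonneg {suc n} h = +-mono-≤ (h zero) (sum-nonneg (λ i → h (suc i)))

+-nonneg-zero : ∀ {x y} → 0ℤ ≤ x → 0ℤ ≤ y → x + y ≡ 0ℤ → x ≡ 0ℤ × y ≡ 0ℤ
+-nonneg-zero {x} {y} 0≤x 0≤y e =
  ≤-antisym (subst (x ≤_) e (subst (_≤ x + y) (+-identityʳ x) (+-monoʳ-≤ x 0≤y))) 0≤x ,
  ≤-antisym (subst (y ≤_) e (subst (_≤ x + y) (+-identityˡ y) (+-monoˡ-≤ y 0≤x))) 0≤y

sum-nonneg-zero : ∀ {n} {f : Fin n → ℤ} → (∀ i → 0ℤ ≤ f i) → sumFin f ≡ 0ℤ → ∀ i → f i ≡ 0ℤ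
sum-nonneg-zero h e zero = proj₁ (+-nonneg-zero (h zero) (sum-nonneg (λ i → h (suc i))) e)
sum-nonneg-zero h e (suc i) =
  sum-nonneg-zero (λ i → h (suc i)) (proj₂ (+-nonneg-zero (h zero) (sum-nonneg (λ i → h (suc i))) e)) i

sq-nonneg : ∀ x → 0ℤ ≤ x * x
sq-nonneg (+ n) = subst (0ℤ ≤_) (pos-* n n) (+≤+ ℕ.z≤n)
sq-nonneg -[1+ n ] = +≤+ ℕ.z≤n

sq-zero : ∀ {x} → x * x ≡ 0ℤ → x ≡ 0ℤ
sq-zero {x} e with i*j≡0⇒i≡0∨j≡0 x e
... | inj₁ p = p
... | inj₂ p = p

sum-sq-zero : ∀ {n} (f : Fin n → ℤ) → sumFin (λ i → f i * f i) ≡ 0ℤ → ∀ i → f i ≡ 0ℤ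
sum-sq-zero f e i = sq-zero (sum-nonneg-zero (λ i → sq-nonneg (f i)) e i)

-- The solver proves identities but uses no hypotheses; a linear consequence of u ≡ v is passed to
-- it as an identity between differences.
cancel-by : ∀ x y {u v} → u ≡ v → x - y ≡ u - v → x ≡ y
cancel-by x y {u} refl h = i-j≡0⇒i≡j x y (trans h (i≡j⇒i-j≡0 {u} refl))

-- Determinants

sgn : ∀ {n} → Fin n → ℤ
sgn j = negOnePow (toℕ j)

minor : ∀ {n} → Matrix (suc n) → Fin (suc n) → Matrix n
minor A j i k = A (suc i) (punchIn j k)

det-cong : ∀ {n} {A B : Matrix n} → (∀ i j → A i j ≡ B i j) → det A ≡ det B
det-cong {zero}  h = refl
det-cong {suc n} h = sum-cong (λ j →
  cong₂ _*_ (cong (sgn j *_) (h zero j)) (det-cong (λ i k → h (suc i) (punchIn j k))))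

replaceRow : ∀ {m} {X : Set} → (Fin m → X) → Fin m → X → Fin m → X
replaceRow M zero    v zero    = v
replaceRow M zero    v (suc i) = M (suc i)
replaceRow M (suc r) v zero    = M zero
replaceRow M (suc r) v (suc i) = replaceRow (λ j → M (suc j)) r v i

replaceRow-same : ∀ {m} {X : Set} (M : Fin m → X) r v → replaceRow M r v r ≡ v
replaceRow-same M zero    v = refl
replaceRow-same M (suc r) v = replaceRow-same (λ j → M (suc j)) r v

replaceRow-other : ∀ {m} {X : Set} (M : Fin m → X) r v i → i ≢ r → replaceRow M r v i ≡ M i
replaceRow-other M zero    v zero    ne = contradiction refl ne
replaceRow-other M zero    v (suc i) ne = refl
replaceRow-other M (suc r) v zero    ne = refl
replaceRow-other M (suc r) v (suc i) ne = replaceRow-other (λ j → M (suc j)) r v i (λ e → ne (cong suc e))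

replaceRow-id : ∀ {m} {X : Set} (M : Fin m → X) r i → replaceRow M r (M r) i ≡ M i
replaceRow-id M zero    zero    = refl
replaceRow-id M zero    (suc i) = refl
replaceRow-id M (suc r) zero    = refl
replaceRow-id M (suc r) (suc i) = replaceRow-id (λ j → M (suc j)) r i

replaceRow-map : ∀ {m} {X Y : Set} (g : X → Y) (M : Fin m → X) r v i →
  g (replaceRow M r v i) ≡ replaceRow (λ j → g (M j)) r (g v) i
replaceRow-map g M zero    v zero    = refl
replaceRow-map g M zero    v (suc i) = refl
replaceRow-map g M (suc r) v zero    = refl
replaceRow-map g M (suc r) v (suc i) = replaceRow-map g (λ j → M (suc j)) r v i

det-replaceRow-suc : ∀ {n} (M : Matrix (suc n)) r v → det (replaceRow M (suc r) v) ≡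
  sumFin (λ j → sgn j * M zero j * det (replaceRow (minor M j) r (λ k → v (punchIn j k))))
det-replaceRow-suc M r v = sum-cong (λ j → cong (sgn j * M zero j *_)
  (det-cong (λ i k → cong (λ w → w k)
    (replaceRow-map (λ w k → w (punchIn j k)) (λ i → M (suc i)) r v i))))

det-row-+* : ∀ {n} (M : Matrix n) r (u v : Fin n → ℤ) c →
  det (replaceRow M r (λ k → u k + c * v k)) ≡
  det (replaceRow M r u) + c * det (replaceRow M r v)
det-row-+* {suc n} M zero u v c = begin
  sumFin (λ j → sgn j * (u j + c * v j) * det (minor M j))
    ≡⟨ sum-cong (λ j → lem (sgn j) (u j) c (v j) (det (minor M j))) ⟩
  sumFin (λ j → sgn j * u j * det (minor M j) + c * (sgn j * v j * det (minor M j)))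
    ≡⟨ sum-+ (λ j → sgn j * u j * det (minor M j)) (λ j → c * (sgn j * v j * det (minor M j))) ⟩
  sumFin (λ j → sgn j * u j * det (minor M j)) + sumFin (λ j → c * (sgn j * v j * det (minor M j)))
    ≡⟨ cong (λ w → sumFin (λ j → sgn j * u j * det (minor M j)) + w)
         (sum-*ˡ c (λ j → sgn j * v j * det (minor M j))) ⟩
  sumFin (λ j → sgn j * u j * det (minor M j)) + c * sumFin (λ j → sgn j * v j * det (minor M j)) ∎
  where lem : ∀ s u c v d → s * (u + c * v) * d ≡ s * u * d + c * (s * v * d)
        lem = solve-∀
det-row-+* {suc n} M (suc r) u v c = begin
  det (replaceRow M (suc r) (λ k → u k + c * v k))
    ≡⟨ det-replaceRow-suc M r _ ⟩
  sumFin (λ j → s j * det (replaceRow (minor M j) r (λ k → u (punchIn j k) + c * v (punchIn j k))))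
    ≡⟨ sum-cong (λ j → cong (s j *_) (det-row-+* (minor M j) r (λ k → u (punchIn j k)) (λ k → v (punchIn j k)) c)) ⟩
  sumFin (λ j → s j * (U j + c * V j))
    ≡⟨ sum-cong (λ j → lem (s j) (U j) c (V j)) ⟩
  sumFin (λ j → s j * U j + c * (s j * V j))
    ≡⟨ sum-+ (λ j → s j * U j) (λ j → c * (s j * V j)) ⟩
  sumFin (λ j → s j * U j) + sumFin (λ j → c * (s j * V j))
    ≡⟨ cong (λ w → sumFin (λ j → s j * U j) + w) (sum-*ˡ c (λ j → s j * V j)) ⟩
  sumFin (λ j → s j * U j) + c * sumFin (λ j → s j * V j)
    ≡⟨ sym (cong₂ (λ x y → x + c * y) (det-replaceRow-suc M r u) (det-replaceRow-suc M r v)) ⟩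
  det (replaceRow M (suc r) u) + c * det (replaceRow M (suc r) v) ∎
  where
    s U V : Fin (suc n) → ℤ
    s j = sgn j * M zero j
    U j = det (replaceRow (minor M j) r (λ k → u (punchIn j k)))
    V j = det (replaceRow (minor M j) r (λ k → v (punchIn j k)))
    lem : ∀ s u c v → s * (u + c * v) ≡ s * u + c * (s * v)
    lem = solve-∀

replaceRow-cong : ∀ {m n} (M : Fin m → Fin n → ℤ) r {u v : Fin n → ℤ} → (∀ k → u k ≡ v k) →
  ∀ i k → replaceRow M r u i k ≡ replaceRow M r v i k
replaceRow-cong M zero    h zero    k = h k
replaceRow-cong M zero    h (suc i) k = refl
replaceRow-cong M (suc r) h zero    k = refl
replaceRow-cong M (suc r) h (suc i) k = replaceRow-cong (λ j → M (suc j)) r h i k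

det-row-zero : ∀ {n} (M : Matrix n) r → det (replaceRow M r (λ _ → 0ℤ)) ≡ 0ℤ
det-row-zero M r = lem _ (det-row-+* M r (λ _ → 0ℤ) (λ _ → 0ℤ) 1ℤ)
  where lem : ∀ x → x ≡ x + 1ℤ * x → x ≡ 0ℤ
        lem x e = cancel-by x 0ℤ (sym e) (alg x)
          where alg : ∀ x → x - 0ℤ ≡ (x + 1ℤ * x) - x
                alg = solve-∀

det-row-sum : ∀ {n m} (M : Matrix n) r (c : Fin m → ℤ) (v : Fin m → Fin n → ℤ) →
  det (replaceRow M r (λ k → sumFin (λ j → c j * v j k))) ≡
  sumFin (λ j → c j * det (replaceRow M r (v j)))
det-row-sum {m = zero}  M r c v = det-row-zero M r
det-row-sum {m = suc m} M r c v = begin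
  det (replaceRow M r (λ k → c zero * v zero k + rest k))
    ≡⟨ det-cong (replaceRow-cong M r (λ k → +-comm (c zero * v zero k) (rest k))) ⟩
  det (replaceRow M r (λ k → rest k + c zero * v zero k))
    ≡⟨ det-row-+* M r rest (v zero) (c zero) ⟩
  det (replaceRow M r rest) + c zero * det (replaceRow M r (v zero))
    ≡⟨ +-comm (det (replaceRow M r rest)) _ ⟩
  c zero * det (replaceRow M r (v zero)) + det (replaceRow M r rest)
    ≡⟨ cong (λ w → c zero * det (replaceRow M r (v zero)) + w) (det-row-sum M r (λ j → c (suc j)) (λ j → v (suc j))) ⟩
  _ ∎
  where
    rest : Fin _ → ℤ
    rest k = sumFin (λ j → c (suc j) * v (suc j) k)

-- In the double expansion along two rows, the column pairs (j , j′) and (j′ , j) come with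
-- opposite signs and the same complementary minor; Φ stands for that minor as a function of
-- the embedding of the remaining columns.
double-expansion-zero : ∀ n (F : Fin (suc (suc n)) → Fin (suc (suc n)) → ℤ) →
  (∀ i j → F i j ≡ F j i) →
  (Φ : (Fin n → Fin (suc (suc n))) → ℤ) → (∀ {g h} → (∀ x → g x ≡ h x) → Φ g ≡ Φ h) →
  sumFin (λ j → sumFin (λ k →
    sgn j * sgn k * F j (punchIn j k) * Φ (λ x → punchIn j (punchIn k x)))) ≡ 0ℤ
double-expansion-zero n F F-sym Φ Φ-ext = begin
  sumFin top + sumFin (λ j → left j + inner n F Φ j)
    ≡⟨ cong (λ w → sumFin top + w) (sum-+ left (inner n F Φ)) ⟩
  sumFin top + (sumFin left + sumFin (inner n F Φ))
    ≡⟨ sym (+-assoc (sumFin top) (sumFin left) (sumFin (inner n F Φ))) ⟩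
  (sumFin top + sumFin left) + sumFin (inner n F Φ)
    ≡⟨ cong₂ _+_ cancel (inner-zero n F F-sym Φ Φ-ext) ⟩
  0ℤ ∎
  where
    inner : ∀ n → (Fin (suc (suc n)) → Fin (suc (suc n)) → ℤ) → ((Fin n → Fin (suc (suc n))) → ℤ) →
      Fin (suc n) → ℤ
    inner n F Φ j = sumFin (λ k → - sgn j * - sgn k * F (suc j) (suc (punchIn j k)) *
      Φ (λ x → punchIn (suc j) (punchIn (suc k) x)))
    top left : Fin (suc n) → ℤ
    top k = 1ℤ * sgn k * F zero (suc k) * Φ (λ x → suc (punchIn k x))
    left j = - sgn j * 1ℤ * F (suc j) zero * Φ (λ x → suc (punchIn j x))
    lem : ∀ s f p → 1ℤ * s * f * p + - s * 1ℤ * f * p ≡ 0ℤ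
    lem = solve-∀
    cancel : sumFin top + sumFin left ≡ 0ℤ
    cancel = trans (sym (sum-+ top left)) (sum-0 (λ k → trans
      (cong (λ f → top k + - sgn k * 1ℤ * f * Φ (λ x → suc (punchIn k x))) (F-sym (suc k) zero))
      (lem (sgn k) (F zero (suc k)) (Φ (λ x → suc (punchIn k x))))))
    inner-zero : ∀ n (F : Fin (suc (suc n)) → Fin (suc (suc n)) → ℤ) → (∀ i j → F i j ≡ F j i) →
      (Φ : (Fin n → Fin (suc (suc n))) → ℤ) → (∀ {g h} → (∀ x → g x ≡ h x) → Φ g ≡ Φ h) →
      sumFin (inner n F Φ) ≡ 0ℤ
    inner-zero zero    F F-sym Φ Φ-ext = refl
    inner-zero (suc n) F F-sym Φ Φ-ext = trans
      (sum-cong (λ j → sum-cong (λ k → cong₂ _*_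
        (cong (_* F (suc j) (suc (punchIn j k))) (neg-neg (sgn j) (sgn k)))
        (Φ-ext {λ x → punchIn (suc j) (punchIn (suc k) x)} {extend (λ x → punchIn j (punchIn k x))}
          (λ { zero → refl ; (suc x) → refl })))))
      (double-expansion-zero n (λ i j → F (suc i) (suc j)) (λ i j → F-sym (suc i) (suc j))
        (λ h → Φ (extend h))
        (λ {g} {h} e → Φ-ext {extend g} {extend h} (λ { zero → refl ; (suc x) → cong suc (e x) })))
      where extend : (Fin n → Fin (suc (suc n))) → Fin (suc n) → Fin (suc (suc (suc n)))
            extend h zero    = zero
            extend h (suc x) = suc (h x)
            neg-neg : ∀ a b → - a * - b ≡ a * b
            neg-neg = solve-∀

swapTop : ∀ {m} {X : Set} → (Fin (suc (suc m)) → X) → Fin (suc (suc m)) → X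
swapTop M zero          = M (suc zero)
swapTop M (suc zero)    = M zero
swapTop M (suc (suc i)) = M (suc (suc i))

-- Adding the double expansions of both matrices termwise makes the coefficient symmetric in the two
-- chosen columns, the situation of `double-expansion-zero`.
det-swapTop : ∀ {n} (M : Matrix (suc (suc n))) → det M + det (swapTop M) ≡ 0ℤ
det-swapTop {n} M = begin
  det M + det (swapTop M) ≡⟨ cong₂ _+_ (expand M) (expand (swapTop M)) ⟩
  sumFin (λ j → sumFin (T M j)) + sumFin (λ j → sumFin (T (swapTop M) j))
    ≡⟨ sym (sum-+ (λ j → sumFin (T M j)) (λ j → sumFin (T (swapTop M) j))) ⟩
  sumFin (λ j → sumFin (T M j) + sumFin (T (swapTop M) j))
    ≡⟨ sum-cong (λ j → trans (sym (sum-+ (T M j) (T (swapTop M) j))) (sum-cong (λ k → lem (sgn j) (sgn k)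
         (M zero j) (M (suc zero) (punchIn j k)) (M (suc zero) j) (M zero (punchIn j k))
         (Φ (λ x → punchIn j (punchIn k x)))))) ⟩
  sumFin (λ j → sumFin (λ k → sgn j * sgn k * F j (punchIn j k) * Φ (λ x → punchIn j (punchIn k x))))
    ≡⟨ double-expansion-zero n F (λ i j → F-symm (M zero i) (M (suc zero) j) (M (suc zero) i) (M zero j))
         Φ (λ e → det-cong (λ i k → cong (M (suc (suc i))) (e k))) ⟩
  0ℤ ∎
  where
    Φ : (Fin n → Fin (suc (suc n))) → ℤ
    Φ h = det (λ i k → M (suc (suc i)) (h k))
    F : Fin (suc (suc n)) → Fin (suc (suc n)) → ℤ
    F i j = M zero i * M (suc zero) j + M (suc zero) i * M zero j
    F-symm : ∀ a b c d → a * b + c * d ≡ d * c + b * a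
    F-symm = solve-∀
    T : Matrix (suc (suc n)) → Fin (suc (suc n)) → Fin (suc n) → ℤ
    T M j k = sgn j * M zero j *
      (sgn k * M (suc zero) (punchIn j k) * det (λ i x → M (suc (suc i)) (punchIn j (punchIn k x))))
    expand : ∀ M → det M ≡ sumFin (λ j → sumFin (T M j))
    expand M = sum-cong (λ j → sym (sum-*ˡ (sgn j * M zero j)
      (λ k → sgn k * M (suc zero) (punchIn j k) *
        det (λ i x → M (suc (suc i)) (punchIn j (punchIn k x))))))
    lem : ∀ s t a b c d p → s * a * (t * b * p) + s * c * (t * d * p) ≡ s * t * (a * b + c * d) * p
    lem = solve-∀

-- If neither of the equal rows is the first, every minor along the first row again has two equal
-- rows. Otherwise a swap of the two top rows leads to that case, unless the equal rows are these
-- two themselves; then det M = -det M.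
det-equal-rows : ∀ {n} (M : Matrix n) i j → i ≢ j → (∀ k → M i k ≡ M j k) → det M ≡ 0ℤ
det-top-equal : ∀ {n} (M : Matrix (suc n)) j → (∀ k → M zero k ≡ M (suc j) k) → det M ≡ 0ℤ

det-equal-rows M zero zero ne h = contradiction refl ne
det-equal-rows M zero (suc j) ne h = det-top-equal M j h
det-equal-rows M (suc i) zero ne h = det-top-equal M i (λ k → sym (h k))
det-equal-rows M (suc i) (suc j) ne h = sum-0 (λ l →
  trans (cong (sgn l * M zero l *_)
    (det-equal-rows (minor M l) i j (λ e → ne (cong suc e)) (λ k → h (punchIn l k))))
  (*-zeroʳ (sgn l * M zero l)))

det-top-equal M zero h = double-zero (trans
    (cong (λ w → det M + w) (det-cong {A = M} {B = swapTop M} swap-id)) (det-swapTop M))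
  where
    swap-id : ∀ i j → M i j ≡ swapTop M i j
    swap-id zero          k = h k
    swap-id (suc zero)    k = sym (h k)
    swap-id (suc (suc i)) k = refl
    double-zero : ∀ {x} → x + x ≡ 0ℤ → x ≡ 0ℤ
    double-zero {x} e = *-cancelˡ-≡ (+ 2) x 0ℤ (trans (lem x) e)
      where lem : ∀ x → + 2 * x ≡ x + x
            lem = solve-∀
det-top-equal {suc n} M (suc j) h = trans (lem (det-swapTop M)) (cong -_ swapped-zero)
  where
    lem : ∀ {x y} → x + y ≡ 0ℤ → x ≡ - y
    lem {x} {y} e = cancel-by x (- y) e (alg x y)
      where alg : ∀ x y → x - - y ≡ (x + y) - 0ℤ
            alg = solve-∀
    swapped-zero : det (swapTop M) ≡ 0ℤ
    swapped-zero = sum-0 (λ l →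
      trans (cong (sgn l * M (suc zero) l *_)
        (det-top-equal (minor (swapTop M) l) j (λ k → h (punchIn l k))))
      (*-zeroʳ (sgn l * M (suc zero) l)))

-- Cofactors as determinants of full size with a unit vector as row i, so that linearity in that row
-- gives `adjugate-inverse` without any bookkeeping of signs.
adjugate : ∀ {n} → Matrix n → Matrix n
adjugate M j i = det (replaceRow M i (δ j))

adjugate-inverse : ∀ {n} (M : Matrix n) k i →
  sumFin (λ j → M k j * adjugate M j i) ≡ det M * δ k i
adjugate-inverse M k i = trans (sym (det-row-sum M i (M k) δ))
  (trans (det-cong (replaceRow-cong M i (λ l → trans
    (sum-cong (λ j → trans (*-comm (M k j) (δ j l)) (cong (_* M k j) (δ-sym j l)))) (sum-δ l (M k)))))
  (diag k i))
  where
    diag : ∀ k i → det (replaceRow M i (M k)) ≡ det M * δ k i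
    diag k i with k ≟ i
    ... | yes refl = trans (det-cong (λ x y → cong (λ w → w y) (replaceRow-id M k x)))
                       (sym (trans (cong (det M *_) (δ-diag k)) (*-identityʳ _)))
    ... | no k≢i = trans (det-equal-rows (replaceRow M i (M k)) k i k≢i
                       (λ y → cong (λ w → w y) (trans (replaceRow-other M i (M k) k k≢i)
                          (sym (replaceRow-same M i (M k))))))
                     (sym (trans (cong (det M *_) (δ-off k≢i)) (*-zeroʳ (det M))))

-- For `E` = `δ` the linear coefficient is the trace of the adjugate: Jacobi's formula for the
-- derivative of the characteristic polynomial.
det-first-order : ∀ {n} (M E : Matrix n) h → Σ ℤ λ e →
  det (λ i j → M i j + h * E i j) ≡
  det M + h * sumFin (λ i → det (replaceRow M i (E i))) + h * h * e
det-first-order {zero}  M E h = 0ℤ , lem h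
  where lem : ∀ h → 1ℤ ≡ 1ℤ + h * 0ℤ + h * h * 0ℤ
        lem = solve-∀
det-first-order {suc n} M E h = sumFin e , (begin
  sumFin (λ j → sgn j * (M zero j + h * E zero j) * det (λ i k → minor M j i k + h * minor E j i k))
    ≡⟨ sum-cong (λ j → trans
         (cong (sgn j * (M zero j + h * E zero j) *_) (proj₂ (ih j)))
         (lem (sgn j) (M zero j) (E zero j) h (d j) (d' j) (proj₁ (ih j)))) ⟩
  sumFin (λ j → (sgn j * M zero j * d j + h * (sgn j * E zero j * d j + sgn j * M zero j * d' j)) + h * h * e j)
    ≡⟨ trans (sum-+ (λ j → u j + h * (v j + w j)) (λ j → h * h * e j)) (cong₂ _+_
         (trans (sum-+ u (λ j → h * (v j + w j))) (cong (λ x → det M + x)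
           (trans (sum-*ˡ h (λ j → v j + w j)) (cong (h *_)
             (trans (sum-+ v w) (cong (λ x → sumFin v + x) lower))))))
         (sum-*ˡ (h * h) e)) ⟩
  det M + h * (sumFin v + sumFin (λ i → det (replaceRow M (suc i) (E (suc i))))) + h * h * sumFin e ∎)
  where
    ih : ∀ j → _
    ih j = det-first-order (minor M j) (minor E j) h
    d d' e u v w : Fin (suc n) → ℤ
    d j = det (minor M j)
    d' j = sumFin (λ i → det (replaceRow (minor M j) i (minor E j i)))
    e j = sgn j * M zero j * proj₁ (ih j) + sgn j * E zero j * d' j + h * (sgn j * E zero j * proj₁ (ih j))
    u j = sgn j * M zero j * d j
    v j = sgn j * E zero j * d j
    w j = sgn j * M zero j * d' j
    lem : ∀ s m x h d d' e → s * (m + h * x) * (d + h * d' + h * h * e) ≡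
      (s * m * d + h * (s * x * d + s * m * d')) + h * h * (s * m * e + s * x * d' + h * (s * x * e))
    lem = solve-∀
    lower : sumFin w ≡ sumFin (λ i → det (replaceRow M (suc i) (E (suc i))))
    lower = trans
      (sum-cong (λ j → sym (sum-*ˡ (sgn j * M zero j) (λ i → det (replaceRow (minor M j) i (minor E j i))))))
      (trans (sum-swap (λ j i → sgn j * M zero j * det (replaceRow (minor M j) i (minor E j i))))
        (sum-cong (λ i → sym (det-replaceRow-suc M i (E (suc i))))))

-- Matrices

infix 4 _≋_
infixl 7 _·_

_≋_ : ∀ {n} → Matrix n → Matrix n → Set
X ≋ Y = ∀ i j → X i j ≡ Y i j

_·_ : ∀ {n} → Matrix n → Matrix n → Matrix n
(X · Y) i j = sumFin (λ k → X i k * Y k j)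

tr : ∀ {n} → Matrix n → ℤ
tr X = sumFin (λ i → X i i)

Symmetric : ∀ {n} → Matrix n → Set
Symmetric X = ∀ i j → X i j ≡ X j i

tr-cong : ∀ {n} {X Y : Matrix n} → X ≋ Y → tr X ≡ tr Y
tr-cong h = sum-cong (λ i → h i i)

·-cong : ∀ {n} {X X′ Y Y′ : Matrix n} → X ≋ X′ → Y ≋ Y′ → X · Y ≋ X′ · Y′
·-cong p q i j = sum-cong (λ k → cong₂ _*_ (p i k) (q k j))

·-assoc : ∀ {n} (X Y Z : Matrix n) → (X · Y) · Z ≋ X · (Y · Z)
·-assoc X Y Z i j = begin
  sumFin (λ k → sumFin (λ l → X i l * Y l k) * Z k j)
    ≡⟨ sum-cong (λ k → sym (sum-*ʳ (Z k j) (λ l → X i l * Y l k))) ⟩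
  sumFin (λ k → sumFin (λ l → X i l * Y l k * Z k j))
    ≡⟨ sum-swap (λ k l → X i l * Y l k * Z k j) ⟩
  sumFin (λ l → sumFin (λ k → X i l * Y l k * Z k j))
    ≡⟨ sum-cong (λ l → trans (sum-cong (λ k → *-assoc (X i l) (Y l k) (Z k j)))
         (sum-*ˡ (X i l) (λ k → Y l k * Z k j))) ⟩
  sumFin (λ l → X i l * sumFin (λ k → Y l k * Z k j)) ∎

·-identityˡ : ∀ {n} (X : Matrix n) → δ · X ≋ X
·-identityˡ X i j = sum-δ i (λ k → X k j)

·-identityʳ : ∀ {n} (X : Matrix n) → X · δ ≋ X
·-identityʳ X i j = trans
  (sum-cong (λ k → trans (*-comm (X i k) (δ k j)) (cong (_* X i k) (δ-sym k j))))
  (sum-δ j (λ k → X i k))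

·-distribˡ : ∀ {n} (X Y Z : Matrix n) → X · (λ i j → Y i j + Z i j) ≋ (λ i j → (X · Y) i j + (X · Z) i j)
·-distribˡ X Y Z i j = trans (sum-cong (λ k → *-distribˡ-+ (X i k) (Y k j) (Z k j)))
  (sum-+ (λ k → X i k * Y k j) (λ k → X i k * Z k j))

·-distribʳ : ∀ {n} (X Y Z : Matrix n) → (λ i j → Y i j + Z i j) · X ≋ (λ i j → (Y · X) i j + (Z · X) i j)
·-distribʳ X Y Z i j = trans (sum-cong (λ k → *-distribʳ-+ (X k j) (Y i k) (Z i k)))
  (sum-+ (λ k → Y i k * X k j) (λ k → Z i k * X k j))

·-scaleˡ : ∀ {n} c (X Y : Matrix n) → (λ i j → c * X i j) · Y ≋ (λ i j → c * (X · Y) i j)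
·-scaleˡ c X Y i j = trans (sum-cong (λ k → *-assoc c (X i k) (Y k j))) (sum-*ˡ c (λ k → X i k * Y k j))

·-scaleʳ : ∀ {n} c (X Y : Matrix n) → X · (λ i j → c * Y i j) ≋ (λ i j → c * (X · Y) i j)
·-scaleʳ c X Y i j = trans (sum-cong (λ k → lem (X i k) c (Y k j))) (sum-*ˡ c (λ k → X i k * Y k j))
  where lem : ∀ x c y → x * (c * y) ≡ c * (x * y)
        lem = solve-∀

·-transpose : ∀ {n} {X Y : Matrix n} → Symmetric X → Symmetric Y → ∀ i j → (X · Y) i j ≡ (Y · X) j i
·-transpose {X = X} {Y} sX sY i j = sum-cong (λ k →
  trans (*-comm (X i k) (Y k j)) (cong₂ _*_ (sY k j) (sX i k)))

-- For symmetric X the trace of X² is the sum of the squares of all entries. This is what makes the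
-- ring of polynomials in A reduced.
tr-sq-zero : ∀ {n} {X : Matrix n} → Symmetric X → tr (X · X) ≡ 0ℤ → ∀ i j → X i j ≡ 0ℤ
tr-sq-zero {X = X} sX e i = sum-sq-zero (X i)
  (sum-nonneg-zero (λ i → sum-nonneg (λ k → sq-nonneg (X i k)))
    (trans (sum-cong (λ i → sum-cong (λ k → cong (X i k *_) (sX i k)))) e) i)

-- The symmetric matrices in the bicommutant of a symmetric matrix A form a commutative
-- ring; it plays the role of the ring of polynomials in A.
module Bicommutant {n} (A : Matrix n) (A-sym : Symmetric A) where

  record Elt : Set where
    constructor elt
    field
      mat     : Matrix n
      mat-sym : Symmetric mat
      commute : ∀ Y → Y · A ≋ A · Y → mat · Y ≋ Y · mat
  open Elt public

  private
    _⊞_ _⊠_ : Elt → Elt → Elt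
    ⊟_ : Elt → Elt

    -- `Y` commutes with A because A commutes with itself; hence `X` commutes with `Y`.
    commuting : ∀ (X Y : Elt) → mat X · mat Y ≋ mat Y · mat X
    commuting X Y = commute X (mat Y) (commute Y A (λ i j → refl))

    elt X sX cX ⊞ elt Y sY cY = elt (λ i j → X i j + Y i j) (λ i j → cong₂ _+_ (sX i j) (sY i j))
      (λ Z h i j → trans (·-distribʳ Z X Y i j)
        (trans (cong₂ _+_ (cX Z h i j) (cY Z h i j)) (sym (·-distribˡ Z X Y i j))))

    X ⊠ Y = elt (mat X · mat Y)
      (λ i j → trans (·-transpose (mat-sym X) (mat-sym Y) i j) (commuting Y X j i))
      (λ Z h i j → trans (·-assoc (mat X) (mat Y) Z i j)
        (trans (·-cong {X = mat X} (λ _ _ → refl) (commute Y Z h) i j)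
        (trans (sym (·-assoc (mat X) Z (mat Y) i j))
        (trans (·-cong {Y = mat Y} (commute X Z h) (λ _ _ → refl) i j)
        (·-assoc Z (mat X) (mat Y) i j)))))

    ⊟ elt X sX cX = elt (λ i j → - X i j) (λ i j → cong -_ (sX i j))
      (λ Z h i j → trans (negˡ Z i j) (trans (cong -_ (cX Z h i j)) (sym (negʳ Z i j))))
      where
        neg1 : ∀ x → - x ≡ -1ℤ * x
        neg1 = solve-∀
        negˡ : ∀ Z → (λ i j → - X i j) · Z ≋ (λ i j → - (X · Z) i j)
        negˡ Z i j = trans (sum-cong (λ k → cong (_* Z k j) (neg1 (X i k))))
          (trans (·-scaleˡ -1ℤ X Z i j) (sym (neg1 ((X · Z) i j))))
        negʳ : ∀ Z → Z · (λ i j → - X i j) ≋ (λ i j → - (Z · X) i j)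
        negʳ Z i j = trans (sum-cong (λ k → cong (Z i k *_) (neg1 (X k j))))
          (trans (·-scaleʳ -1ℤ Z X i j) (sym (neg1 ((Z · X) i j))))

  scalar : ℤ → Elt
  scalar c = elt (λ i j → c * δ i j) (λ i j → cong (c *_) (δ-sym i j))
    (λ Z _ i j → trans (·-scaleˡ c δ Z i j) (trans (cong (c *_)
      (trans (·-identityˡ Z i j) (sym (·-identityʳ Z i j)))) (sym (·-scaleʳ c Z δ i j))))

  gen : Elt
  gen = elt A A-sym (λ Y h i j → sym (h i j))

  ring : CommutativeRing 0ℓ 0ℓ
  ring = record
    { Carrier = Elt
    ; _≈_ = λ X Y → mat X ≋ mat Y
    ; _+_ = _⊞_ ; _*_ = _⊠_ ; -_ = ⊟_ ; 0# = scalar 0ℤ ; 1# = scalar 1ℤ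
    ; isCommutativeRing = record
      { isRing = record
        { +-isAbelianGroup = record
          { isGroup = record
            { isMonoid = record
              { isSemigroup = record
                { isMagma = record
                  { isEquivalence = record
                    { refl = λ _ _ → refl ; sym = λ p i j → sym (p i j) ; trans = λ p q i j → trans (p i j) (q i j) }
                  ; ∙-cong = λ p q i j → cong₂ _+_ (p i j) (q i j) }
                ; assoc = λ X Y Z i j → +-assoc (mat X i j) (mat Y i j) (mat Z i j) }
              ; identity = (λ X i j → lem0ˡ (δ i j) (mat X i j)) , (λ X i j → lem0ʳ (δ i j) (mat X i j)) }
            ; inverse = (λ X i j → lem-ˡ (δ i j) (mat X i j)) , (λ X i j → lem-ʳ (δ i j) (mat X i j))
            ; ⁻¹-cong = λ p i j → cong -_ (p i j) }
          ; comm = λ X Y i j → +-comm (mat X i j) (mat Y i j) }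
        ; *-cong = λ p q → ·-cong p q
        ; *-assoc = λ X Y Z → ·-assoc (mat X) (mat Y) (mat Z)
        ; *-identity = (λ X i j → trans (·-scaleˡ 1ℤ δ (mat X) i j) (trans (*-identityˡ _) (·-identityˡ (mat X) i j)))
                     , (λ X i j → trans (·-scaleʳ 1ℤ (mat X) δ i j) (trans (*-identityˡ _) (·-identityʳ (mat X) i j)))
        ; distrib = (λ X Y Z → ·-distribˡ (mat X) (mat Y) (mat Z))
                  , (λ X Y Z → ·-distribʳ (mat X) (mat Y) (mat Z)) }
      ; *-comm = commuting } }
    where
      lem0ˡ : ∀ d x → 0ℤ * d + x ≡ x
      lem0ˡ = solve-∀
      lem0ʳ : ∀ d x → x + 0ℤ * d ≡ x
      lem0ʳ = solve-∀
      lem-ˡ : ∀ d x → - x + x ≡ 0ℤ * d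
      lem-ˡ = solve-∀
      lem-ʳ : ∀ d x → x + - x ≡ 0ℤ * d
      lem-ʳ = solve-∀

  scalar-hom : CommutativeRing.rawRing +-*-commutativeRing -Raw-AlmostCommutative⟶ fromCommutativeRing ring
  scalar-hom = record
    { ⟦_⟧ = scalar
    ; +-homo = λ c d i j → *-distribʳ-+ (δ i j) c d
    ; *-homo = λ c d i j → sym (trans (·-scaleˡ c δ (mat (scalar d)) i j)
        (trans (cong (c *_) (·-identityˡ (mat (scalar d)) i j)) (sym (*-assoc c d (δ i j)))))
    ; -‿homo = λ c i j → sym (neg-distribˡ-* c (δ i j))
    ; 0-homo = λ _ _ → refl
    ; 1-homo = λ _ _ → refl }

  module R = CommutativeRing ring

  tr-+ : ∀ X Y → tr (mat (X R.+ Y)) ≡ tr (mat X) + tr (mat Y)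
  tr-+ X Y = sum-+ (λ i → mat X i i) (λ i → mat Y i i)

  mat-scale : ∀ c X → mat (scalar c R.* X) ≋ (λ i j → c * mat X i j)
  mat-scale c X i j = trans (·-scaleˡ c δ (mat X) i j) (cong (c *_) (·-identityˡ (mat X) i j))

  tr-scalar : ∀ c → tr (mat (scalar c)) ≡ c * + n
  tr-scalar c = trans (sum-*ˡ {n} c (λ i → δ i i)) (cong (c *_)
    (trans (sum-cong {n} (λ i → δ-diag i)) (trans (sum-const {n} 1ℤ) (*-identityʳ (+ n)))))

  sq-zero-elt : ∀ X → X R.* X R.≈ R.0# → X R.≈ R.0#
  sq-zero-elt X h = tr-sq-zero (mat-sym X) (trans (tr-cong h) (tr-scalar 0ℤ))

  -- An expression built from scalars, such as the coefficients left by the solver, is a scalar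
  -- matrix only up to `R.≈`; this tracks its integer value. The record wrapper keeps `X` and `v`
  -- recoverable by unification.
  record IsScalar (X : Elt) (v : ℤ) : Set where
    constructor is-scalar
    field ≈scalar : X R.≈ scalar v
  open IsScalar public

  infixl 6 _⊕_ _⊝_
  infixl 7 _⊛_

  private module H = _-Raw-AlmostCommutative⟶_ scalar-hom

  _⊕_ : ∀ {X Y u v} → IsScalar X u → IsScalar Y v → IsScalar (X R.+ Y) (u + v)
  _⊕_ {X} {Y} {u} {v} (is-scalar hX) (is-scalar hY) = is-scalar
    (R.trans {X R.+ Y} {scalar u R.+ scalar v} {scalar (u + v)}
      (R.+-cong {X} {scalar u} {Y} {scalar v} hX hY) (λ i j → sym (H.+-homo u v i j)))

  _⊛_ : ∀ {X Y u v} → IsScalar X u → IsScalar Y v → IsScalar (X R.* Y) (u * v)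
  _⊛_ {X} {Y} {u} {v} (is-scalar hX) (is-scalar hY) = is-scalar
    (R.trans {X R.* Y} {scalar u R.* scalar v} {scalar (u * v)}
      (R.*-cong {X} {scalar u} {Y} {scalar v} hX hY) (λ i j → sym (H.*-homo u v i j)))

  sc-neg : ∀ {X u} → IsScalar X u → IsScalar (R.- X) (- u)
  sc-neg {X} {u} (is-scalar hX) = is-scalar
    (R.trans {R.- X} {R.- scalar u} {scalar (- u)}
      (R.-‿cong {X} {scalar u} hX) (λ i j → sym (H.-‿homo u i j)))

  _⊝_ : ∀ {X Y u v} → IsScalar X u → IsScalar Y v → IsScalar (X R.- Y) (u - v)
  hX ⊝ hY = hX ⊕ sc-neg hY

  sc : ∀ v → IsScalar (scalar v) v
  sc v = is-scalar (λ _ _ → refl)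

  mat-scale′ : ∀ {K v} → IsScalar K v → ∀ X → mat (K R.* X) ≋ (λ i j → v * mat X i j)
  mat-scale′ {K} {v} (is-scalar hK) X i j =
    trans (R.*-cong {K} {scalar v} {X} {X} hK (λ _ _ → refl) i j) (mat-scale v X i j)

  tr-scale′ : ∀ {K v} → IsScalar K v → ∀ X → tr (mat (K R.* X)) ≡ v * tr (mat X)
  tr-scale′ {v = v} hK X = trans (tr-cong (mat-scale′ hK X)) (sum-*ˡ v (λ i → mat X i i))

  τ₁ τ₂ τ₃ : ℤ
  τ₁ = tr A
  τ₂ = tr (A · A)
  τ₃ = tr (A · (A · A))

  tr-cubic : ∀ {k₃ k₂ k₁ k₀ v₃ v₂ v₁ v₀} →
    IsScalar k₃ v₃ → IsScalar k₂ v₂ → IsScalar k₁ v₁ → IsScalar k₀ v₀ →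
    tr (mat (k₃ R.* (gen R.* (gen R.* gen)) R.+ k₂ R.* (gen R.* gen) R.+ k₁ R.* gen R.+ k₀)) ≡
    v₃ * τ₃ + v₂ * τ₂ + v₁ * τ₁ + v₀ * + n
  tr-cubic {k₃} {k₂} {k₁} {k₀} {v₀ = v₀} h₃ h₂ h₁ h₀ =
    trans (tr-+ (k₃ R.* (gen R.* (gen R.* gen)) R.+ k₂ R.* (gen R.* gen) R.+ k₁ R.* gen) k₀) (cong₂ _+_
      (trans (tr-+ (k₃ R.* (gen R.* (gen R.* gen)) R.+ k₂ R.* (gen R.* gen)) (k₁ R.* gen)) (cong₂ _+_
        (trans (tr-+ (k₃ R.* (gen R.* (gen R.* gen))) (k₂ R.* (gen R.* gen)))
          (cong₂ _+_ (tr-scale′ h₃ (gen R.* (gen R.* gen))) (tr-scale′ h₂ (gen R.* gen))))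
        (tr-scale′ h₁ gen)))
      (trans (tr-cong (≈scalar h₀)) (tr-scalar v₀)))

-- From the characteristic polynomial to traces

norm : ∀ {n} → (Fin n → ℤ) → ℤ
norm r = sumFin (λ i → + ∣ r i ∣)

norm-nonneg : ∀ {n} (r : Fin n → ℤ) → 0ℤ ≤ norm r
norm-nonneg r = sum-nonneg {f = λ i → + ∣ r i ∣} (λ i → +≤+ ℕ.z≤n)

abs-sum : ∀ {n} (f : Fin n → ℤ) → + ∣ sumFin f ∣ ≤ norm f
abs-sum {zero}  f = ≤-refl
abs-sum {suc n} f = ≤-trans (+≤+ (∣i+j∣≤∣i∣+∣j∣ (f zero) _))
  (+-monoʳ-≤ (+ ∣ f zero ∣) (abs-sum (λ i → f (suc i))))

-- Write ‖·‖ for the ℓ¹-norm `norm`. Row i gives t |r i| ≤ |c i| + ‖r‖, and summation gives (t - n)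
-- ‖r‖ ≤ ‖c‖ < t - n. So ‖r‖ < 1, and an integer vector of norm below 1 is zero.
resolvent-injective : ∀ {n} (A : Matrix n) → (∀ i j → ∣ A i j ∣ ℕ.≤ 1) →
  ∀ (t : ℕ) (r c : Fin n → ℤ) → + n + norm c < + t →
  (∀ i → sumFin (λ j → (+ t * δ i j - A i j) * r j) ≡ c i) → ∀ i → r i ≡ 0ℤ
resolvent-injective {n} A bounded t r c large h i =
  ∣i∣≡0⇒i≡0 (+-injective (sum-nonneg-zero (λ i → +≤+ ℕ.z≤n) norm-zero i))
  where
    row : ∀ i → + t * r i ≡ c i + sumFin (λ j → A i j * r j)
    row i = cancel-by (+ t * r i) (c i + sumFin (λ j → A i j * r j))
      (trans (sym expand) (h i))
      (lem₂ (+ t * r i) (c i) (sumFin (λ j → A i j * r j)))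
      where
        lem : ∀ t d a r → (t * d - a) * r ≡ d * (t * r) + -1ℤ * (a * r)
        lem = solve-∀
        lem₂ : ∀ x c y → x - (c + y) ≡ (x + -1ℤ * y) - c
        lem₂ = solve-∀
        expand : sumFin (λ j → (+ t * δ i j - A i j) * r j) ≡ + t * r i + -1ℤ * sumFin (λ j → A i j * r j)
        expand = begin
          sumFin (λ j → (+ t * δ i j - A i j) * r j)
            ≡⟨ sum-cong (λ j → lem (+ t) (δ i j) (A i j) (r j)) ⟩
          sumFin (λ j → δ i j * (+ t * r j) + -1ℤ * (A i j * r j))
            ≡⟨ sum-+ (λ j → δ i j * (+ t * r j)) (λ j → -1ℤ * (A i j * r j)) ⟩
          sumFin (λ j → δ i j * (+ t * r j)) + sumFin (λ j → -1ℤ * (A i j * r j))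
            ≡⟨ cong₂ _+_ (sum-δ i (λ j → + t * r j)) (sum-*ˡ -1ℤ (λ j → A i j * r j)) ⟩
          + t * r i + -1ℤ * sumFin (λ j → A i j * r j) ∎
    entry : ∀ i → + t * + ∣ r i ∣ ≤ + ∣ c i ∣ + norm r
    entry i = subst (_≤ + ∣ c i ∣ + norm r)
      (trans (cong +_ (trans (cong ∣_∣ (sym (row i))) (abs-* (+ t) (r i)))) (pos-* t ∣ r i ∣))
      (≤-trans (+≤+ (∣i+j∣≤∣i∣+∣j∣ (c i) (sumFin (λ j → A i j * r j))))
        (+-monoʳ-≤ (+ ∣ c i ∣) (≤-trans (abs-sum (λ j → A i j * r j))
          (sum-mono (λ j → +≤+ (subst (ℕ._≤ ∣ r j ∣) (sym (abs-* (A i j) (r j)))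
            (subst (∣ A i j ∣ ℕ.* ∣ r j ∣ ℕ.≤_) (ℕ.*-identityˡ ∣ r j ∣) (ℕ.*-monoˡ-≤ ∣ r j ∣ (bounded i j)))))))))
    total : + t * norm r ≤ norm c + + n * norm r
    total = subst₂ _≤_ (sum-*ˡ (+ t) (λ i → + ∣ r i ∣))
      (trans (sum-+ (λ i → + ∣ c i ∣) (λ _ → norm r)) (cong (λ w → norm c + w) (sum-const {n} (norm r))))
      (sum-mono entry)
    norm-zero : norm r ≡ 0ℤ
    norm-zero with norm r ≤? 0ℤ
    ... | yes r≤0 = ≤-antisym r≤0 (norm-nonneg r)
    ... | no r≰0 = contradiction contra (<-irrefl refl)
      where
        norm≥1 : 1ℤ ≤ norm r
        norm≥1 = i<j⇒suc[i]≤j (≰⇒> r≰0)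
        gap : 0ℤ ≤ + t - + n
        gap = i≤j⇒0≤j-i (≤-trans (subst (_≤ + n + norm c) (+-identityʳ (+ n)) (+-monoʳ-≤ (+ n) (norm-nonneg c)))
          (<⇒≤ large))
        contra : norm c < norm c
        contra = <-≤-trans (subst₂ _<_ (lem₁ (+ n) (norm c)) (lem₂ (+ t) (+ n)) (+-monoˡ-< (- + n) large))
          (≤-trans (*-monoˡ-≤-nonNeg (+ t - + n) {{nonNegative gap}} norm≥1)
            (subst₂ _≤_ (lem₃ (+ t) (+ n) (norm r)) (lem₄ (norm c) (+ n * norm r))
              (+-monoˡ-≤ (- (+ n * norm r)) total)))
          where
            lem₁ : ∀ n c → n + c + - n ≡ c
            lem₁ = solve-∀
            lem₂ : ∀ t n → t + - n ≡ (t - n) * 1ℤ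
            lem₂ = solve-∀
            lem₃ : ∀ t n r → t * r + - (n * r) ≡ (t - n) * r
            lem₃ = solve-∀
            lem₄ : ∀ c x → c + x + - x ≡ c
            lem₄ = solve-∀

-- Derivatives of integer functions

Derivative : (ℤ → ℤ) → ℤ → ℤ → Set
Derivative u u′ t = ∀ h → Σ ℤ λ e → u (t + h) ≡ u t + h * u′ + h * h * e

-- The two expansions show that h divides u′ - v′ for every nonzero h; the choice h = |u′ - v′| + 1
-- is too large to divide anything but 0.
derivative-unique : ∀ u v {u′ v′ t} → (∀ t → u t ≡ v t) →
  Derivative u u′ t → Derivative v v′ t → u′ ≡ v′
derivative-unique u v {u′} {v′} {t} same du dv = i-j≡0⇒i≡j u′ v′ (small (e₂ - e₁) factor)
  where
    h : ℤ
    h = + suc ∣ u′ - v′ ∣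
    e₁ e₂ : ℤ
    e₁ = proj₁ (du h)
    e₂ = proj₁ (dv h)
    factor : u′ - v′ ≡ h * (e₂ - e₁)
    factor = *-cancelˡ-≡ h (u′ - v′) (h * (e₂ - e₁))
      (cancel-by (h * (u′ - v′)) (h * (h * (e₂ - e₁)))
        (trans (sym (proj₂ (du h))) (trans (same (t + h)) (trans (proj₂ (dv h))
          (cong (λ w → w + h * v′ + h * h * e₂) (sym (same t))))))
        (lem h u′ v′ e₁ e₂ (u t)))
      where lem : ∀ h x y e f w → h * (x - y) - h * (h * (f - e)) ≡
                    (w + h * x + h * h * e) - (w + h * y + h * h * f)
            lem = solve-∀
    small : ∀ k → u′ - v′ ≡ h * k → u′ - v′ ≡ 0ℤ
    small k e = go ∣ k ∣ refl
      where
        go : ∀ m → ∣ k ∣ ≡ m → u′ - v′ ≡ 0ℤ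
        go zero    eq = trans e (trans (cong (h *_) (∣i∣≡0⇒i≡0 {k} eq)) (*-zeroʳ h))
        go (suc m) eq = contradiction (ℕ.≤-trans (ℕ.m≤m*n (suc ∣ u′ - v′ ∣) (suc m))
            (ℕ.≤-reflexive (sym (trans (cong ∣_∣ e) (trans (abs-* h k) (cong (suc ∣ u′ - v′ ∣ ℕ.*_) eq))))))
          (ℕ.<-irrefl refl)

derivative-* : ∀ u v {u′ v′ t} → Derivative u u′ t → Derivative v v′ t →
  Derivative (λ s → u s * v s) (u′ * v t + u t * v′) t
derivative-* u v {u′} {v′} {t} du dv h =
  u′ * v′ + u t * f + e * v t + h * (u′ * f + e * v′) + h * h * (e * f) ,
  trans (cong₂ _*_ (proj₂ (du h)) (proj₂ (dv h))) (lem h (u t) u′ e (v t) v′ f)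
  where
    e f : ℤ
    e = proj₁ (du h)
    f = proj₁ (dv h)
    lem : ∀ h u u′ e v v′ f → (u + h * u′ + h * h * e) * (v + h * v′ + h * h * f) ≡
      u * v + h * (u′ * v + u * v′) + h * h * (u′ * v′ + u * f + e * v + h * (u′ * f + e * v′) + h * h * (e * f))
    lem = solve-∀

derivative-shift : ∀ c t → Derivative (λ s → s + c) 1ℤ t
derivative-shift c t h = 0ℤ , lem t h c
  where lem : ∀ t h c → t + h + c ≡ t + c + h * 1ℤ + h * h * 0ℤ
        lem = solve-∀

-- The value is fixed only after multiplication by t + c, which avoids the exponent k - 1 at k = 0
-- and is the form that the logarithmic derivative calls for.
derivative-^ : ∀ c k t → Σ ℤ λ d → Derivative (λ s → (s + c) ^ k) d t × d * (t + c) ≡ + k * (t + c) ^ k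
derivative-^ c zero t = 0ℤ , (λ h → 0ℤ , lem h) , refl
  where lem : ∀ h → 1ℤ ≡ 1ℤ + h * 0ℤ + h * h * 0ℤ
        lem = solve-∀
derivative-^ c (suc k) t with derivative-^ c k t
... | d , dd , e = 1ℤ * (t + c) ^ k + (t + c) * d , derivative-* (_+ c) (λ s → (s + c) ^ k) {t = t} (derivative-shift c t) dd ,
  trans (lem₁ (t + c) ((t + c) ^ k) d) (trans (cong (λ w → (t + c) * (t + c) ^ k + (t + c) * w) e)
    (lem₂ (t + c) ((t + c) ^ k) (+ k)))
  where lem₁ : ∀ x y d → (1ℤ * y + x * d) * x ≡ x * y + x * (d * x)
        lem₁ = solve-∀
        lem₂ : ∀ x y k → x * y + x * (k * y) ≡ (1ℤ + k) * (x * y)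
        lem₂ = solve-∀

derivative-quad : ∀ c p t → Derivative (λ s → s * s - c * s + p) (+ 2 * t - c) t
derivative-quad c p t h = 1ℤ , lem c p t h
  where lem : ∀ c p t h → (t + h) * (t + h) - c * (t + h) + p ≡
                t * t - c * t + p + h * (+ 2 * t - c) + h * h * 1ℤ
        lem = solve-∀

derivative-charPoly : ∀ {n} (A : Matrix n) t →
  Derivative (charPolyAt A) (tr (adjugate (λ i j → t * δ i j - A i j))) t
derivative-charPoly A t h = proj₁ expansion ,
  trans (det-cong (λ i j → lem t h (δ i j) (A i j))) (proj₂ expansion)
  where
    expansion = det-first-order (λ i j → t * δ i j - A i j) δ h
    lem : ∀ t h d a → (t + h) * d - a ≡ t * d - a + h * d
    lem = solve-∀

-- Three consecutive arguments suffice: the second difference is 2γ, after which β and α follow.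
quadratic-vanishes : ∀ (α β γ : ℤ) (T : ℕ) → (∀ u → let t = + (T ℕ.+ u) in α + β * t + γ * (t * t) ≡ 0ℤ) →
  α ≡ 0ℤ × β ≡ 0ℤ × γ ≡ 0ℤ
quadratic-vanishes α β γ T h = α0 , β0 , γ0
  where
    val : ℤ → ℤ
    val t = α + β * t + γ * (t * t)
    h0 : val (+ T) ≡ 0ℤ
    h0 = subst (λ m → val (+ m) ≡ 0ℤ) (ℕ.+-identityʳ T) (h 0)
    h1 : val (+ T + 1ℤ) ≡ 0ℤ
    h1 = h 1
    h2 : val (+ T + + 2) ≡ 0ℤ
    h2 = h 2
    γ0 : γ ≡ 0ℤ
    γ0 = *-cancelˡ-≡ (+ 2) γ 0ℤ (trans (lem α β γ (+ T))
      (trans (cong₂ (λ x y → x - + 2 * y + val (+ T)) h2 h1) (trans (+-identityˡ (val (+ T))) h0)))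
      where
        lem : ∀ α β γ t → + 2 * γ ≡
          (α + β * (t + + 2) + γ * ((t + + 2) * (t + + 2)))
          - + 2 * (α + β * (t + 1ℤ) + γ * ((t + 1ℤ) * (t + 1ℤ))) + (α + β * t + γ * (t * t))
        lem = solve-∀
    β0 : β ≡ 0ℤ
    β0 = trans (lem α β γ (+ T)) (trans (cong₂ (λ x y → x - y - γ * (+ 2 * + T + 1ℤ)) h1 h0)
      (cong (λ g → 0ℤ - g * (+ 2 * + T + 1ℤ)) γ0))
      where
        lem : ∀ α β γ t → β ≡ (α + β * (t + 1ℤ) + γ * ((t + 1ℤ) * (t + 1ℤ))) - (α + β * t + γ * (t * t))
          - γ * (+ 2 * t + 1ℤ)
        lem = solve-∀
    α0 : α ≡ 0ℤ
    α0 = trans (lem α β γ (+ T)) (trans (cong (λ x → x - β * + T - γ * (+ T * + T)) h0)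
      (cong₂ (λ b g → 0ℤ - b * + T - g * (+ T * + T)) β0 γ0))
      where
        lem : ∀ α β γ t → α ≡ (α + β * t + γ * (t * t)) - β * t - γ * (t * t)
        lem = solve-∀

quad-nonzero : ∀ c p (m : ℕ) → ∣ c ∣ ℕ.+ ∣ p ∣ ℕ.< m → + m * + m - c * + m + p ≢ 0ℤ
quad-nonzero c p m large e = go ∣ + m - c ∣ refl
  where
    lem : ∀ m c p → m * (m - c) - - p ≡ (m * m - c * m + p) - 0ℤ
    lem = solve-∀
    abs-p : ∣ p ∣ ≡ m ℕ.* ∣ + m - c ∣
    abs-p = sym (trans (sym (abs-* (+ m) (+ m - c)))
      (trans (cong ∣_∣ (cancel-by (+ m * (+ m - c)) (- p) e (lem (+ m) c p))) (∣-i∣≡∣i∣ p)))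
    go : ∀ d → ∣ + m - c ∣ ≡ d → ⊥
    go zero eq = ℕ.<-irrefl refl (ℕ.≤-trans large (ℕ.≤-trans (ℕ.≤-reflexive
      (cong ∣_∣ (i-j≡0⇒i≡j (+ m) c (∣i∣≡0⇒i≡0 {+ m - c} eq)))) (ℕ.m≤m+n ∣ c ∣ ∣ p ∣)))
    go (suc k) eq = ℕ.<-irrefl refl (ℕ.≤-trans large (ℕ.≤-trans (ℕ.m≤m*n m (suc k))
      (ℕ.≤-trans (ℕ.≤-reflexive (sym (trans abs-p (cong (m ℕ.*_) eq)))) (ℕ.m≤n+m ∣ p ∣ ∣ c ∣))))

^-nonzero : ∀ x k → x ≢ 0ℤ → x ^ k ≢ 0ℤ
^-nonzero x zero    ne ()
^-nonzero x (suc k) ne e = [ ne , ^-nonzero x k ne ]′ (i*j≡0⇒i≡0∨j≡0 x e)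

-- Cayley-Hamilton and the power sums of the eigenvalues

module Spectrum {n} (A : Matrix n) (A-sym : Symmetric A) (bounded : ∀ i j → ∣ A i j ∣ ℕ.≤ 1)
  (a b : ℕ) (c p : ℤ) (size : a ℕ.+ b ℕ.+ 2 ≡ n)
  (charPoly : ∀ t → charPolyAt A t ≡ (t - 1ℤ) ^ a * (t + 1ℤ) ^ b * (t * t - c * t + p)) where

  open Bicommutant A A-sym
  open RingIdentities ring scalar-hom

  char : ℤ → Matrix n
  char t i j = t * δ i j - A i j

  polyA : Elt
  polyA = poly a b (scalar c) (scalar p) gen

  sc-pow : ∀ {X u} k → IsScalar X u → IsScalar (pow X k) (u ^ k)
  sc-pow zero    hX = sc 1ℤ
  sc-pow (suc k) hX = hX ⊛ sc-pow k hX

  charPoly-scalar : ∀ t → IsScalar (poly a b (scalar c) (scalar p) (scalar t)) (charPolyAt A t)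
  charPoly-scalar t = subst (IsScalar _) (sym (charPoly t))
    (sc-pow a (sc t ⊝ sc 1ℤ) ⊛ sc-pow b (sc t ⊕ sc 1ℤ) ⊛ (sc t ⊛ sc t ⊝ sc c ⊛ sc t ⊕ sc p))

  char-diff : ∀ (X Y : Matrix n) x {U V : Matrix n} → char x · X ≋ U → char x · Y ≋ V → ∀ u v →
    char x · (λ i j → u * X i j - v * Y i j) ≋ (λ i j → u * U i j - v * V i j)
  char-diff X Y x {U} {V} hX hY u v i j = trans
    (sum-cong (λ k → lem (char x i k) u (X k j) v (Y k j)))
    (trans (sum-+ (λ k → u * (char x i k * X k j)) (λ k → - v * (char x i k * Y k j)))
    (trans (cong₂ _+_ (trans (sum-*ˡ u (λ k → char x i k * X k j)) (cong (u *_) (hX i j)))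
                   (trans (sum-*ˡ (- v) (λ k → char x i k * Y k j)) (cong (- v *_) (hY i j))))
      (cong (λ w → u * U i j + w) (sym (neg-distribˡ-* v (V i j))))))
    where lem : ∀ m u x v y → m * (u * x - v * y) ≡ u * (m * x) + - v * (m * y)
          lem = solve-∀

  -- p(A) = (t − A) · R(t) with R(t) an integer matrix; for t large this forces R(t) = 0.
  cayley-hamilton : polyA R.≈ R.0#
  cayley-hamilton i j = trans (sym (eqn i)) (sum-0 (λ k → trans (cong (char (+ t) i k *_) (vanish k)) (*-zeroʳ (char (+ t) i k))))
    where
      col : Fin n → ℤ
      col i = mat polyA i j
      t : ℕ
      t = suc (n ℕ.+ ∣ norm col ∣)
      X Q : Matrix n
      X = adjugate (char (+ t))
      Q = mat (proj₁ (poly-CongMod a b (scalar c) (scalar p) (scalar (+ t)) gen))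
      hQ : char (+ t) · Q ≋ (λ i j → charPolyAt A (+ t) * δ i j - mat polyA i j)
      hQ i j = cancel-by ((char (+ t) · Q) i j) (charPolyAt A (+ t) * δ i j - mat polyA i j)
        (sym (trans (sym (≈scalar (charPoly-scalar (+ t)) i j))
          (proj₂ (poly-CongMod a b (scalar c) (scalar p) (scalar (+ t)) gen) i j)))
        (lem ((char (+ t) · Q) i j) (mat polyA i j) (charPolyAt A (+ t) * δ i j))
        where lem : ∀ x y z → x - (z - y) ≡ (y + x) - z
              lem = solve-∀
      r : Fin n → ℤ
      r k = 1ℤ * X k j - 1ℤ * Q k j
      eqn : ∀ i → sumFin (λ k → char (+ t) i k * r k) ≡ col i
      eqn i = trans (char-diff X Q (+ t) (adjugate-inverse (char (+ t))) hQ 1ℤ 1ℤ i j)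
        (lem (charPolyAt A (+ t) * δ i j) (mat polyA i j))
        where lem : ∀ x y → 1ℤ * x - 1ℤ * (x - y) ≡ y
              lem = solve-∀
      vanish : ∀ k → r k ≡ 0ℤ
      vanish = resolvent-injective A bounded t r col
        (subst (λ w → + n + w < + t) (0≤i⇒+∣i∣≡i (norm-nonneg col)) (+<+ (ℕ.n<1+n (n ℕ.+ ∣ norm col ∣)))) eqn

  root : quartic (scalar c) (scalar p) gen R.≈ R.0#
  root = pow-zero⇒zero sq-zero-elt (quartic (scalar c) (scalar p) gen) (a ℕ.+ b)
    (quartic-nilpotent a b (scalar c) (scalar p) gen cayley-hamilton)

  -- As F(A) = 0 for F = `quartic`, this is F(t) times the inverse of t - A.
  quotient : ℤ → Elt
  quotient t = quartic-quotient (scalar c) (scalar p) (scalar t) gen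

  quarticAt : ℤ → ℤ
  quarticAt t = (t * t - 1ℤ) * (t * t - c * t + p)

  quotient-inverse : ∀ t → char t · mat (quotient t) ≋ (λ i j → quarticAt t * δ i j)
  quotient-inverse t i j = trans (sym (quartic-factor (scalar c) (scalar p) (scalar t) gen i j))
    (trans (cong₂ _-_ (≈scalar ((sc t ⊛ sc t ⊝ sc 1ℤ) ⊛ (sc t ⊛ sc t ⊝ sc c ⊛ sc t ⊕ sc p)) i j) (root i j))
      (+-identityʳ _))

  -- Multiplied by t - A, both sides become F(t) χ(t) times the identity, χ being the characteristic
  -- polynomial; for t > n the factor can be cancelled by `resolvent-injective` with right-hand side
  -- 0.
  adjugate-quotient : ∀ t → n ℕ.< t → ∀ i j →
    quarticAt (+ t) * adjugate (char (+ t)) i j ≡ charPolyAt A (+ t) * mat (quotient (+ t)) i j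
  adjugate-quotient t n<t i j = i-j≡0⇒i≡j _ _ (resolvent-injective A bounded t
    (λ i → quarticAt (+ t) * X i j - charPolyAt A (+ t) * mat (quotient (+ t)) i j) (λ _ → 0ℤ)
    (subst (_< + t) (sym (trans (cong (λ w → + n + w) (sum-0 {n} {λ _ → 0ℤ} (λ _ → refl))) (+-identityʳ (+ n)))) (+<+ n<t))
    (λ i → trans (char-diff X (mat (quotient (+ t))) (+ t)
        (adjugate-inverse (char (+ t))) (quotient-inverse (+ t)) (quarticAt (+ t)) (charPolyAt A (+ t)) i j)
      (lem (quarticAt (+ t)) (charPolyAt A (+ t)) (δ i j))) i)
    where
      X : Matrix n
      X = adjugate (char (+ t))
      lem : ∀ f p d → f * (p * d) - p * (f * d) ≡ 0ℤ
      lem = solve-∀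

  tr-quotient : ∀ t → tr (mat (quotient t)) ≡
    1ℤ * τ₃ + (t - c) * τ₂ + (t * t - c * t + p - 1ℤ) * τ₁ + (t * t * t - c * (t * t) + (p - 1ℤ) * t + c) * + n
  tr-quotient t = trans (tr-cong {X = mat (quotient t)}
      {mat (scalar 1ℤ R.* (gen R.* (gen R.* gen)) R.+ K₂ R.+ K₁ R.+ K₀)}
      (λ i j → cong (λ w → w + mat K₂ i j + mat K₁ i j + mat K₀ i j)
        (sym (R.*-identityˡ (gen R.* (gen R.* gen)) i j))))
    (tr-cubic (sc 1ℤ) (sc t ⊝ sc c) (sc t ⊛ sc t ⊝ sc c ⊛ sc t ⊕ sc p ⊝ sc 1ℤ)
      (sc t ⊛ sc t ⊛ sc t ⊝ sc c ⊛ (sc t ⊛ sc t) ⊕ (sc p ⊝ sc 1ℤ) ⊛ sc t ⊕ sc c))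
    where
      K₂ K₁ K₀ : Elt
      K₂ = (scalar t R.- scalar c) R.* (gen R.* gen)
      K₁ = (scalar t R.* scalar t R.- scalar c R.* scalar t R.+ scalar p R.- scalar 1ℤ) R.* gen
      K₀ = scalar t R.* scalar t R.* scalar t R.- scalar c R.* (scalar t R.* scalar t)
        R.+ (scalar p R.- scalar 1ℤ) R.* scalar t R.+ scalar c

  -- The trace is F(t) χ′(t) / χ(t), and χ′ / χ = a / (t - 1) + b / (t + 1) + q′ / q. The bounds on
  -- t keep χ(t) away from 0.
  tr-quotient-eigenvalues : ∀ t → n ℕ.< t → ∣ c ∣ ℕ.+ ∣ p ∣ ℕ.< t → 1 ℕ.< t → tr (mat (quotient (+ t))) ≡
    (+ a * (+ t + 1ℤ) + + b * (+ t - 1ℤ)) * (+ t * + t - c * + t + p) + (+ t * + t - 1ℤ) * (+ 2 * + t - c)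
  tr-quotient-eigenvalues t n<t large 1<t = *-cancelˡ-≡ (u * v * q) _ _ {{≢-nonZero uvq≢0}} (begin
    u * v * q * tr (mat (quotient (+ t))) ≡⟨ cong (_* tr (mat (quotient (+ t)))) (sym (charPoly (+ t))) ⟩
    charPolyAt A (+ t) * tr (mat (quotient (+ t))) ≡⟨ sym (sum-*ˡ (charPolyAt A (+ t)) (λ i → mat (quotient (+ t)) i i)) ⟩
    tr (λ i j → charPolyAt A (+ t) * mat (quotient (+ t)) i j)
      ≡⟨ tr-cong (λ i j → sym (adjugate-quotient t n<t i j)) ⟩
    tr (λ i j → quarticAt (+ t) * adjugate (char (+ t)) i j)
      ≡⟨ sum-*ˡ (quarticAt (+ t)) (λ i → adjugate (char (+ t)) i i) ⟩
    quarticAt (+ t) * tr (adjugate (char (+ t))) ≡⟨ cong (quarticAt (+ t) *_) derivative-eq ⟩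
    quarticAt (+ t) * ((d₁ * v + u * d₂) * q + u * v * (+ 2 * + t - c))
      ≡⟨ lem₁ (+ t) u v q d₁ d₂ (+ 2 * + t - c) ⟩
    q * ((d₁ * (+ t - 1ℤ)) * v * (+ t + 1ℤ) * q + (d₂ * (+ t + 1ℤ)) * u * (+ t - 1ℤ) * q
      + (+ t * + t - 1ℤ) * u * v * (+ 2 * + t - c))
      ≡⟨ cong₂ (λ x y → q * (x * v * (+ t + 1ℤ) * q + y * u * (+ t - 1ℤ) * q
           + (+ t * + t - 1ℤ) * u * v * (+ 2 * + t - c))) (proj₂ (proj₂ D₁)) (proj₂ (proj₂ D₂)) ⟩
    q * ((+ a * u) * v * (+ t + 1ℤ) * q + (+ b * v) * u * (+ t - 1ℤ) * q
      + (+ t * + t - 1ℤ) * u * v * (+ 2 * + t - c))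
      ≡⟨ lem₂ (+ t) u v q (+ a) (+ b) (+ 2 * + t - c) ⟩
    u * v * q * ((+ a * (+ t + 1ℤ) + + b * (+ t - 1ℤ)) * q + (+ t * + t - 1ℤ) * (+ 2 * + t - c)) ∎)
    where
      u v q d₁ d₂ : ℤ
      u = (+ t - 1ℤ) ^ a
      v = (+ t + 1ℤ) ^ b
      q = + t * + t - c * + t + p
      D₁ = derivative-^ -1ℤ a (+ t)
      D₂ = derivative-^ 1ℤ b (+ t)
      d₁ = proj₁ D₁
      d₂ = proj₁ D₂
      derivative-eq : tr (adjugate (char (+ t))) ≡ (d₁ * v + u * d₂) * q + u * v * (+ 2 * + t - c)
      derivative-eq = derivative-unique (charPolyAt A)
        (λ s → (s - 1ℤ) ^ a * (s + 1ℤ) ^ b * (s * s - c * s + p)) {t = + t} charPoly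
        (derivative-charPoly A (+ t))
        (derivative-* (λ s → (s - 1ℤ) ^ a * (s + 1ℤ) ^ b) (λ s → s * s - c * s + p) {t = + t}
          (derivative-* (λ s → (s - 1ℤ) ^ a) (λ s → (s + 1ℤ) ^ b) {t = + t}
            (proj₁ (proj₂ D₁)) (proj₁ (proj₂ D₂)))
          (derivative-quad c p (+ t)))
      t-1≢0 : + t - 1ℤ ≢ 0ℤ
      t-1≢0 e = ℕ.<-irrefl (sym (+-injective (i-j≡0⇒i≡j (+ t) 1ℤ e))) 1<t
      t+1≢0 : + t + 1ℤ ≢ 0ℤ
      t+1≢0 e = ℕ.1+n≢0 (trans (ℕ.+-comm 1 t) (+-injective e))
      uvq≢0 : u * v * q ≢ 0ℤ
      uvq≢0 e = [ (λ e′ → [ ^-nonzero (+ t - 1ℤ) a t-1≢0 , ^-nonzero (+ t + 1ℤ) b t+1≢0 ]′ (i*j≡0⇒i≡0∨j≡0 u e′))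
        , quad-nonzero c p t large ]′ (i*j≡0⇒i≡0∨j≡0 (u * v) e)
      lem₁ : ∀ t u v q d e k → (t * t - 1ℤ) * q * ((d * v + u * e) * q + u * v * k) ≡
        q * ((d * (t - 1ℤ)) * v * (t + 1ℤ) * q + (e * (t + 1ℤ)) * u * (t - 1ℤ) * q + (t * t - 1ℤ) * u * v * k)
      lem₁ = solve-∀
      lem₂ : ∀ t u v q a b k → q * ((a * u) * v * (t + 1ℤ) * q + (b * v) * u * (t - 1ℤ) * q + (t * t - 1ℤ) * u * v * k)
        ≡ u * v * q * ((a * (t + 1ℤ) + b * (t - 1ℤ)) * q + (t * t - 1ℤ) * k)
      lem₂ = solve-∀

  -- The two formulas for the trace of `quotient` are compared as polynomials in t. Their cubic
  -- terms cancel because n = a + b + 2, and the remaining coefficients are triangular in the errors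
  -- `E₁`, `E₂`, `E₃`.
  traces : τ₁ ≡ + a - + b + c × τ₂ ≡ + a + + b + (c * c - + 2 * p) ×
    τ₃ ≡ + a - + b + (c * c * c - + 3 * c * p)
  traces = i-j≡0⇒i≡j _ _ E₁≡0 , i-j≡0⇒i≡j _ _ E₂≡0 , i-j≡0⇒i≡j _ _ E₃≡0
    where
      E₁ E₂ E₃ : ℤ
      E₁ = τ₁ - (+ a - + b + c)
      E₂ = τ₂ - (+ a + + b + (c * c - + 2 * p))
      E₃ = τ₃ - (+ a - + b + (c * c * c - + 3 * c * p))
      T : ℕ
      T = 2 ℕ.+ n ℕ.+ (∣ c ∣ ℕ.+ ∣ p ∣)
      n-size : + n ≡ + a + + b + + 2
      n-size = cong +_ (sym size)
      bounds : ∀ u → n ℕ.< T ℕ.+ u × ∣ c ∣ ℕ.+ ∣ p ∣ ℕ.< T ℕ.+ u × 1 ℕ.< T ℕ.+ u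
      bounds u = ℕ.s≤s (ℕ.≤-trans (ℕ.m≤m+n n (∣ c ∣ ℕ.+ ∣ p ∣)) (ℕ.≤-trans (ℕ.n≤1+n _) (ℕ.m≤m+n _ u)))
        , ℕ.s≤s (ℕ.≤-trans (ℕ.m≤n+m (∣ c ∣ ℕ.+ ∣ p ∣) n) (ℕ.≤-trans (ℕ.n≤1+n _) (ℕ.m≤m+n _ u)))
        , ℕ.s≤s (ℕ.s≤s ℕ.z≤n)
      vanish : ∀ u → let t = + (T ℕ.+ u) in
        (E₃ - c * E₂ + (p - 1ℤ) * E₁) + (E₂ - c * E₁) * t + E₁ * (t * t) ≡ 0ℤ
      vanish u with bounds u
      ... | b₁ , b₂ , b₃ = trans (lem (+ a) (+ b) c p τ₁ τ₂ τ₃ (+ (T ℕ.+ u)))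
        (i≡j⇒i-j≡0 (trans (trans (cong (λ m → 1ℤ * τ₃ + (t - c) * τ₂ + (t * t - c * t + p - 1ℤ) * τ₁
            + (t * t * t - c * (t * t) + (p - 1ℤ) * t + c) * m) (sym n-size))
          (sym (tr-quotient t))) (tr-quotient-eigenvalues (T ℕ.+ u) b₁ b₂ b₃)))
        where
          t : ℤ
          t = + (T ℕ.+ u)
          lem : ∀ a b c p x y z t →
            ((z - (a - b + (c * c * c - + 3 * c * p))) - c * (y - (a + b + (c * c - + 2 * p)))
              + (p - 1ℤ) * (x - (a - b + c)))
            + ((y - (a + b + (c * c - + 2 * p))) - c * (x - (a - b + c))) * t + (x - (a - b + c)) * (t * t) ≡
            (1ℤ * z + (t - c) * y + (t * t - c * t + p - 1ℤ) * x
              + (t * t * t - c * (t * t) + (p - 1ℤ) * t + c) * (a + b + + 2))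
            - ((a * (t + 1ℤ) + b * (t - 1ℤ)) * (t * t - c * t + p) + (t * t - 1ℤ) * (+ 2 * t - c))
          lem = solve-∀
      coeffs = quadratic-vanishes (E₃ - c * E₂ + (p - 1ℤ) * E₁) (E₂ - c * E₁) E₁ T vanish
      E₁≡0 : E₁ ≡ 0ℤ
      E₁≡0 = proj₂ (proj₂ coeffs)
      E₂≡0 : E₂ ≡ 0ℤ
      E₂≡0 = trans (lem E₂ c E₁) (trans (cong₂ (λ x y → x + c * y) (proj₁ (proj₂ coeffs)) E₁≡0) (lem₀ c))
        where lem : ∀ x c y → x ≡ (x - c * y) + c * y
              lem = solve-∀
              lem₀ : ∀ c → 0ℤ + c * 0ℤ ≡ 0ℤ
              lem₀ = solve-∀
      E₃≡0 : E₃ ≡ 0ℤ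
      E₃≡0 = trans (lem E₃ (c * E₂) ((p - 1ℤ) * E₁)) (trans (cong₂ (λ x y → x + y - (p - 1ℤ) * E₁)
          (proj₁ coeffs) (cong (c *_) E₂≡0)) (trans (cong (λ y → 0ℤ + c * 0ℤ - (p - 1ℤ) * y) E₁≡0) (lem₀ c (p - 1ℤ))))
        where lem : ∀ x y z → x ≡ (x - y + z) + y - z
              lem = solve-∀
              lem₀ : ∀ c q → 0ℤ + c * 0ℤ - q * 0ℤ ≡ 0ℤ
              lem₀ = solve-∀

-- Exterior squares

dot : ∀ {n} → (Fin n → ℤ) → (Fin n → ℤ) → ℤ
dot u v = sumFin (λ i → u i * v i)

mv : ∀ {n} → Matrix n → (Fin n → ℤ) → Fin n → ℤ
mv X v i = dot (X i) v

module _ {n : ℕ} where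

  -- A formal linear combination of summands. The solver cannot look inside `sumFin`, so a summand
  -- is first brought into this shape and `sum-linComb` then carries out the summation.
  linComb : ∀ {m} → Vec (ℤ × (Fin n → ℤ)) m → Fin n → ℤ
  linComb []             k = 0ℤ
  linComb ((c , f) ∷ ts) k = c * f k + linComb ts k

  sumComb : ∀ {m} → Vec (ℤ × (Fin n → ℤ)) m → ℤ
  sumComb []             = 0ℤ
  sumComb ((c , f) ∷ ts) = c * sumFin f + sumComb ts

  sum-linComb : ∀ {m} (ts : Vec (ℤ × (Fin n → ℤ)) m) → sumFin (linComb ts) ≡ sumComb ts
  sum-linComb []             = sum-0 {n} {λ _ → 0ℤ} (λ _ → refl)
  sum-linComb ((c , f) ∷ ts) = trans (sum-+ (λ k → c * f k) (linComb ts))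
    (cong₂ _+_ (sum-*ˡ c f) (sum-linComb ts))

  -- Lagrange's identity for the bivector x ∧ y - e (x′ ∧ y′); the factor 2 appears because each
  -- pair of coordinates is counted in both orders.
  lagrange : ∀ (x y x′ y′ : Fin n → ℤ) e →
    sumFin (λ k → sumFin (λ l →
      (x k * y l - x l * y k - e * (x′ k * y′ l - x′ l * y′ k)) *
      (x k * y l - x l * y k - e * (x′ k * y′ l - x′ l * y′ k)))) ≡
    + 2 * (dot x x * dot y y - + 2 * e * (dot x x′ * dot y y′) + e * e * (dot x′ x′ * dot y′ y′)
      - dot x y * dot x y + + 2 * e * (dot x y′ * dot y x′) - e * e * (dot x′ y′ * dot x′ y′))
  lagrange x y x′ y′ e = begin
    _ ≡⟨ sum-cong (λ k → trans (sum-cong (λ l →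
           expand (x k) (y k) (x′ k) (y′ k) (x l) (y l) (x′ l) (y′ l) e))
           (trans (sum-linComb (inner k))
           (collect (x k) (y k) (x′ k) (y′ k) e (dot y y) (dot x x) (dot y′ y′) (dot x′ x′) (dot x y)
             (dot y y′) (dot y x′) (dot x y′) (dot x x′) (dot x′ y′)))) ⟩
    sumFin (linComb outer) ≡⟨ sum-linComb outer ⟩
    sumComb outer ≡⟨ finish e (dot y y) (dot x x) (dot y′ y′) (dot x′ x′) (dot x y)
             (dot y y′) (dot y x′) (dot x y′) (dot x x′) (dot x′ y′) ⟩
    _ ∎
    where
      inner : Fin n → Vec (ℤ × (Fin n → ℤ)) 10
      inner k = (x k * x k , λ l → y l * y l) ∷ (y k * y k , λ l → x l * x l)
        ∷ (e * e * (x′ k * x′ k) , λ l → y′ l * y′ l) ∷ (e * e * (y′ k * y′ k) , λ l → x′ l * x′ l)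
        ∷ (- + 2 * (x k * y k) , λ l → x l * y l) ∷ (- + 2 * e * (x k * x′ k) , λ l → y l * y′ l)
        ∷ (+ 2 * e * (x k * y′ k) , λ l → y l * x′ l) ∷ (+ 2 * e * (y k * x′ k) , λ l → x l * y′ l)
        ∷ (- + 2 * e * (y k * y′ k) , λ l → x l * x′ l) ∷ (- + 2 * e * e * (x′ k * y′ k) , λ l → x′ l * y′ l) ∷ []
      outer : Vec (ℤ × (Fin n → ℤ)) 10
      outer = (dot y y , λ k → x k * x k) ∷ (dot x x , λ k → y k * y k)
        ∷ (e * e * dot y′ y′ , λ k → x′ k * x′ k) ∷ (e * e * dot x′ x′ , λ k → y′ k * y′ k)
        ∷ (- + 2 * dot x y , λ k → x k * y k) ∷ (- + 2 * e * dot y y′ , λ k → x k * x′ k)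
        ∷ (+ 2 * e * dot y x′ , λ k → x k * y′ k) ∷ (+ 2 * e * dot x y′ , λ k → y k * x′ k)
        ∷ (- + 2 * e * dot x x′ , λ k → y k * y′ k) ∷ (- + 2 * e * e * dot x′ y′ , λ k → x′ k * y′ k) ∷ []
      expand : ∀ a b c d a′ b′ c′ d′ e →
        (a * b′ - a′ * b - e * (c * d′ - c′ * d)) * (a * b′ - a′ * b - e * (c * d′ - c′ * d)) ≡
        a * a * (b′ * b′) + (b * b * (a′ * a′) + (e * e * (c * c) * (d′ * d′) + (e * e * (d * d) * (c′ * c′)
        + (- + 2 * (a * b) * (a′ * b′) + (- + 2 * e * (a * c) * (b′ * d′) + (+ 2 * e * (a * d) * (b′ * c′)
        + (+ 2 * e * (b * c) * (a′ * d′) + (- + 2 * e * (b * d) * (a′ * c′)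
        + (- + 2 * e * e * (c * d) * (c′ * d′) + 0ℤ)))))))))
      expand = solve-∀
      collect : ∀ a b c d e yy xx y′y′ x′x′ xy yy′ yx′ xy′ xx′ x′y′ →
        a * a * yy + (b * b * xx + (e * e * (c * c) * y′y′ + (e * e * (d * d) * x′x′
        + (- + 2 * (a * b) * xy + (- + 2 * e * (a * c) * yy′ + (+ 2 * e * (a * d) * yx′
        + (+ 2 * e * (b * c) * xy′ + (- + 2 * e * (b * d) * xx′
        + (- + 2 * e * e * (c * d) * x′y′ + 0ℤ))))))))) ≡
        yy * (a * a) + (xx * (b * b) + (e * e * y′y′ * (c * c) + (e * e * x′x′ * (d * d)
        + (- + 2 * xy * (a * b) + (- + 2 * e * yy′ * (a * c) + (+ 2 * e * yx′ * (a * d)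
        + (+ 2 * e * xy′ * (b * c) + (- + 2 * e * xx′ * (b * d)
        + (- + 2 * e * e * x′y′ * (c * d) + 0ℤ)))))))))
      collect = solve-∀
      finish : ∀ e yy xx y′y′ x′x′ xy yy′ yx′ xy′ xx′ x′y′ →
        yy * xx + (xx * yy + (e * e * y′y′ * x′x′ + (e * e * x′x′ * y′y′
        + (- + 2 * xy * xy + (- + 2 * e * yy′ * xx′ + (+ 2 * e * yx′ * xy′
        + (+ 2 * e * xy′ * yx′ + (- + 2 * e * xx′ * yy′
        + (- + 2 * e * e * x′y′ * x′y′ + 0ℤ))))))))) ≡
        + 2 * (xx * yy - + 2 * e * (xx′ * yy′) + e * e * (x′x′ * y′y′)
          - xy * xy + + 2 * e * (xy′ * yx′) - e * e * (x′y′ * x′y′))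
      finish = solve-∀

  gram : (Fin n → ℤ) → (Fin n → ℤ) → ℤ
  gram x y = dot x x * dot y y - dot x y * dot x y

  private
    lagrange₀ : ∀ x y → sumFin (λ k → sumFin (λ l →
      (x k * y l - x l * y k) * (x k * y l - x l * y k))) ≡ + 2 * gram x y
    lagrange₀ x y = trans (sum-cong (λ k → sum-cong (λ l → lem₁ (x k * y l - x l * y k) (x k * y l - x l * y k))))
      (trans (lagrange x y x y 0ℤ) (lem₂ (dot x x) (dot y y) (dot x y) (dot y x)))
      where
        lem₁ : ∀ u v → u * u ≡ (u - 0ℤ * v) * (u - 0ℤ * v)
        lem₁ = solve-∀
        lem₂ : ∀ a b c d → + 2 * (a * b - + 2 * 0ℤ * (a * b) + 0ℤ * 0ℤ * (a * b) - c * c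
          + + 2 * 0ℤ * (c * d) - 0ℤ * 0ℤ * (c * c)) ≡ + 2 * (a * b - c * c)
        lem₂ = solve-∀

  gram-nonneg : ∀ x y → 0ℤ ≤ gram x y
  gram-nonneg x y = *-cancelˡ-≤-pos 0ℤ (gram x y) (+ 2) (subst (0ℤ ≤_) (lagrange₀ x y)
    (sum-nonneg (λ k → sum-nonneg (λ l → sq-nonneg (x k * y l - x l * y k)))))

  gram-zero : ∀ x y → gram x y ≡ 0ℤ → ∀ k l → x k * y l ≡ x l * y k
  gram-zero x y e k l = i-j≡0⇒i≡j _ _ (sum-sq-zero (λ l → x k * y l - x l * y k)
    (sum-nonneg-zero (λ k → sum-nonneg (λ l → sq-nonneg (x k * y l - x l * y k)))
      (trans (lagrange₀ x y) (trans (cong (+ 2 *_) e) refl)) k) l)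

  -- If D⁻¹ M is a projection of rank two and W acts on its range with trace s and determinant e
  -- (after division by D), then Λ²W = e Λ²M.
  module Wedge (M W : Matrix n) (D s e : ℤ) (M-sym : Symmetric M) (W-sym : Symmetric W)
    (MM : M · M ≋ (λ i j → D * M i j)) (WM : W · M ≋ (λ i j → D * W i j))
    (WW : W · W ≋ (λ i j → D * (s * W i j - e * M i j)))
    (trM : tr M ≡ + 2 * D) (trW : tr W ≡ D * s) where

    private
      dot-rows : ∀ (X Y : Matrix n) → Symmetric Y → ∀ i j → dot (X i) (Y j) ≡ (X · Y) i j
      dot-rows X Y sY i j = sum-cong (λ k → cong (X i k *_) (sY j k))

      -- An entry of Λ²W - e Λ²M. The sum of the squares of all these entries is computed from the
      -- product relations and the traces and turns out to be 0.
      defect : Fin n → Fin n → Fin n → Fin n → ℤ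
      defect i j k l = W i k * W j l - W i l * W j k - e * (M i k * M j l - M i l * M j k)

      rows : ∀ i j → sumFin (λ k → sumFin (λ l → defect i j k l * defect i j k l)) ≡
        + 2 * (D * D) * ((s * W i i - e * M i i) * (s * W j j - e * M j j) - + 2 * e * (W i i * W j j)
          + e * e * (M i i * M j j) - (s * W i j - e * M i j) * (s * W i j - e * M i j)
          + + 2 * e * (W i j * W i j) - e * e * (M i j * M i j))
      rows i j = trans (lagrange (W i) (W j) (M i) (M j) e)
        (trans (cong (+ 2 *_) (cong₂ _-_ (cong₂ _+_ (cong₂ _-_ (cong₂ _+_ (cong₂ _-_
            (cong₂ _*_ (ww i i) (ww j j))
            (cong (+ 2 * e *_) (cong₂ _*_ (wm i i) (wm j j))))
            (cong (e * e *_) (cong₂ _*_ (mm i i) (mm j j))))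
            (cong₂ _*_ (ww i j) (ww i j)))
            (cong (+ 2 * e *_) (cong₂ _*_ (wm i j) (trans (wm j i) (cong (D *_) (W-sym j i))))))
            (cong (e * e *_) (cong₂ _*_ (mm i j) (mm i j)))))
          (lem D s e (W i i) (M i i) (W j j) (M j j) (W i j) (M i j)))
        where
          ww : ∀ i j → dot (W i) (W j) ≡ D * (s * W i j - e * M i j)
          ww i j = trans (dot-rows W W W-sym i j) (WW i j)
          wm : ∀ i j → dot (W i) (M j) ≡ D * W i j
          wm i j = trans (dot-rows W M M-sym i j) (WM i j)
          mm : ∀ i j → dot (M i) (M j) ≡ D * M i j
          mm i j = trans (dot-rows M M M-sym i j) (MM i j)
          lem : ∀ D s e a b c d f g →
            + 2 * (D * (s * a - e * b) * (D * (s * c - e * d)) - + 2 * e * (D * a * (D * c))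
              + e * e * (D * b * (D * d)) - D * (s * f - e * g) * (D * (s * f - e * g))
              + + 2 * e * (D * f * (D * f)) - e * e * (D * g * (D * g))) ≡
            + 2 * (D * D) * ((s * a - e * b) * (s * c - e * d) - + 2 * e * (a * c)
              + e * e * (b * d) - (s * f - e * g) * (s * f - e * g) + + 2 * e * (f * f) - e * e * (g * g))
          lem = solve-∀

      -- Only the sum over j brings in `trM` and `trW`, and with them the rank two; the terms cancel
      -- for each i separately.
      total : ∀ i → sumFin (λ j → sumFin (λ k → sumFin (λ l → defect i j k l * defect i j k l))) ≡ 0ℤ
      total i = trans (sum-cong (λ j → trans (rows i j)
          (lem₁ D s e (W i i) (M i i) (W j j) (M j j) (W i j) (M i j))))
        (trans (sum-linComb ts) (trans
          (cong₂ (λ x y → + 2 * (D * D) * ((s * s - + 2 * e) * W i i - s * e * M i i) * x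
             + (+ 2 * (D * D) * (+ 2 * (e * e) * M i i - s * e * W i i) * y + rest)) trW trM)
          (trans (cong (λ x → + 2 * (D * D) * ((s * s - + 2 * e) * W i i - s * e * M i i) * (D * s)
             + (+ 2 * (D * D) * (+ 2 * (e * e) * M i i - s * e * W i i) * (+ 2 * D) + x)) rest-eq)
          (lem₂ D s e (W i i) (M i i)))))
        where
          ts : Vec (ℤ × (Fin n → ℤ)) 5
          ts = (+ 2 * (D * D) * ((s * s - + 2 * e) * W i i - s * e * M i i) , λ j → W j j)
             ∷ (+ 2 * (D * D) * (+ 2 * (e * e) * M i i - s * e * W i i) , λ j → M j j)
             ∷ (+ 2 * (D * D) * (+ 2 * e - s * s) , λ j → W i j * W i j)
             ∷ (+ 2 * (D * D) * (+ 2 * s * e) , λ j → W i j * M i j)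
             ∷ (+ 2 * (D * D) * (- + 2 * (e * e)) , λ j → M i j * M i j) ∷ []
          rest : ℤ
          rest = + 2 * (D * D) * (+ 2 * e - s * s) * dot (W i) (W i)
             + (+ 2 * (D * D) * (+ 2 * s * e) * dot (W i) (M i)
             + (+ 2 * (D * D) * (- + 2 * (e * e)) * dot (M i) (M i) + 0ℤ))
          rest-eq : rest ≡ + 2 * (D * D) * (+ 2 * e - s * s) * (D * (s * W i i - e * M i i))
             + (+ 2 * (D * D) * (+ 2 * s * e) * (D * W i i)
             + (+ 2 * (D * D) * (- + 2 * (e * e)) * (D * M i i) + 0ℤ))
          rest-eq = cong₂ _+_ (cong (+ 2 * (D * D) * (+ 2 * e - s * s) *_) (trans (dot-rows W W W-sym i i) (WW i i)))
            (cong₂ _+_ (cong (+ 2 * (D * D) * (+ 2 * s * e) *_) (trans (dot-rows W M M-sym i i) (WM i i)))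
            (cong (λ x → + 2 * (D * D) * (- + 2 * (e * e)) * x + 0ℤ) (trans (dot-rows M M M-sym i i) (MM i i))))
          lem₁ : ∀ D s e a b c d f g →
            + 2 * (D * D) * ((s * a - e * b) * (s * c - e * d) - + 2 * e * (a * c)
              + e * e * (b * d) - (s * f - e * g) * (s * f - e * g) + + 2 * e * (f * f) - e * e * (g * g)) ≡
            + 2 * (D * D) * ((s * s - + 2 * e) * a - s * e * b) * c
            + (+ 2 * (D * D) * (+ 2 * (e * e) * b - s * e * a) * d
            + (+ 2 * (D * D) * (+ 2 * e - s * s) * (f * f)
            + (+ 2 * (D * D) * (+ 2 * s * e) * (f * g)
            + (+ 2 * (D * D) * (- + 2 * (e * e)) * (g * g) + 0ℤ))))
          lem₁ = solve-∀
          lem₂ : ∀ D s e a b →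
            + 2 * (D * D) * ((s * s - + 2 * e) * a - s * e * b) * (D * s)
            + (+ 2 * (D * D) * (+ 2 * (e * e) * b - s * e * a) * (+ 2 * D)
            + (+ 2 * (D * D) * (+ 2 * e - s * s) * (D * (s * a - e * b))
            + (+ 2 * (D * D) * (+ 2 * s * e) * (D * a)
            + (+ 2 * (D * D) * (- + 2 * (e * e)) * (D * b) + 0ℤ)))) ≡ 0ℤ
          lem₂ = solve-∀

      defect-zero : ∀ i j k l → defect i j k l ≡ 0ℤ
      defect-zero i j k = sum-sq-zero (defect i j k) (sum-nonneg-zero (λ k → sum-nonneg (λ l → sq-nonneg (defect i j k l)))
        (sum-nonneg-zero (λ j → sum-nonneg (λ k → sum-nonneg (λ l → sq-nonneg (defect i j k l)))) (total i) j) k)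

      contract : ∀ (a b a′ b′ y : Fin n → ℤ) {u f u′ f′} →
        (∀ k → a k * u - b k * f - e * (a′ k * u′ - b′ k * f′) ≡ 0ℤ) →
        dot a y * u - dot b y * f - e * (dot a′ y * u′ - dot b′ y * f′) ≡ 0ℤ
      contract a b a′ b′ y {u} {f} {u′} {f′} h = trans
        (lem₀ e u f u′ f′ (dot a y) (dot b y) (dot a′ y) (dot b′ y))
        (trans (sym (sum-linComb ts)) (sum-0 (λ k →
          trans (lem₁ e u f u′ f′ (a k) (b k) (a′ k) (b′ k) (y k))
            (trans (cong (_* y k) (h k)) refl))))
        where
          ts : Vec (ℤ × (Fin n → ℤ)) 4
          ts = (u , λ k → a k * y k) ∷ (- f , λ k → b k * y k) ∷ (- e * u′ , λ k → a′ k * y k)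
             ∷ (e * f′ , λ k → b′ k * y k) ∷ []
          lem₀ : ∀ e u f u′ f′ a b a′ b′ → a * u - b * f - e * (a′ * u′ - b′ * f′) ≡
            u * a + (- f * b + (- e * u′ * a′ + (e * f′ * b′ + 0ℤ)))
          lem₀ = solve-∀
          lem₁ : ∀ e u f u′ f′ a b a′ b′ y → u * (a * y) + (- f * (b * y) + (- e * u′ * (a′ * y) + (e * f′ * (b′ * y) + 0ℤ)))
            ≡ (a * u - b * f - e * (a′ * u′ - b′ * f′)) * y
          lem₁ = solve-∀

    wedge : ∀ x₁ x₂ y₁ y₂ →
      dot (mv W y₁) x₁ * dot (mv W y₂) x₂ - dot (mv W y₂) x₁ * dot (mv W y₁) x₂
      - e * (dot (mv M y₁) x₁ * dot (mv M y₂) x₂ - dot (mv M y₂) x₁ * dot (mv M y₁) x₂) ≡ 0ℤ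
    wedge x₁ x₂ y₁ y₂ = trans
        (flip₂ e (dot (mv W y₁) x₁) (dot (mv W y₂) x₂) (dot (mv W y₂) x₁) (dot (mv W y₁) x₂)
           (dot (mv M y₁) x₁) (dot (mv M y₂) x₂) (dot (mv M y₂) x₁) (dot (mv M y₁) x₂)) step₄
      where
        flip₁ : ∀ e a b c d a′ b′ c′ d′ → a * b - c * d - e * (a′ * b′ - c′ * d′) ≡
          a * b - d * c - e * (a′ * b′ - d′ * c′)
        flip₁ = solve-∀
        flip₂ : ∀ e a b c d a′ b′ c′ d′ → a * b - c * d - e * (a′ * b′ - c′ * d′) ≡
          b * a - d * c - e * (b′ * a′ - d′ * c′)
        flip₂ = solve-∀
        flip₃ : ∀ e a b c d a′ b′ c′ d′ → b * a - c * d - e * (b′ * a′ - c′ * d′) ≡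
          a * b - c * d - e * (a′ * b′ - c′ * d′)
        flip₃ = solve-∀
        -- The slots k, l, i, j are filled with `y₁`, `y₂`, `x₁`, `x₂` in turn; the flips merely
        -- reorder factors to the shape of `contract`.
        step₁ : ∀ i j l → mv W y₁ i * W j l - mv W y₁ j * W i l - e * (mv M y₁ i * M j l - mv M y₁ j * M i l) ≡ 0ℤ
        step₁ i j l = contract (W i) (W j) (M i) (M j) y₁ (λ k → trans
          (flip₁ e (W i k) (W j l) (W j k) (W i l) (M i k) (M j l) (M j k) (M i l)) (defect-zero i j k l))
        step₂ : ∀ i j → mv W y₂ j * mv W y₁ i - mv W y₂ i * mv W y₁ j
          - e * (mv M y₂ j * mv M y₁ i - mv M y₂ i * mv M y₁ j) ≡ 0ℤ
        step₂ i j = contract (W j) (W i) (M j) (M i) y₂ (λ l → trans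
          (flip₂ e (W j l) (mv W y₁ i) (W i l) (mv W y₁ j) (M j l) (mv M y₁ i) (M i l) (mv M y₁ j)) (step₁ i j l))
        step₃ : ∀ j → dot (mv W y₁) x₁ * mv W y₂ j - dot (mv W y₂) x₁ * mv W y₁ j
          - e * (dot (mv M y₁) x₁ * mv M y₂ j - dot (mv M y₂) x₁ * mv M y₁ j) ≡ 0ℤ
        step₃ j = contract (mv W y₁) (mv W y₂) (mv M y₁) (mv M y₂) x₁ (λ i → trans
          (flip₃ e (mv W y₂ j) (mv W y₁ i) (mv W y₂ i) (mv W y₁ j)
             (mv M y₂ j) (mv M y₁ i) (mv M y₂ i) (mv M y₁ j)) (step₂ i j))
        step₄ : dot (mv W y₂) x₂ * dot (mv W y₁) x₁ - dot (mv W y₁) x₂ * dot (mv W y₂) x₁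
          - e * (dot (mv M y₂) x₂ * dot (mv M y₁) x₁ - dot (mv M y₁) x₂ * dot (mv M y₂) x₁) ≡ 0ℤ
        step₄ = contract (mv W y₂) (mv W y₁) (mv M y₂) (mv M y₁) x₂ (λ j → trans
          (flip₂ e (mv W y₂ j) (dot (mv W y₁) x₁) (mv W y₁ j) (dot (mv W y₂) x₁)
             (mv M y₂ j) (dot (mv M y₁) x₁) (mv M y₁ j) (dot (mv M y₂) x₁)) (step₃ j))

-- Isotropic planes

dot-comm : ∀ {n} (u v : Fin n → ℤ) → dot u v ≡ dot v u
dot-comm u v = sum-cong (λ i → *-comm (u i) (v i))

mv-· : ∀ {n} (X Y : Matrix n) v i → mv (X · Y) v i ≡ mv X (mv Y v) i
mv-· X Y v i = begin
  sumFin (λ k → sumFin (λ l → X i l * Y l k) * v k)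
    ≡⟨ sum-cong (λ k → sym (sum-*ʳ (v k) (λ l → X i l * Y l k))) ⟩
  sumFin (λ k → sumFin (λ l → X i l * Y l k * v k))
    ≡⟨ sum-swap (λ k l → X i l * Y l k * v k) ⟩
  sumFin (λ l → sumFin (λ k → X i l * Y l k * v k))
    ≡⟨ sum-cong (λ l → trans (sum-cong (λ k → *-assoc (X i l) (Y l k) (v k)))
         (sum-*ˡ (X i l) (λ k → Y l k * v k))) ⟩
  sumFin (λ l → X i l * sumFin (λ k → Y l k * v k)) ∎

dot-mv : ∀ {n} (X : Matrix n) → Symmetric X → ∀ u v → dot (mv X u) v ≡ dot u (mv X v)
dot-mv X sX u v = begin
  sumFin (λ i → sumFin (λ k → X i k * u k) * v i)
    ≡⟨ sum-cong (λ i → sym (sum-*ʳ (v i) (λ k → X i k * u k))) ⟩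
  sumFin (λ i → sumFin (λ k → X i k * u k * v i))
    ≡⟨ sum-swap (λ i k → X i k * u k * v i) ⟩
  sumFin (λ k → sumFin (λ i → X i k * u k * v i))
    ≡⟨ sum-cong (λ k → trans (sum-cong (λ i → trans (cong (λ w → w * u k * v i) (sX i k)) (lem (X k i) (u k) (v i))))
         (sum-*ˡ (u k) (λ i → X k i * v i))) ⟩
  sumFin (λ k → u k * sumFin (λ i → X k i * v i)) ∎
  where lem : ∀ x u v → x * u * v ≡ u * (x * v)
        lem = solve-∀

private
  -- Here γ = 4e² (xy - z²) = 4e³ g. For e < 0 this says that the nonnegative numbers γ and 4(-e)³ g
  -- add up to 0.
  negative-gram : ∀ {e x y z γ g} → e < 0ℤ →
    γ ≡ - (+ 2 * e) * x * (- (+ 2 * e) * y) - - (+ 2 * e) * z * (- (+ 2 * e) * z) →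
    x * y - z * z - e * g ≡ 0ℤ → 0ℤ ≤ γ → 0ℤ ≤ g → g ≡ 0ℤ
  negative-gram {e} {x} {y} {z} {γ} {g} e<0 hγ h 0≤γ 0≤g =
    *-cancelˡ-≡ k g 0ℤ {{>-nonZero 0<k}} (trans (proj₂ (+-nonneg-zero 0≤γ 0≤kg total)) (sym (*-zeroʳ k)))
    where
      k : ℤ
      k = - e * (- e * (- e * + 4))
      0<-e : 0ℤ < - e
      0<-e = neg-mono-< e<0
      pos-mul : ∀ {u} → 0ℤ < u → 0ℤ < - e * u
      pos-mul {u} 0<u = subst (_< - e * u) (*-zeroʳ (- e)) (*-monoˡ-<-pos (- e) {{Data.Integer.positive 0<-e}} 0<u)
      0<k : 0ℤ < k
      0<k = pos-mul (pos-mul (pos-mul (+<+ (ℕ.s≤s ℕ.z≤n))))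
      0≤kg : 0ℤ ≤ k * g
      0≤kg = subst (_≤ k * g) (*-zeroʳ k) (*-monoˡ-≤-nonNeg k {{nonNegative (<⇒≤ 0<k)}} 0≤g)
      total : γ + k * g ≡ 0ℤ
      total = trans (cong (_+ k * g) hγ) (trans (lem e x y z g) (trans (cong (+ 4 * (e * e) *_) h) (*-zeroʳ (+ 4 * (e * e)))))
        where
          lem : ∀ e x y z g → - (+ 2 * e) * x * (- (+ 2 * e) * y) - - (+ 2 * e) * z * (- (+ 2 * e) * z)
            + - e * (- e * (- e * + 4)) * g ≡ + 4 * (e * e) * (x * y - z * z - e * g)
          lem = solve-∀

  cancel-squares : ∀ {D e a b c x y z w₁ w₂ w₃ w₄ m₁ m₂ m₃ m₄} → D ≢ 0ℤ →
    w₁ ≡ D * a → w₂ ≡ D * b → w₃ ≡ D * c → w₄ ≡ D * c →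
    m₁ ≡ D * x → m₂ ≡ D * y → m₃ ≡ D * z → m₄ ≡ D * z →
    w₁ * w₂ - w₃ * w₄ - e * (m₁ * m₂ - m₃ * m₄) ≡ 0ℤ → a * b - c * c - e * (x * y - z * z) ≡ 0ℤ
  cancel-squares {D} {e} {a} {b} {c} {x} {y} {z} D≢0 refl refl refl refl refl refl refl refl h =
    *-cancelˡ-≡ D _ 0ℤ {{≢-nonZero D≢0}} (*-cancelˡ-≡ D _ _ {{≢-nonZero D≢0}}
      (trans (lem D e a b c x y z) (trans h (lem₀ D))))
    where
      lem : ∀ D e a b c x y z → D * (D * (a * b - c * c - e * (x * y - z * z))) ≡
        D * a * (D * b) - D * c * (D * c) - e * (D * x * (D * y) - D * z * (D * z))
      lem = solve-∀
      lem₀ : ∀ D → 0ℤ ≡ D * (D * 0ℤ)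
      lem₀ = solve-∀

module Forms {n} (A : Matrix n) (A-sym : Symmetric A) where

  open Bicommutant A A-sym

  form : Elt → (Fin n → ℤ) → (Fin n → ℤ) → ℤ
  form X u v = dot (mv (mat X) u) v

  form-cong : ∀ {X Y} → X R.≈ Y → ∀ u v → form X u v ≡ form Y u v
  form-cong h u v = sum-cong (λ i → cong (_* v i) (sum-cong (λ k → cong (_* u k) (h i k))))

  form-sym : ∀ X u v → form X u v ≡ form X v u
  form-sym X u v = trans (dot-mv (mat X) (mat-sym X) u v) (dot-comm u (mv (mat X) v))

  form-+ : ∀ X Y u v → form (X R.+ Y) u v ≡ form X u v + form Y u v
  form-+ X Y u v = trans
    (sum-cong (λ i → trans
      (cong (_* v i) (trans (sum-cong (λ k → *-distribʳ-+ (u k) (mat X i k) (mat Y i k)))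
        (sum-+ (λ k → mat X i k * u k) (λ k → mat Y i k * u k))))
      (*-distribʳ-+ (v i) (mv (mat X) u i) (mv (mat Y) u i))))
    (sum-+ (λ i → mv (mat X) u i * v i) (λ i → mv (mat Y) u i * v i))

  form-scale : ∀ {K c} → IsScalar K c → ∀ X u v → form (K R.* X) u v ≡ c * form X u v
  form-scale {K} {c} hK X u v = trans
    (sum-cong (λ i → trans
      (cong (_* v i) (trans (sum-cong (λ k → trans (cong (_* u k) (mat-scale′ hK X i k)) (*-assoc c (mat X i k) (u k))))
        (sum-*ˡ c (λ k → mat X i k * u k))))
      (*-assoc c (mv (mat X) u i) (v i))))
    (sum-*ˡ c (λ i → mv (mat X) u i * v i))

  form-neg : ∀ X u v → form (R.- X) u v ≡ - form X u v
  form-neg X u v = cancel-by (form (R.- X) u v) (- form X u v)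
    (trans (sym (form-+ X (R.- X) u v)) (trans (form-cong {X R.- X} {scalar 0ℤ R.* X}
        (λ i j → trans (+-inverseʳ (mat X i j)) (sym (mat-scale 0ℤ X i j))) u v)
      (form-scale (sc 0ℤ) X u v)))
    (lem (form (R.- X) u v) (form X u v))
    where lem : ∀ x y → x - - y ≡ (y + x) - 0ℤ * y
          lem = solve-∀

  form-*ˡ : ∀ X Y u v → form (X R.* Y) u v ≡ form X (mv (mat Y) u) v
  form-*ˡ X Y u v = sum-cong (λ i → cong (_* v i) (mv-· (mat X) (mat Y) u i))

  form-* : ∀ X Y u v → form (X R.* Y) u v ≡ dot (mv (mat Y) u) (mv (mat X) v)
  form-* X Y u v = trans (form-*ˡ X Y u v) (dot-mv (mat X) (mat-sym X) (mv (mat Y) u) v)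

  -- The form L = 1 − A has exactly one negative eigenvalue, so a totally isotropic plane for it
  -- meets its radical.
  module Isotropic (N A′ M W Y L D ∇ s two : Elt) (Dᵥ ∇ᵥ sᵥ : ℤ)
    (D-scalar : IsScalar D Dᵥ) (∇-scalar : IsScalar ∇ ∇ᵥ) (s-scalar : IsScalar s sᵥ) (two-scalar : IsScalar two (+ 2))
    (M*N : M R.* N R.≈ D R.* N) (M*M : M R.* M R.≈ D R.* M) (W*M : W R.* M R.≈ D R.* W)
    (W*N : W R.* N R.≈ D R.* (N R.* A′)) (W*W : W R.* W R.≈ D R.* (s R.* W R.- ∇ R.* M))
    (Y-N : Y R.≈ N R.* A′ R.- ∇ R.* L) (Y*Y : Y R.* Y R.≈ R.- (two R.* ∇) R.* Y)
    (N-L : N R.≈ L R.* L R.- two R.* L) where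

    module _ (trM : tr (mat M) ≡ + 2 * Dᵥ) (trW : tr (mat W) ≡ Dᵥ * sᵥ)
             (D≢0 : Dᵥ ≢ 0ℤ) (∇<0 : ∇ᵥ < 0ℤ) where

      private
        WWᵥ : mat W · mat W ≋ (λ i j → Dᵥ * (sᵥ * mat W i j - ∇ᵥ * mat M i j))
        WWᵥ i j = trans (W*W i j) (trans (mat-scale′ D-scalar (s R.* W R.- ∇ R.* M) i j)
          (cong (Dᵥ *_) (cong₂ _-_ (mat-scale′ s-scalar W i j) (mat-scale′ ∇-scalar M i j))))

        module Wd = Wedge (mat M) (mat W) Dᵥ sᵥ ∇ᵥ (mat-sym M) (mat-sym W)
          (λ i j → trans (M*M i j) (mat-scale′ D-scalar M i j))
          (λ i j → trans (W*M i j) (mat-scale′ D-scalar W i j)) WWᵥ trM trW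

      module _ (z₁ z₂ : Fin n → ℤ) (L₁₁ : form L z₁ z₁ ≡ 0ℤ) (L₁₂ : form L z₁ z₂ ≡ 0ℤ) (L₂₂ : form L z₂ z₂ ≡ 0ℤ) where

        private
          g₁ g₂ : Fin n → ℤ
          g₁ = mv (mat L) z₁
          g₂ = mv (mat L) z₂

          formN : ∀ u v → form L u v ≡ 0ℤ → form N u v ≡ dot (mv (mat L) u) (mv (mat L) v)
          formN u v e = begin
            form N u v ≡⟨ form-cong {N} {L R.* L R.- two R.* L} N-L u v ⟩
            form (L R.* L R.- two R.* L) u v ≡⟨ form-+ (L R.* L) (R.- (two R.* L)) u v ⟩
            form (L R.* L) u v + form (R.- (two R.* L)) u v
              ≡⟨ cong₂ _+_ (form-* L L u v) (trans (form-neg (two R.* L) u v)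
                   (cong -_ (trans (form-scale two-scalar L u v) (cong (+ 2 *_) e)))) ⟩
            dot (mv (mat L) u) (mv (mat L) v) + 0ℤ ≡⟨ +-identityʳ _ ⟩
            dot (mv (mat L) u) (mv (mat L) v) ∎

          formY : ∀ u v → form L u v ≡ 0ℤ → form Y u v ≡ form (N R.* A′) u v
          formY u v e = begin
            form Y u v ≡⟨ form-cong {Y} {N R.* A′ R.- ∇ R.* L} Y-N u v ⟩
            form (N R.* A′ R.- ∇ R.* L) u v ≡⟨ form-+ (N R.* A′) (R.- (∇ R.* L)) u v ⟩
            form (N R.* A′) u v + form (R.- (∇ R.* L)) u v
              ≡⟨ cong (λ w → form (N R.* A′) u v + w) (trans (form-neg (∇ R.* L) u v)
                   (cong -_ (trans (form-scale ∇-scalar L u v) (trans (cong (∇ᵥ *_) e) (*-zeroʳ ∇ᵥ))))) ⟩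
            form (N R.* A′) u v + 0ℤ ≡⟨ +-identityʳ _ ⟩
            form (N R.* A′) u v ∎

          dotY : ∀ u v → form L u v ≡ 0ℤ →
            dot (mv (mat Y) u) (mv (mat Y) v) ≡ - (+ 2 * ∇ᵥ) * form (N R.* A′) u v
          dotY u v e = trans (sym (form-* Y Y u v)) (trans (form-cong {Y R.* Y} {R.- (two R.* ∇) R.* Y} Y*Y u v)
            (trans (form-scale (sc-neg (two-scalar ⊛ ∇-scalar)) Y u v) (cong (- (+ 2 * ∇ᵥ) *_) (formY u v e))))

          formWN : ∀ u v → dot (mv (mat W) (mv (mat N) u)) v ≡ Dᵥ * form (N R.* A′) u v
          formWN u v = trans (sym (form-*ˡ W N u v)) (trans (form-cong {W R.* N} {D R.* (N R.* A′)} W*N u v)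
            (form-scale D-scalar (N R.* A′) u v))

          formMN : ∀ u v → form L u v ≡ 0ℤ →
            dot (mv (mat M) (mv (mat N) u)) v ≡ Dᵥ * dot (mv (mat L) u) (mv (mat L) v)
          formMN u v e = trans (sym (form-*ˡ M N u v)) (trans (form-cong {M R.* N} {D R.* N} M*N u v)
            (trans (form-scale D-scalar N u v) (cong (Dᵥ *_) (formN u v e))))

          L₂₁ : form L z₂ z₁ ≡ 0ℤ
          L₂₁ = trans (form-sym L z₂ z₁) L₁₂

          h₁₁ h₁₂ h₂₂ : ℤ
          h₁₁ = form (N R.* A′) z₁ z₁
          h₁₂ = form (N R.* A′) z₁ z₂
          h₂₂ = form (N R.* A′) z₂ z₂

          -- `Wd.wedge` is applied to the vectors z and N z. There W N = D N A′ and M N = D N, so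
          -- the two minors are D² times the determinants of N · A′ and of N on the plane.
          h-gram : h₁₁ * h₂₂ - h₁₂ * h₁₂ - ∇ᵥ * gram g₁ g₂ ≡ 0ℤ
          h-gram = cancel-squares {Dᵥ} {∇ᵥ} {h₁₁} {h₂₂} {h₁₂} {dot g₁ g₁} {dot g₂ g₂} {dot g₁ g₂} D≢0 (formWN z₁ z₁) (formWN z₂ z₂)
            (trans (formWN z₂ z₁) (cong (Dᵥ *_) (form-sym (N R.* A′) z₂ z₁))) (formWN z₁ z₂)
            (formMN z₁ z₁ L₁₁) (formMN z₂ z₂ L₂₂)
            (trans (formMN z₂ z₁ L₂₁) (cong (Dᵥ *_) (dot-comm g₂ g₁))) (formMN z₁ z₂ L₁₂)
            (Wd.wedge z₁ z₂ (mv (mat N) z₁) (mv (mat N) z₂))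

        -- The Gram determinant of Y z₁, Y z₂ is 4∇² times the determinant of N · A′ on the plane,
        -- hence 4∇³ times the Gram determinant of g₁, g₂. As ∇ < 0, both are 0, and the equality
        -- case of Cauchy-Schwarz applies.
        isotropic-parallel : ∀ k l → g₁ k * g₂ l ≡ g₁ l * g₂ k
        isotropic-parallel = gram-zero g₁ g₂ (negative-gram {∇ᵥ} {h₁₁} {h₂₂} {h₁₂} ∇<0
          (cong₂ _-_ (cong₂ _*_ (dotY z₁ z₁ L₁₁) (dotY z₂ z₂ L₂₂)) (cong₂ _*_ (dotY z₁ z₂ L₁₂) (dotY z₁ z₂ L₁₂)))
          h-gram (gram-nonneg (mv (mat Y) z₁) (mv (mat Y) z₂)) (gram-nonneg g₁ g₂))

-- Sign matrices and triangles

IsSign-sq : ∀ {s} → IsSign s → s * s ≡ 1ℤ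
IsSign-sq (inj₁ refl) = refl
IsSign-sq (inj₂ refl) = refl

IsSign-neg : ∀ {s} → IsSign s → IsSign (- s)
IsSign-neg (inj₁ refl) = inj₂ refl
IsSign-neg (inj₂ refl) = inj₁ refl

IsSign-* : ∀ {s t} → IsSign s → IsSign t → IsSign (s * t)
IsSign-* (inj₁ refl) (inj₁ refl) = inj₁ refl
IsSign-* (inj₁ refl) (inj₂ refl) = inj₂ refl
IsSign-* (inj₂ refl) (inj₁ refl) = inj₂ refl
IsSign-* (inj₂ refl) (inj₂ refl) = inj₁ refl

record SignMatrix {n} (A : Matrix n) : Set where
  field
    A-sym  : Symmetric A
    A-diag : ∀ i → A i i ≡ 0ℤ
    A-off  : ∀ {i j} → i ≢ j → IsSign (A i j)

  tr₁ : tr A ≡ 0ℤ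
  tr₁ = sum-0 A-diag

  sq-entry : ∀ i j → A i j * A j i ≡ 1ℤ - δ i j
  sq-entry i j with i ≟ j
  ... | yes refl = trans (cong (_* A i i) (A-diag i)) (sym (trans (cong (λ w → 1ℤ - w) (δ-diag i)) refl))
  ... | no i≢j = trans (cong (A i j *_) (A-sym j i)) (trans (IsSign-sq (A-off i≢j))
                   (sym (cong (λ w → 1ℤ - w) (δ-off i≢j))))

  tr₂ : tr (A · A) ≡ + n * (+ n - 1ℤ)
  tr₂ = trans (sum-cong (λ i → trans (sum-cong (λ k → trans (sq-entry i k) (lem₁ (δ i k))))
      (trans (sum-+ (λ _ → 1ℤ) (λ k → δ i k * -1ℤ))
        (cong₂ _+_ (trans (sum-const {n} 1ℤ) (*-identityʳ (+ n))) (sum-δ i (λ _ → -1ℤ))))))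
    (sum-const {n} (+ n - 1ℤ))
    where lem₁ : ∀ d → 1ℤ - d ≡ 1ℤ + d * -1ℤ
          lem₁ = solve-∀

  -- The sign of the triangle ijl; it is 0 when two of the vertices coincide.
  T : Fin n → Fin n → Fin n → ℤ
  T i j l = A i j * A j l * A i l

  T-swap₁₂ : ∀ i j l → T i j l ≡ T j i l
  T-swap₁₂ i j l = trans (lem (A i j) (A j l) (A i l)) (cong (λ w → w * A i l * A j l) (A-sym i j))
    where lem : ∀ x y z → x * y * z ≡ x * z * y
          lem = solve-∀

  T-swap₂₃ : ∀ i j l → T i j l ≡ T i l j
  T-swap₂₃ i j l = trans (lem (A i j) (A j l) (A i l)) (cong (λ w → A i l * w * A i j) (A-sym j l))
    where lem : ∀ x y z → x * y * z ≡ z * y * x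
          lem = solve-∀

  T-sign : ∀ {i j l} → i ≢ j → j ≢ l → i ≢ l → IsSign (T i j l)
  T-sign p q r = IsSign-* (IsSign-* (A-off p) (A-off q)) (A-off r)

  T-distinct : ∀ {i j l s} → T i j l ≡ s → s ≢ 0ℤ → i ≢ j × j ≢ l × i ≢ l
  T-distinct {i} {j} {l} refl ne =
    (λ { refl → ne (cong (λ w → w * A i l * A i l) (A-diag i)) }) ,
    (λ { refl → ne (trans (cong (λ w → A i j * w * A i j) (A-diag j)) (lem (A i j))) }) ,
    (λ { refl → ne (trans (cong (A i j * A j i *_) (A-diag i)) (*-zeroʳ (A i j * A j i))) })
    where lem : ∀ x → x * 0ℤ * x ≡ 0ℤ
          lem = solve-∀

  -- Each of the six edges on four vertices lies in two of the four triangles, so the four triangle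
  -- signs have product 1.
  quartet : ∀ {i j x q s t u} → IsSign s → IsSign t → IsSign u →
    T i j x ≡ s → T i j q ≡ t → T i q x ≡ u → T j q x ≡ s * t * u
  quartet {i} {j} {x} {q} {s} {t} {u} hs ht hu e₁ e₂ e₃ = begin
    A j q * A q x * A j x ≡⟨ sym (lem₁ (A j q * A q x * A j x)) ⟩
    A j q * A q x * A j x * (1ℤ * 1ℤ * 1ℤ)
      ≡⟨ cong (A j q * A q x * A j x *_) (sym (cong₂ _*_ (cong₂ _*_ (IsSign-sq (A-off i≢j)) (IsSign-sq (A-off i≢x))) (IsSign-sq (A-off i≢q)))) ⟩
    A j q * A q x * A j x * (A i j * A i j * (A i x * A i x) * (A i q * A i q))
      ≡⟨ lem₂ (A j q) (A q x) (A j x) (A i j) (A i x) (A i q) ⟩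
    T i j x * T i j q * T i q x ≡⟨ cong₂ _*_ (cong₂ _*_ e₁ e₂) e₃ ⟩
    s * t * u ∎
    where
      sign≢0 : ∀ {s} → IsSign s → s ≢ 0ℤ
      sign≢0 (inj₁ refl) ()
      sign≢0 (inj₂ refl) ()
      i≢j = proj₁ (T-distinct e₁ (sign≢0 hs))
      i≢x = proj₂ (proj₂ (T-distinct e₁ (sign≢0 hs)))
      i≢q = proj₂ (proj₂ (T-distinct e₂ (sign≢0 ht)))
      lem₁ : ∀ x → x * (1ℤ * 1ℤ * 1ℤ) ≡ x
      lem₁ = solve-∀
      lem₂ : ∀ a b c d e f → a * b * c * (d * d * (e * e) * (f * f)) ≡ d * c * e * (d * a * f) * (f * b * e)
      lem₂ = solve-∀

-- c and p are the sum and the product of the two exceptional eigenvalues.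
record Spectral {n} (A : Matrix n) (a b : ℕ) (c p : ℤ) : Set where
  field
    signMatrix : SignMatrix A
  open SignMatrix signMatrix public
  module B = Bicommutant A A-sym
  open RingIdentities B.ring B.scalar-hom using (quartic)
  field
    size  : + n ≡ + a + + b + + 2
    c-val : c ≡ + b - + a
    p-val : p ≡ - (+ 2 * (+ a * + b) + + a + + b + 1ℤ)
    root  : quartic (B.scalar c) (B.scalar p) B.gen B.R.≈ B.R.0#
    tr₃   : tr (A · (A · A)) ≡ + a - + b + (c * c * c - + 3 * c * p)

negate : ∀ {n} → Matrix n → Matrix n
negate A i j = - A i j

private
  neg-neg : ∀ x y → - x * - y ≡ x * y
  neg-neg = solve-∀

negate-square : ∀ {n} (A : Matrix n) → negate A · negate A ≋ A · A
negate-square A i j = sum-cong (λ k → neg-neg (A i k) (A k j))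

negate-sign : ∀ {n} {A : Matrix n} → SignMatrix A → SignMatrix (negate A)
negate-sign S = record
  { A-sym  = λ i j → cong -_ (A-sym i j)
  ; A-diag = λ i → cong -_ (A-diag i)
  ; A-off  = λ ne → IsSign-neg (A-off ne) }
  where open SignMatrix S

-- Negation exchanges the eigenvalues 1 and -1 and the two signs of triangles, so that each
-- statement about 1 - A and negative triangles also serves for 1 + A and positive ones.
negate-spectral : ∀ {n} {A : Matrix n} {a b c p} → Spectral A a b c p → Spectral (negate A) b a (- c) p
negate-spectral {n} {A} {a} {b} {c} {p} S = record
  { signMatrix = negate-sign signMatrix
  ; size  = trans size (cong (_+ + 2) (+-comm (+ a) (+ b)))
  ; c-val = trans (cong -_ c-val) (lem₁ (+ a) (+ b))
  ; p-val = trans p-val (lem₂ (+ a) (+ b))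
  ; root  = λ i j → trans (·-cong
      (λ i j → cong (_+ - (1ℤ * δ i j)) (negate-square A i j))
      (λ i j → cong (_+ p * δ i j) (cong₂ _+_ (negate-square A i j) (cong -_ (cx i j)))) i j) (root i j)
  ; tr₃   = trans (tr-cong (λ i j → trans
      (sum-cong (λ k → trans (cong (- A i k *_) (negate-square A k j)) (sym (neg1 (A i k) ((A · A) k j)))))
      (sum-*ˡ -1ℤ (λ k → A i k * (A · A) k j))))
      (trans (sum-*ˡ -1ℤ (λ i → (A · (A · A)) i i)) (trans (cong (-1ℤ *_) tr₃) (lem₃ (+ a) (+ b) c p))) }
  where
    open Spectral S
    lem₁ : ∀ a b → - (b - a) ≡ a - b
    lem₁ = solve-∀
    lem₂ : ∀ a b → - (+ 2 * (a * b) + a + b + 1ℤ) ≡ - (+ 2 * (b * a) + b + a + 1ℤ)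
    lem₂ = solve-∀
    lem₃ : ∀ a b c p → -1ℤ * (a - b + (c * c * c - + 3 * c * p)) ≡ b - a + (- c * - c * - c - + 3 * - c * p)
    lem₃ = solve-∀
    neg1 : ∀ x y → -1ℤ * (x * y) ≡ - x * y
    neg1 = solve-∀
    cx : (λ i j → - c * δ i j) · negate A ≋ (λ i j → c * δ i j) · A
    cx i j = sum-cong (λ k → lem (c) (δ i k) (A k j))
      where lem : ∀ c d x → - c * d * - x ≡ c * d * x
            lem = solve-∀

-- The case of negative q(1) and q(-1)

private
  -- Each hypothesis has a variable on its left, so matching on `refl` leaves an identity in a and b
  -- alone. The value 2D is the trace of D times a projection of rank two.
  trM-arith : ∀ {a b c p n x y z : ℤ} → c ≡ b - a → p ≡ - (+ 2 * (a * b) + a + b + 1ℤ) → n ≡ a + b + + 2 →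
    x ≡ a - b + (c * c * c - + 3 * c * p) → y ≡ n * (n - 1ℤ) → z ≡ 0ℤ →
    - c * x + (c * c - p - 1ℤ) * y + c * z + - (c * c - p - 1ℤ) * n ≡ + 2 * ((p + 1ℤ) * (p + 1ℤ) - c * c)
  trM-arith {a} {b} refl refl refl refl refl refl = lem a b
    where
      lem : ∀ a b → let c = b - a ; p = - (+ 2 * (a * b) + a + b + 1ℤ) ; n = a + b + + 2 in
        - c * (a - b + (c * c * c - + 3 * c * p)) + (c * c - p - 1ℤ) * (n * (n - 1ℤ)) + c * 0ℤ
          + - (c * c - p - 1ℤ) * n ≡ + 2 * ((p + 1ℤ) * (p + 1ℤ) - c * c)
      lem = solve-∀

  trW-arith : ∀ {a b c p n x y z : ℤ} → c ≡ b - a → p ≡ - (+ 2 * (a * b) + a + b + 1ℤ) → n ≡ a + b + + 2 →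
    x ≡ a - b + (c * c * c - + 3 * c * p) → y ≡ n * (n - 1ℤ) → z ≡ 0ℤ →
    - (p + 1ℤ) * x + c * p * y + (p + 1ℤ) * z + - (c * p) * n
      + - (c + 1ℤ) * (+ 2 * ((p + 1ℤ) * (p + 1ℤ) - c * c)) ≡ ((p + 1ℤ) * (p + 1ℤ) - c * c) * - (c + + 2)
  trW-arith {a} {b} refl refl refl refl refl refl = lem a b
    where
      lem : ∀ a b → let c = b - a ; p = - (+ 2 * (a * b) + a + b + 1ℤ) ; n = a + b + + 2 in
        - (p + 1ℤ) * (a - b + (c * c * c - + 3 * c * p)) + c * p * (n * (n - 1ℤ)) + (p + 1ℤ) * 0ℤ
          + - (c * p) * n + - (c + 1ℤ) * (+ 2 * ((p + 1ℤ) * (p + 1ℤ) - c * c)) ≡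
        ((p + 1ℤ) * (p + 1ℤ) - c * c) * - (c + + 2)
      lem = solve-∀

  D-arith : ∀ {a b c p : ℤ} → c ≡ b - a → p ≡ - (+ 2 * (a * b) + a + b + 1ℤ) →
    + 4 * (a * (a + 1ℤ)) * (b * (b + 1ℤ)) ≡ (p + 1ℤ) * (p + 1ℤ) - c * c
  D-arith {a} {b} refl refl = lem a b
    where
      lem : ∀ a b → let c = b - a ; p = - (+ 2 * (a * b) + a + b + 1ℤ) in
        + 4 * (a * (a + 1ℤ)) * (b * (b + 1ℤ)) ≡ (p + 1ℤ) * (p + 1ℤ) - c * c
      lem = solve-∀

  ∇-arith : ∀ {a b c p : ℤ} → c ≡ b - a → p ≡ - (+ 2 * (a * b) + a + b + 1ℤ) →
    1ℤ + c + p ≡ - (+ 2 * (a * (1ℤ + b)))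
  ∇-arith {a} {b} refl refl = lem a b
    where
      lem : ∀ a b → 1ℤ + (b - a) + - (+ 2 * (a * b) + a + b + 1ℤ) ≡ - (+ 2 * (a * (1ℤ + b)))
      lem = solve-∀

module Nondegenerate {n} {A : Matrix n} {a′ b′ : ℕ} {c p : ℤ} (S : Spectral A (suc a′) (suc b′) c p) where

  open Spectral S
  open Forms A A-sym
  open B
  open RingIdentities ring scalar-hom using (two; module Quartic)
  open Quartic (scalar c) (scalar p) gen root

  private
    a b : ℤ
    a = + suc a′
    b = + suc b′

    Dᵥ ∇ᵥ sᵥ : ℤ
    Dᵥ = (p + 1ℤ) * (p + 1ℤ) - c * c
    ∇ᵥ = 1ℤ + c + p
    sᵥ = - (c + + 2)

    trM : tr (mat M) ≡ + 2 * Dᵥ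
    trM = trans (tr-cong M-expand) (trans
      (tr-cubic (sc-neg (sc c)) (sc c ⊛ sc c ⊝ sc p ⊝ sc 1ℤ) (sc c) (sc-neg (sc c ⊛ sc c ⊝ sc p ⊝ sc 1ℤ)))
      (trM-arith {a} {b} {c} {p} {+ n} {τ₃} {τ₂} {τ₁} c-val p-val size tr₃ tr₂ tr₁))

    trW : tr (mat W) ≡ Dᵥ * sᵥ
    trW = trans (tr-cong W-expand) (trans (tr-+ (M R.* gen) (R.- (scalar c R.+ scalar 1ℤ) R.* M))
      (trans (cong₂ _+_ (trans (tr-cong Mx-expand)
          (tr-cubic (sc-neg (sc p ⊕ sc 1ℤ)) (sc c ⊛ sc p) (sc p ⊕ sc 1ℤ) (sc-neg (sc c ⊛ sc p))))
        (trans (tr-scale′ (sc-neg (sc c ⊕ sc 1ℤ)) M) (cong (- (c + 1ℤ) *_) trM)))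
      (trW-arith {a} {b} {c} {p} {+ n} {τ₃} {τ₂} {τ₁} c-val p-val size tr₃ tr₂ tr₁)))

    nonzero : ∀ {x y} → x ≢ 0ℤ → y ≢ 0ℤ → x * y ≢ 0ℤ
    nonzero {x} hx hy e with i*j≡0⇒i≡0∨j≡0 x e
    ... | inj₁ e′ = hx e′
    ... | inj₂ e′ = hy e′

    D≢0 : Dᵥ ≢ 0ℤ
    D≢0 e = nonzero {+ 4 * (a * (a + 1ℤ))} {b * (b + 1ℤ)}
      (nonzero {+ 4} {a * (a + 1ℤ)} (λ ()) (nonzero {a} {a + 1ℤ} (λ ()) (λ ())))
      (nonzero {b} {b + 1ℤ} (λ ()) (λ ()))
      (trans (D-arith {a} {b} {c} {p} c-val p-val) e)

    ∇<0 : ∇ᵥ < 0ℤ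
    ∇<0 = subst (_< 0ℤ) (sym (trans (∇-arith {a} {b} {c} {p} c-val p-val)
      (cong -_ (trans (cong (+ 2 *_) (sym (pos-* (suc a′) (suc (suc b′))))) (sym (pos-* 2 (suc a′ ℕ.* suc (suc b′))))))))
      -<+

    module Iso = Isotropic N A′ M W Y L D ∇ s two Dᵥ ∇ᵥ sᵥ
      ((sc p ⊕ sc 1ℤ) ⊛ (sc p ⊕ sc 1ℤ) ⊝ sc c ⊛ sc c) (sc 1ℤ ⊕ sc c ⊕ sc p) (sc-neg (sc c ⊕ sc (+ 2))) (sc (+ 2))
      M*N M*M W*M W*N W*W Y-N Y*Y N-L

    -- z i j is isotropic for L, and z i j, z i l are orthogonal when the triangle ijl is negative.
    z : Fin n → Fin n → Fin n → ℤ
    z i j k = δ i k + A i j * δ j k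

    dot-z : ∀ (v : Fin n → ℤ) i j → dot v (z i j) ≡ v i + A i j * v j
    dot-z v i j = trans (sum-cong (λ k → lem (v k) (δ i k) (A i j) (δ j k)))
      (trans (sum-+ (λ k → δ i k * v k) (λ k → A i j * (δ j k * v k)))
        (cong₂ _+_ (sum-δ i v) (trans (sum-*ˡ (A i j) (λ k → δ j k * v k)) (cong (A i j *_) (sum-δ j v)))))
      where lem : ∀ v d x e → v * (d + x * e) ≡ d * v + x * (e * v)
            lem = solve-∀

    g : Fin n → Fin n → Fin n → ℤ
    g i j = mv (mat L) (z i j)

    g-val : ∀ i j x → g i j x ≡ 1ℤ * δ x i - A x i + A i j * (1ℤ * δ x j - A x j)
    g-val i j x = dot-z (mat L x) i j

    g-left : ∀ {i j} → i ≢ j → g i j i ≡ 0ℤ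
    g-left {i} {j} i≢j = trans (g-val i j i) (trans
      (cong₂ (λ u v → 1ℤ * u - v + A i j * (1ℤ * δ i j - A i j)) (δ-diag i) (A-diag i))
      (trans (cong (λ u → 1ℤ * 1ℤ - 0ℤ + A i j * (1ℤ * u - A i j)) (δ-off i≢j))
      (trans (lem (A i j)) (cong (λ w → 1ℤ - w) (IsSign-sq (A-off i≢j))))))
      where lem : ∀ x → 1ℤ * 1ℤ - 0ℤ + x * (1ℤ * 0ℤ - x) ≡ 1ℤ - x * x
            lem = solve-∀

    g-right : ∀ {i j} → i ≢ j → g i j j ≡ 0ℤ
    g-right {i} {j} i≢j = trans (g-val i j j) (trans
      (cong₂ (λ u v → 1ℤ * δ j i - A j i + A i j * (1ℤ * u - v)) (δ-diag j) (A-diag j))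
      (trans (cong₂ (λ u v → 1ℤ * u - v + A i j * (1ℤ * 1ℤ - 0ℤ)) (δ-off (λ e → i≢j (sym e))) (A-sym j i))
      (lem (A i j))))
      where lem : ∀ x → 1ℤ * 0ℤ - x + x * (1ℤ * 1ℤ - 0ℤ) ≡ 0ℤ
            lem = solve-∀

    -- For three distinct vertices the value is -A i x (1 + T i j x): it vanishes exactly when the
    -- triangle ijx is negative.
    g-other : ∀ {i j x} → x ≢ i → x ≢ j → g i j x ≡ - (A i x + A i j * A j x)
    g-other {i} {j} {x} x≢i x≢j = trans (g-val i j x) (trans
      (cong₂ (λ u v → 1ℤ * u - A x i + A i j * (1ℤ * v - A x j)) (δ-off x≢i) (δ-off x≢j))
      (trans (cong₂ (λ u v → 1ℤ * 0ℤ - u + A i j * (1ℤ * 0ℤ - v)) (A-sym x i) (A-sym x j)) (lem (A i x) (A i j) (A j x))))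
      where lem : ∀ x y z → 1ℤ * 0ℤ - x + y * (1ℤ * 0ℤ - z) ≡ - (x + y * z)
            lem = solve-∀

    tri-neg : ∀ {x y w} → IsSign x → IsSign y → IsSign w → x * y * w ≡ -1ℤ → w + x * y ≡ 0ℤ
    tri-neg (inj₁ refl) (inj₁ refl) (inj₁ refl) ()
    tri-neg (inj₁ refl) (inj₂ refl) (inj₂ refl) ()
    tri-neg (inj₂ refl) (inj₁ refl) (inj₂ refl) ()
    tri-neg (inj₂ refl) (inj₂ refl) (inj₁ refl) ()
    tri-neg (inj₁ refl) (inj₁ refl) (inj₂ refl) e = refl
    tri-neg (inj₁ refl) (inj₂ refl) (inj₁ refl) e = refl
    tri-neg (inj₂ refl) (inj₁ refl) (inj₁ refl) e = refl
    tri-neg (inj₂ refl) (inj₂ refl) (inj₂ refl) e = refl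

    tri-pos : ∀ {x y w} → IsSign x → IsSign y → IsSign w → x * y * w ≡ 1ℤ → w + x * y ≢ 0ℤ
    tri-pos (inj₁ refl) (inj₁ refl) (inj₂ refl) ()
    tri-pos (inj₁ refl) (inj₂ refl) (inj₁ refl) ()
    tri-pos (inj₂ refl) (inj₁ refl) (inj₁ refl) ()
    tri-pos (inj₂ refl) (inj₂ refl) (inj₂ refl) ()
    tri-pos (inj₁ refl) (inj₁ refl) (inj₁ refl) e ()
    tri-pos (inj₁ refl) (inj₂ refl) (inj₂ refl) e ()
    tri-pos (inj₂ refl) (inj₁ refl) (inj₂ refl) e ()
    tri-pos (inj₂ refl) (inj₂ refl) (inj₁ refl) e ()

    g-neg : ∀ {i j x} → T i j x ≡ -1ℤ → g i j x ≡ 0ℤ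
    g-neg {i} {j} {x} e with T-distinct e (λ ())
    ... | i≢j , j≢x , i≢x = trans (g-other (λ e → i≢x (sym e)) (λ e → j≢x (sym e)))
      (cong -_ (tri-neg (A-off i≢j) (A-off j≢x) (A-off i≢x) e))

    g-pos : ∀ {i j x} → T i j x ≡ 1ℤ → g i j x ≢ 0ℤ
    g-pos {i} {j} {x} e g≡0 with T-distinct e (λ ())
    ... | i≢j , j≢x , i≢x = tri-pos (A-off i≢j) (A-off j≢x) (A-off i≢x) e
      (trans (sym (neg-involutive (A i x + A i j * A j x)))
        (cong -_ (trans (sym (g-other (λ e → i≢x (sym e)) (λ e → j≢x (sym e)))) g≡0)))

    form-z : ∀ {i j k l} → g i j k ≡ 0ℤ → g i j l ≡ 0ℤ → form L (z i j) (z k l) ≡ 0ℤ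
    form-z {i} {j} {k} {l} e₁ e₂ = trans (dot-z (g i j) k l)
      (trans (cong₂ (λ x y → x + A k l * y) e₁ e₂) (trans (+-identityˡ (A k l * 0ℤ)) (*-zeroʳ (A k l))))

  -- As ijl is negative, `z i j` and `z i l` span an isotropic plane, so `g i j` and `g i l` are
  -- parallel. At u the first vanishes and the second does not; hence `g i j` = 0, which excludes
  -- positive triangles on ij.
  negative-edge : ∀ {i j l u} → T i j l ≡ -1ℤ → T i j u ≡ -1ℤ → T i l u ≡ 1ℤ → ∀ x → T i j x ≢ 1ℤ
  negative-edge {i} {j} {l} {u} e₁ e₂ e₃ x e₄ with T-distinct e₁ (λ ())
  ... | i≢j , j≢l , i≢l = nonzero (g-pos e₄) (g-pos e₃)
    (trans (Iso.isotropic-parallel trM trW D≢0 ∇<0 (z i j) (z i l)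
        (form-z {i} {j} {i} {j} (g-left i≢j) (g-right i≢j))
        (form-z {i} {j} {i} {l} (g-left i≢j) (g-neg e₁))
        (form-z {i} {l} {i} {l} (g-left i≢l) (g-right i≢l)) x u)
      (cong (_* g i l x) (g-neg e₂)))

-- The structure of the triangles

-- For a = 0 the quadratic q has the root -1, so the eigenvalue -1 has multiplicity b + 1 = n - 1
-- and the other eigenvalue is n - 1. Thus A + 1 should have rank one.
module Degenerate {n} {A : Matrix n} {b : ℕ} {c p : ℤ} (S : Spectral A 0 b c p) where

  open Spectral S
  open B
  open RingIdentities ring scalar-hom using (quad; two; shift-square; module Quartic)
  open Quartic (scalar c) (scalar p) gen root using (quad²-expand)

  private
    trace-arith : ∀ {b c p n x y z : ℤ} → c ≡ b - 0ℤ → p ≡ - (+ 2 * (0ℤ * b) + 0ℤ + b + 1ℤ) → n ≡ 0ℤ + b + + 2 →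
      x ≡ 0ℤ - b + (c * c * c - + 3 * c * p) → y ≡ n * (n - 1ℤ) → z ≡ 0ℤ →
      - c * x + (1ℤ + p + c * c) * y + - (c * (1ℤ + p) + c * p) * z + (1ℤ + p) * p * n ≡ 0ℤ
    trace-arith {b} refl refl refl refl refl refl = lem b
      where
        lem : ∀ b → let c = b - 0ℤ ; p = - (+ 2 * (0ℤ * b) + 0ℤ + b + 1ℤ) ; n = 0ℤ + b + + 2 in
          - c * (0ℤ - b + (c * c * c - + 3 * c * p)) + (1ℤ + p + c * c) * (n * (n - 1ℤ))
            + - (c * (1ℤ + p) + c * p) * 0ℤ + (1ℤ + p) * p * n ≡ 0ℤ
        lem = solve-∀

    -- The trace of q(A)² is 0 and q(A) is symmetric. This improves the quartic equation for A to a
    -- quadratic one.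
    quad-zero : ∀ i j → mat (quad (scalar c) (scalar p) gen) i j ≡ 0ℤ
    quad-zero = tr-sq-zero (mat-sym (quad (scalar c) (scalar p) gen)) (trans (tr-cong quad²-expand) (trans
      (tr-cubic (sc-neg (sc c)) (sc 1ℤ ⊕ sc p ⊕ sc c ⊛ sc c) (sc-neg (sc c ⊛ (sc 1ℤ ⊕ sc p) ⊕ sc c ⊛ sc p))
        ((sc 1ℤ ⊕ sc p) ⊛ sc p))
      (trace-arith {+ b} {c} {p} {+ n} {τ₃} {τ₂} {τ₁} c-val p-val size tr₃ tr₂ tr₁)))

    U : Elt
    U = gen R.+ scalar 1ℤ

    u : Matrix n
    u = mat U

    c+2 : c + + 2 ≡ + n
    c+2 = arith {+ b} {c} {+ n} c-val size
      where
        arith : ∀ {b c n : ℤ} → c ≡ b - 0ℤ → n ≡ 0ℤ + b + + 2 → c + + 2 ≡ n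
        arith {b} refl refl = lem b
          where lem : ∀ b → b - 0ℤ + + 2 ≡ 0ℤ + b + + 2
                lem = solve-∀

    p+1+c : p + 1ℤ + c ≡ 0ℤ
    p+1+c = arith {+ b} {c} {p} c-val p-val
      where
        arith : ∀ {b c p : ℤ} → c ≡ b - 0ℤ → p ≡ - (+ 2 * (0ℤ * b) + 0ℤ + b + 1ℤ) → p + 1ℤ + c ≡ 0ℤ
        arith {b} refl refl = lem b
          where lem : ∀ b → - (+ 2 * (0ℤ * b) + 0ℤ + b + 1ℤ) + 1ℤ + (b - 0ℤ) ≡ 0ℤ
                lem = solve-∀

    u-square : ∀ i j → (u · u) i j ≡ + n * u i j
    u-square i j = trans (shift-square (scalar c) (scalar p) gen i j) (trans
      (cong₂ _+_ (cong₂ _+_ (quad-zero i j) (trans (mat-scale′ (sc c ⊕ sc (+ 2)) U i j) (cong (_* u i j) c+2)))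
        (trans (≈scalar (sc-neg (sc p ⊕ sc 1ℤ ⊕ sc c)) i j) (trans (cong (λ w → - w * δ i j) p+1+c) refl)))
      (lem (+ n * u i j)))
      where lem : ∀ x → 0ℤ + x + 0ℤ ≡ x
            lem = solve-∀

    u-sign : ∀ i j → IsSign (u i j)
    u-sign i j with i ≟ j
    ... | yes refl = inj₁ (cong₂ (λ x y → x + 1ℤ * y) (A-diag i) (δ-diag i))
    ... | no i≢j = subst IsSign (sym (trans (cong (λ y → A i j + 1ℤ * y) (δ-off i≢j)) (+-identityʳ (A i j)))) (A-off i≢j)

    -- With all entries ±1 the sum is 2n - 2 u_ij (U²)_ij, and U² = nU together with u_ij² = 1 makes
    -- it 0. So U has rank one.
    u-sum : ∀ i j → sumFin (λ k → (u i k - u i j * u k j) * (u i k - u i j * u k j)) ≡ 0ℤ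
    u-sum i j = trans (sum-cong (λ k → trans (lem₁ (u i k) (u i j) (u k j))
        (cong₂ (λ x y → x + (- + 2 * u i j * (u i k * u k j) + u i j * u i j * y))
          (IsSign-sq (u-sign i k)) (IsSign-sq (u-sign k j)))))
      (trans (sum-cong (λ k → lem₂ (u i j) (u i k * u k j))) (trans (sum-linComb ts)
      (trans (cong₂ (λ x y → (1ℤ + u i j * u i j) * x + (- + 2 * u i j * y + 0ℤ)) (sum-const {n} 1ℤ) (u-square i j))
      (trans (lem₃ (u i j) (+ n)) (trans (cong (λ w → + n * (1ℤ - w)) (IsSign-sq (u-sign i j))) (*-zeroʳ (+ n)))))))
      where
        ts : Vec (ℤ × (Fin n → ℤ)) 2
        ts = (1ℤ + u i j * u i j , λ _ → 1ℤ) ∷ (- + 2 * u i j , λ k → u i k * u k j) ∷ []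
        lem₁ : ∀ x y z → (x - y * z) * (x - y * z) ≡ x * x + (- + 2 * y * (x * z) + y * y * (z * z))
        lem₁ = solve-∀
        lem₂ : ∀ y w → 1ℤ + (- + 2 * y * w + y * y * 1ℤ) ≡ (1ℤ + y * y) * 1ℤ + (- + 2 * y * w + 0ℤ)
        lem₂ = solve-∀
        lem₃ : ∀ y n → (1ℤ + y * y) * (n * 1ℤ) + (- + 2 * y * (n * y) + 0ℤ) ≡ n * (1ℤ - y * y)
        lem₃ = solve-∀

    u-product : ∀ i j k → u i k ≡ u i j * u k j
    u-product i j k = i-j≡0⇒i≡j _ _ (sum-sq-zero (λ k → u i k - u i j * u k j) (u-sum i j) k)

    u-off : ∀ {i j} → i ≢ j → u i j ≡ A i j
    u-off {i} {j} i≢j = trans (cong (λ y → A i j + 1ℤ * y) (δ-off i≢j)) (+-identityʳ (A i j))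

  all-positive : ∀ i j l → T i j l ≢ -1ℤ
  all-positive i j l e with T-distinct e (λ ())
  ... | i≢j , j≢l , i≢l = contradiction (trans (sym e) (trans
      (cong₂ (λ x y → A i j * x * y) (trans (A-sym j l) (sym (u-off (λ e → j≢l (sym e)))))
        (trans (sym (u-off i≢l)) (trans (u-product i j l) (cong (_* u l j) (u-off i≢j)))))
      (trans (lem (A i j) (u l j)) (cong₂ _*_ (IsSign-sq (A-off i≢j)) (IsSign-sq (u-sign l j)))))) (λ ())
    where lem : ∀ x y → x * y * (x * y) ≡ x * x * (y * y)
          lem = solve-∀

-- In the partition into P and Q, the vertex i represents Q and j represents P.
CenterPair : ∀ {n} {A : Matrix n} → SignMatrix A → Set
CenterPair {n} Σ₀ = Σ (Fin n) λ i → Σ (Fin n) λ j → i ≢ j × (∀ x → x ≢ i → x ≢ j →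
    (∀ y → T j x y ≢ -1ℤ) ⊎ (∀ y → T i x y ≢ 1ℤ))
  where open SignMatrix Σ₀

module _ {n} {A : Matrix (suc (suc n))} (Σ₀ : SignMatrix A) where

  open SignMatrix Σ₀

  private
    T± : ∀ {i j x} → i ≢ j → x ≢ i → x ≢ j → T i j x ≡ 1ℤ ⊎ T i j x ≡ -1ℤ
    T± i≢j x≢i x≢j = T-sign i≢j (λ e → x≢j (sym e)) (λ e → x≢i (sym e))

    T-rot : ∀ i j l → T i j l ≡ T j l i
    T-rot i j l = trans (T-swap₁₂ i j l) (T-swap₂₃ j i l)

  module _
    (neg-edge : ∀ {i j l u} → T i j l ≡ -1ℤ → T i j u ≡ -1ℤ → T i l u ≡ 1ℤ → ∀ x → T i j x ≢ 1ℤ)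
    (pos-edge : ∀ {i j l u} → T i j l ≡ 1ℤ → T i j u ≡ 1ℤ → T i l u ≡ -1ℤ → ∀ x → T i j x ≢ -1ℤ) where

    private
      -- In the structure sought, a triangle is negative exactly when at least two of its vertices
      -- lie in Q. The hypotheses put i, q into Q and j, p into P. So iq has no positive and jp no
      -- negative triangle, and the sign of ijx decides the side of any further x.
      mixed : ∀ {i j p q} → T i j p ≡ 1ℤ → T i j q ≡ -1ℤ → T i p q ≡ -1ℤ → CenterPair Σ₀
      mixed {i} {j} {p} {q} ijp ijq ipq = i , j , i≢j , side
        where
          i≢j = proj₁ (T-distinct ijp (λ ()))
          jpq : T j p q ≡ 1ℤ
          jpq = trans (T-swap₂₃ j p q) (quartet (inj₁ refl) (inj₂ refl) (inj₂ refl) ijp ijq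
            (trans (T-swap₂₃ i q p) ipq))
          i≢q = proj₂ (proj₂ (T-distinct ijq (λ ())))
          p≢j = λ (e : p ≡ j) → proj₁ (proj₂ (T-distinct ijp (λ ()))) (sym e)
          iq-neg : ∀ x → T i q x ≢ 1ℤ
          iq-neg = neg-edge {i} {q} {j} {p} (trans (T-swap₂₃ i q j) ijq) (trans (T-swap₂₃ i q p) ipq) ijp
          jp-pos : ∀ x → T j p x ≢ -1ℤ
          jp-pos = pos-edge {j} {p} {i} {q} (trans (sym (T-rot i j p)) ijp) jpq (trans (T-swap₁₂ j i q) ijq)
          side : ∀ x → x ≢ i → x ≢ j → (∀ y → T j x y ≢ -1ℤ) ⊎ (∀ y → T i x y ≢ 1ℤ)
          side x x≢i x≢j with T± i≢j x≢i x≢j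
          ... | inj₁ ijx = inj₁ (pos-edge {j} {x} {i} {q} (trans (sym (T-rot i j x)) ijx)
                  (trans (T-swap₂₃ j x q) jqx) (trans (T-swap₁₂ j i q) ijq))
            where
              x≢q : x ≢ q
              x≢q refl = contradiction (trans (sym ijx) ijq) (λ ())
              iqx : T i q x ≡ -1ℤ
              iqx with T± i≢q x≢i x≢q
              ... | inj₁ e = contradiction e (iq-neg x)
              ... | inj₂ e = e
              jqx : T j q x ≡ 1ℤ
              jqx = quartet (inj₁ refl) (inj₂ refl) (inj₂ refl) ijx ijq iqx
          ... | inj₂ ijx = inj₂ (neg-edge {i} {x} {j} {p} (trans (T-swap₂₃ i x j) ijx)
                  (trans (T-swap₂₃ i x p) ipx) ijp)
            where
              x≢p : x ≢ p
              x≢p refl = contradiction (trans (sym ijx) ijp) (λ ())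
              jpx : T j p x ≡ 1ℤ
              jpx with T± (λ e → p≢j (sym e)) x≢j x≢p
              ... | inj₁ e = e
              ... | inj₂ e = contradiction e (jp-pos x)
              ipx : T i p x ≡ -1ℤ
              ipx = quartet {j} {i} {x} {p} (inj₂ refl) (inj₁ refl) (inj₁ refl)
                (trans (T-swap₁₂ j i x) ijx) (trans (T-swap₁₂ j i p) ijp) jpx

    -- An edge with triangles of both signs must join P to Q, and the sign of ipq tells which of its
    -- ends lies in Q.
    center-pair : CenterPair Σ₀
    center-pair with any? (λ i → any? (λ j → any? (λ p → any? (λ q →
        (T i j p ℤ.≟ 1ℤ) ×-dec (T i j q ℤ.≟ -1ℤ)))))
    ... | yes (i , j , p , q , ijp , ijq) with T-distinct ijp (λ ()) | T-distinct ijq (λ ())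
    ...   | i≢j , j≢p , i≢p | _ , j≢q , i≢q = from-mixed (T-sign i≢p p≢q i≢q)
      where
        p≢q : p ≢ q
        p≢q refl = contradiction (trans (sym ijp) ijq) (λ ())
        from-mixed : T i p q ≡ 1ℤ ⊎ T i p q ≡ -1ℤ → CenterPair Σ₀
        from-mixed (inj₂ ipq) = mixed ijp ijq ipq
        from-mixed (inj₁ ipq) = mixed {j} {i} {p} {q} (trans (T-swap₁₂ j i p) ijp) (trans (T-swap₁₂ j i q) ijq)
          (trans (T-swap₂₃ j p q) (quartet (inj₁ refl) (inj₂ refl) (inj₁ refl) ijp ijq (trans (T-swap₂₃ i q p) ipq)))
    -- Without mixed edges all triangles on the edge 01 have one sign. Each edge 0x or 1x inherits
    -- it from the triangle 01x and, being unmixed, has no triangle of the other sign.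
    center-pair | no unmixed with any? (λ x → T zero (suc zero) x ℤ.≟ -1ℤ)
    ... | yes (x₀ , e₀) = zero , suc zero , (λ ()) , λ x x≢0 x≢1 → inj₂ (λ y 0xy →
        unmixed (zero , x , y , suc zero , 0xy , trans (T-swap₂₃ zero x (suc zero)) (01x x x≢0 x≢1)))
      where
        01x : ∀ x → x ≢ zero → x ≢ suc zero → T zero (suc zero) x ≡ -1ℤ
        01x x x≢0 x≢1 with T± {zero} {suc zero} (λ ()) x≢0 x≢1
        ... | inj₁ e = contradiction (zero , suc zero , x , x₀ , e , e₀) unmixed
        ... | inj₂ e = e
    ... | no none = zero , suc zero , (λ ()) , λ x x≢0 x≢1 → inj₁ (λ y 1xy →
        unmixed (suc zero , x , zero , y , trans (sym (T-rot zero (suc zero) x)) (01x x x≢0 x≢1) , 1xy))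
      where
        01x : ∀ x → x ≢ zero → x ≢ suc zero → T zero (suc zero) x ≡ 1ℤ
        01x x x≢0 x≢1 with T± {zero} {suc zero} (λ ()) x≢0 x≢1
        ... | inj₁ e = e
        ... | inj₂ e = contradiction (x , e) none

spectral-center-pair : ∀ {n} {A : Matrix (suc (suc n))} {a b c p} (S : Spectral A a b c p) →
  CenterPair (Spectral.signMatrix S)
spectral-center-pair {a = zero} S =
  zero , suc zero , (λ ()) , λ x _ _ → inj₁ (λ y → Degenerate.all-positive S (suc zero) x y)
spectral-center-pair {A = A} {a = suc a} {zero} S =
  zero , suc zero , (λ ()) , λ x _ _ → inj₂ (λ y e →
    Degenerate.all-positive (negate-spectral S) zero x y
      (trans (neg-T (A zero x) (A x y) (A zero y)) (cong -_ e)))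
  where neg-T : ∀ x y z → - x * - y * - z ≡ - (x * y * z)
        neg-T = solve-∀
spectral-center-pair {A = A} {a = suc a} {suc b} S = center-pair (Spectral.signMatrix S)
  (Nondegenerate.negative-edge S)
  (λ {i} {j} {l} {u} e₁ e₂ e₃ x e₄ → Nondegenerate.negative-edge (negate-spectral S) {i} {j} {l} {u}
    (flip i j l e₁) (flip i j u e₂) (flip i l u e₃) x (flip i j x e₄))
  where
    neg-T : ∀ x y z → - x * - y * - z ≡ - (x * y * z)
    neg-T = solve-∀
    flip : ∀ i j l {s} → A i j * A j l * A i l ≡ s → - A i j * - A j l * - A i l ≡ - s
    flip i j l e = trans (neg-T (A i j) (A j l) (A i l)) (cong -_ e)

-- Standard form

ε : Bool → Bool → ℤ
ε true  true  = -1ℤ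
ε true  false = 1ℤ
ε false _     = 1ℤ

-- w is the indicator of Q and r the switching.
record StandardForm {n} (A : Matrix n) : Set where
  field
    w       : Fin n → Bool
    r       : Fin n → ℤ
    r-sign  : ∀ x → IsSign (r x)
    shape   : ∀ {x y} → x ≢ y → A x y ≡ r x * r y * ε (w x) (w y)
    inside  : Σ (Fin n) λ i → w i ≡ true
    outside : Σ (Fin n) λ j → w j ≡ false

standard-form : ∀ {n} {A : Matrix n} (Σ₀ : SignMatrix A) → CenterPair Σ₀ → StandardForm A
standard-form {n} {A} Σ₀ (i , j , i≢j , side) = record
  { w = λ x → ⌊ P? x ⌋ ; r = λ x → r′ x (x ≟ j) ; r-sign = λ x → r-sign x (x ≟ j)
  ; shape = λ {x} {y} x≢y → shape x≢y (x ≟ j) (y ≟ j)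
  ; inside = i , true-if (P? i) (inj₁ refl) ; outside = j , false-if (P? j) ¬Pj }
  where
    open SignMatrix Σ₀
    -- Membership in Q, despite the letter: i itself and all x for which ijx is negative.
    P : Fin n → Set
    P x = x ≡ i ⊎ T i j x ≡ -1ℤ
    P? : ∀ x → Dec (P x)
    P? x = (x ≟ i) ⊎-dec (T i j x ℤ.≟ -1ℤ)
    true-if : ∀ {X : Set} (d : Dec X) → X → ⌊ d ⌋ ≡ true
    true-if (yes _) x = refl
    true-if (no ¬x) x = contradiction x ¬x
    false-if : ∀ {X : Set} (d : Dec X) → ¬ X → ⌊ d ⌋ ≡ false
    false-if (yes x) ¬x = contradiction x ¬x
    false-if (no _)  ¬x = refl
    ¬Pj : ¬ P j
    ¬Pj (inj₁ j≡i) = i≢j (sym j≡i)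
    ¬Pj (inj₂ e) = proj₁ (proj₂ (T-distinct e (λ ()))) refl
    -- Switching by row j makes every edge at j positive, and the edge xy then gets the sign
    -- `T j x y`.
    r′ : ∀ x → Dec (x ≡ j) → ℤ
    r′ x (yes _) = 1ℤ
    r′ x (no _)  = A j x
    r-sign : ∀ x d → IsSign (r′ x d)
    r-sign x (yes _)  = inj₁ refl
    r-sign x (no x≢j) = A-off (λ e → x≢j (sym e))
    positive-side : ∀ {x} → x ≢ j → ¬ P x → ∀ y → T j x y ≢ -1ℤ
    positive-side {x} x≢j ¬Px with side x (λ e → ¬Px (inj₁ e)) x≢j
    ... | inj₁ h = h
    ... | inj₂ h with T-sign i≢j (λ e → x≢j (sym e)) (λ e → ¬Px (inj₁ (sym e)))
    ...   | inj₁ e = contradiction (trans (T-swap₂₃ i x j) e) (h j)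
    ...   | inj₂ e = contradiction (inj₂ e) ¬Px
    negative-side : ∀ {x} → x ≢ i → x ≢ j → T i j x ≡ -1ℤ → ∀ y → T i x y ≢ 1ℤ
    negative-side {x} x≢i x≢j e with side x x≢i x≢j
    ... | inj₁ h = contradiction (trans (trans (T-swap₂₃ j x i) (T-swap₁₂ j i x)) e) (h i)
    ... | inj₂ h = h
    tri-pos : ∀ {x y} → x ≢ j → y ≢ j → x ≢ y → ¬ P x → T j x y ≡ 1ℤ
    tri-pos {x} {y} x≢j y≢j x≢y ¬Px with T-sign {j} {x} {y} (λ e → x≢j (sym e)) x≢y (λ e → y≢j (sym e))
    ... | inj₁ e = e
    ... | inj₂ e = contradiction e (positive-side x≢j ¬Px y)
    tri-neg : ∀ {x y} → x ≢ j → y ≢ j → x ≢ y → P x → P y → T j x y ≡ -1ℤ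
    tri-neg x≢j y≢j x≢y (inj₁ refl) (inj₁ refl) = contradiction refl x≢y
    tri-neg {y = y} x≢j y≢j x≢y (inj₁ refl) (inj₂ e) = trans (T-swap₁₂ j i y) e
    tri-neg {x = x} x≢j y≢j x≢y (inj₂ e) (inj₁ refl) = trans (T-swap₂₃ j x i) (trans (T-swap₁₂ j i x) e)
    tri-neg {x} {y} x≢j y≢j x≢y (inj₂ e) (inj₂ e′) = quartet (inj₂ refl) (inj₂ refl) (inj₂ refl) e′ e ixy
      where
        x≢i : x ≢ i
        x≢i x≡i = proj₂ (proj₂ (T-distinct e (λ ()))) (sym x≡i)
        ixy : T i x y ≡ -1ℤ
        ixy with T-sign {i} {x} {y} (λ e → x≢i (sym e)) x≢y (proj₂ (proj₂ (T-distinct e′ (λ ()))))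
        ... | inj₁ e″ = contradiction e″ (negative-side x≢i x≢j e y)
        ... | inj₂ e″ = e″
    core : ∀ {x y} → x ≢ j → y ≢ j → x ≢ y → (d : Dec (P x)) (d′ : Dec (P y)) → T j x y ≡ ε ⌊ d ⌋ ⌊ d′ ⌋
    core x≢j y≢j x≢y (no ¬Px) d′ = tri-pos x≢j y≢j x≢y ¬Px
    core {x} {y} x≢j y≢j x≢y (yes Px) (no ¬Py) =
      trans (T-swap₂₃ j x y) (tri-pos y≢j x≢j (λ e → x≢y (sym e)) ¬Py)
    core x≢j y≢j x≢y (yes Px) (yes Py) = tri-neg x≢j y≢j x≢y Px Py
    ε-comm : ∀ b → ε b false ≡ 1ℤ
    ε-comm true = refl
    ε-comm false = refl
    shape : ∀ {x y} → x ≢ y → (d : Dec (x ≡ j)) (d′ : Dec (y ≡ j)) →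
      A x y ≡ r′ x d * r′ y d′ * ε ⌊ P? x ⌋ ⌊ P? y ⌋
    shape x≢y (yes refl) (yes refl) = contradiction refl x≢y
    shape {y = y} x≢y (yes refl) (no y≢j) = sym (trans (cong (λ b → 1ℤ * A j y * ε b ⌊ P? y ⌋) (false-if (P? j) ¬Pj)) (lem (A j y)))
      where lem : ∀ x → 1ℤ * x * 1ℤ ≡ x
            lem = solve-∀
    shape {x} x≢y (no x≢j) (yes refl) = sym (trans (cong (A j x * 1ℤ *_) (trans (cong (ε ⌊ P? x ⌋) (false-if (P? j) ¬Pj)) (ε-comm ⌊ P? x ⌋)))
      (trans (lem (A j x)) (A-sym j x)))
      where lem : ∀ x → x * 1ℤ * 1ℤ ≡ x
            lem = solve-∀
    shape {x} {y} x≢y (no x≢j) (no y≢j) = sym (trans (cong (A j x * A j y *_) (sym (core x≢j y≢j x≢y (P? x) (P? y))))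
      (trans (lem (A j x) (A j y) (A x y)) (trans (cong₂ (λ u v → u * v * A x y)
        (IsSign-sq (A-off (λ e → x≢j (sym e)))) (IsSign-sq (A-off (λ e → y≢j (sym e))))) (*-identityˡ (A x y)))))
      where lem : ∀ a b c → a * b * (a * c * b) ≡ a * a * (b * b) * c
            lem = solve-∀

-- The size of Q and the trace of A³

bit : Bool → ℕ
bit true  = 1
bit false = 0

count : ∀ {n} → (Fin n → Bool) → ℕ
count {zero}  w = 0
count {suc n} w = bit (w zero) ℕ.+ count (λ i → w (suc i))

val : Bool → ℤ
val b = + bit b

sum-val : ∀ {n} (w : Fin n → Bool) → sumFin (λ i → val (w i)) ≡ + count w
sum-val {zero}  w = refl
sum-val {suc n} w = cong (λ x → val (w zero) + x) (sum-val (λ i → w (suc i)))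

count-punchIn : ∀ {n} (w : Fin (suc n) → Bool) i → count w ≡ bit (w i) ℕ.+ count (λ k → w (punchIn i k))
count-punchIn w zero = refl
count-punchIn {suc n} w (suc i) = trans (cong (bit (w zero) ℕ.+_) (count-punchIn (λ k → w (suc k)) i))
  (lem (bit (w zero)) (bit (w (suc i))) (count (λ k → w (suc (punchIn i k)))))
  where lem : ∀ a b c → a ℕ.+ (b ℕ.+ c) ≡ b ℕ.+ (a ℕ.+ c)
        lem a b c = trans (sym (ℕ.+-assoc a b c)) (trans (cong (ℕ._+ c) (ℕ.+-comm a b)) (ℕ.+-assoc b a c))

count≤n : ∀ {n} (w : Fin n → Bool) → count w ℕ.≤ n
count≤n {zero}  w = ℕ.z≤n
count≤n {suc n} w with w zero
... | true  = ℕ.s≤s (count≤n (λ i → w (suc i)))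
... | false = ℕ.m≤n⇒m≤1+n (count≤n (λ i → w (suc i)))

count-all : ∀ {n} (w : Fin n → Bool) b → (∀ i → w i ≡ b) → count w ≡ n ℕ.* bit b
count-all {zero}  w b h = refl
count-all {suc n} w b h = cong₂ ℕ._+_ (cong bit (h zero)) (count-all (λ i → w (suc i)) b (λ i → h (suc i)))

matching : ∀ {n} (w w′ : Fin (suc n) → Bool) → count w ≡ count w′ → Σ (Fin (suc n)) λ i → w i ≡ w′ zero
matching {n} w w′ e with any? (λ i → w i Bool.≟ w′ zero)
... | yes h = h
... | no ¬h = contradiction (trans (sym (count-all w (not (w′ zero)) (λ i → Bool.¬-not (λ e → ¬h (i , e))))) e)
                (impossible (w′ zero) refl)
  where
    impossible : ∀ b → w′ zero ≡ b → suc n ℕ.* bit (not (w′ zero)) ≢ count w′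
    impossible b e′ with w′ zero
    impossible true  refl | true  = λ e → contradiction (trans (sym (ℕ.*-zeroʳ (suc n))) e) (λ ())
    impossible false refl | false = λ e → ℕ.<-irrefl (trans (sym e) (ℕ.*-identityʳ (suc n))) (ℕ.s≤s (count≤n (λ i → w′ (suc i))))

count-permutation : ∀ {n} (w w′ : Fin n → Bool) → count w ≡ count w′ →
  Σ (Permutation′ n) λ π → ∀ x → w′ x ≡ w (π ⟨$⟩ʳ x)
count-permutation {zero}  w w′ e = Perm.id , λ ()
count-permutation {suc n} w w′ e with matching w w′ e
... | i , wi with count-permutation (λ k → w (punchIn i k)) (λ k → w′ (suc k))
      (ℕ.+-cancelˡ-≡ (bit (w i)) _ _ (trans (sym (count-punchIn w i)) (trans e
        (cong (λ b → bit b ℕ.+ count (λ k → w′ (suc k))) (sym wi)))))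
...   | π , h = insert zero i π , λ { zero → sym wi
                                    ; (suc k) → trans (h k) (cong w (sym (insert-punchIn zero i π k))) }

-- The entry of the standard form as a polynomial in the indicators and d = δ x y: for d = 0 it is
-- `ε`, and on the diagonal it is 0. This makes the sums over vertices computable.
E⟨_,_⟩ : Bool → Bool → ℤ → ℤ
E⟨ b , b′ ⟩ d = (1ℤ - + 2 * val b * val b′) - d * (1ℤ - + 2 * val b)

-- tr A³ for |Q| = k: each ordered pair inside P, inside Q or across contributes
-- n − 2, −(n − 2) or n − 2k respectively.
triangleSum : ℤ → ℤ → ℤ
triangleSum n k = (n - + 2) * (n * n) - (n - + 2) * n + + 2 * (n - + 2) * k
  + + 2 * (+ 2 - + 2 * k) * (k * n) - + 2 * ((n - + 2) + (+ 2 - + 2 * k)) * (k * k)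

module _ {n} {A : Matrix n} (Σ₀ : SignMatrix A) (F : StandardForm A) where

  open SignMatrix Σ₀
  open StandardForm F

  private
    v : Fin n → ℤ
    v x = val (w x)

    k : ℤ
    k = + count w

    E : Matrix n
    E x y = E⟨ w x , w y ⟩ (δ x y)

    ε-val : ∀ b b′ → ε b b′ ≡ E⟨ b , b′ ⟩ 0ℤ
    ε-val true  true  = refl
    ε-val true  false = refl
    ε-val false true  = refl
    ε-val false false = refl

    E-diag : ∀ b → E⟨ b , b ⟩ 1ℤ ≡ 0ℤ
    E-diag true  = refl
    E-diag false = refl

    A-E : ∀ x y → A x y ≡ r x * r y * E x y
    A-E x y with x ≟ y
    ... | yes refl = trans (A-diag x) (sym (trans (cong (r x * r x *_)
            (trans (cong E⟨ w x , w x ⟩ (δ-diag x)) (E-diag (w x)))) (*-zeroʳ (r x * r x))))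
    ... | no x≢y = trans (shape x≢y) (cong (r x * r y *_)
            (trans (ε-val (w x) (w y)) (cong E⟨ w x , w y ⟩ (sym (δ-off x≢y)))))

    κ e₁ e₂ e₃ : Bool → Bool → ℤ
    κ b b′ = - + 2 * val b - + 2 * val b′ + + 4 * val b * val b′
    e₁ b b′ = (1ℤ - + 2 * val b) * (1ℤ - + 2 * val b * val b′)
    e₂ b b′ = (1ℤ - + 2 * val b′) * (1ℤ - + 2 * val b * val b′)
    e₃ b b′ = (1ℤ - + 2 * val b) * (1ℤ - + 2 * val b′)

    -- As a function of z the product is a combination of 1, `v z`, δ y z, δ x z and δ y z · δ x z,
    -- each of which has a known sum. The coefficients are verified on all Boolean values.
    entry : ∀ y x z → E y z * E z x ≡
      1ℤ * 1ℤ + (κ (w y) (w x) * v z + (- e₁ (w y) (w x) * (δ y z * 1ℤ) + (- e₂ (w y) (w x) * (δ x z * 1ℤ)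
        + (e₃ (w y) (w x) * (δ y z * δ x z) + 0ℤ))))
    entry y x z rewrite δ-sym z x with y ≟ z | x ≟ z
    ... | yes refl | yes refl rewrite δ-diag z with w z
    ...   | true  = refl
    ...   | false = refl
    entry y x z | yes refl | no x≢z rewrite δ-diag z | δ-off x≢z with w z | w x
    ...   | true  | true  = refl
    ...   | true  | false = refl
    ...   | false | true  = refl
    ...   | false | false = refl
    entry y x z | no y≢z | yes refl rewrite δ-diag z | δ-off y≢z with w y | w z
    ...   | true  | true  = refl
    ...   | true  | false = refl
    ...   | false | true  = refl
    ...   | false | false = refl
    entry y x z | no y≢z | no x≢z rewrite δ-off y≢z | δ-off x≢z with w y | w z | w x
    ...   | true  | true  | true  = refl
    ...   | true  | true  | false = refl
    ...   | true  | false | true  = refl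
    ...   | true  | false | false = refl
    ...   | false | true  | true  = refl
    ...   | false | true  | false = refl
    ...   | false | false | true  = refl
    ...   | false | false | false = refl

    E² : ∀ y x → (E · E) y x ≡ + n * 1ℤ * 1ℤ + (κ (w y) (w x) * k + (- e₁ (w y) (w x) * 1ℤ
      + (- e₂ (w y) (w x) * 1ℤ + (e₃ (w y) (w x) * δ x y + 0ℤ))))
    E² y x = trans (sum-cong (entry y x)) (trans (sum-linComb ts)
      (cong₂ _+_ (trans (*-identityˡ (sumFin {n} (λ _ → 1ℤ))) (trans (sum-const {n} 1ℤ) (sym (*-identityʳ (+ n * 1ℤ)))))
      (cong₂ _+_ (cong (κ (w y) (w x) *_) (sum-val w))
      (cong₂ _+_ (cong (- e₁ (w y) (w x) *_) (sum-δ y (λ _ → 1ℤ)))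
      (cong₂ _+_ (cong (- e₂ (w y) (w x) *_) (sum-δ x (λ _ → 1ℤ)))
        (cong (λ u → e₃ (w y) (w x) * u + 0ℤ) (sum-δ y (δ x))))))))
      where
        ts : Vec (ℤ × (Fin n → ℤ)) 5
        ts = (1ℤ , λ _ → 1ℤ) ∷ (κ (w y) (w x) , v) ∷ (- e₁ (w y) (w x) , λ z → δ y z * 1ℤ)
          ∷ (- e₂ (w y) (w x) , λ z → δ x z * 1ℤ) ∷ (e₃ (w y) (w x) , λ z → δ y z * δ x z) ∷ []

    α β : ℤ → ℤ
    α n = n - + 2
    β k = + 2 - + 2 * k

    row : ∀ N K bx by → E⟨ bx , by ⟩ 0ℤ * (N * 1ℤ * 1ℤ + (κ by bx * K + (- e₁ by bx * 1ℤ
        + (- e₂ by bx * 1ℤ + (e₃ by bx * 0ℤ + 0ℤ))))) ≡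
      (α N + β K * val bx) * 1ℤ + ((β K - + 2 * (α N + β K) * val bx) * val by + (- ((1ℤ - + 2 * val bx) * α N) * 0ℤ + 0ℤ))
    row N K true true = lem N K
      where lem : ∀ N K → -1ℤ * (N * 1ℤ * 1ℤ + (0ℤ * K + (-1ℤ * 1ℤ + (-1ℤ * 1ℤ + (1ℤ * 0ℤ + 0ℤ))))) ≡
              (N - + 2 + (+ 2 - + 2 * K) * 1ℤ) * 1ℤ
              + ((+ 2 - + 2 * K - + 2 * (N - + 2 + (+ 2 - + 2 * K)) * 1ℤ) * 1ℤ + (- (-1ℤ * (N - + 2)) * 0ℤ + 0ℤ))
            lem = solve-∀
    row N K true false = lem N K
      where lem : ∀ N K → 1ℤ * (N * 1ℤ * 1ℤ + (- + 2 * K + (-1ℤ * 1ℤ + (1ℤ * 1ℤ + (-1ℤ * 0ℤ + 0ℤ))))) ≡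
              (N - + 2 + (+ 2 - + 2 * K) * 1ℤ) * 1ℤ
              + ((+ 2 - + 2 * K - + 2 * (N - + 2 + (+ 2 - + 2 * K)) * 1ℤ) * 0ℤ + (- (-1ℤ * (N - + 2)) * 0ℤ + 0ℤ))
            lem = solve-∀
    row N K false true = lem N K
      where lem : ∀ N K → 1ℤ * (N * 1ℤ * 1ℤ + (- + 2 * K + (1ℤ * 1ℤ + (-1ℤ * 1ℤ + (-1ℤ * 0ℤ + 0ℤ))))) ≡
              (N - + 2 + (+ 2 - + 2 * K) * 0ℤ) * 1ℤ
              + ((+ 2 - + 2 * K - + 2 * (N - + 2 + (+ 2 - + 2 * K)) * 0ℤ) * 1ℤ + (- (1ℤ * (N - + 2)) * 0ℤ + 0ℤ))
            lem = solve-∀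
    row N K false false = lem N K
      where lem : ∀ N K → 1ℤ * (N * 1ℤ * 1ℤ + (0ℤ * K + (-1ℤ * 1ℤ + (-1ℤ * 1ℤ + (1ℤ * 0ℤ + 0ℤ))))) ≡
              (N - + 2 + (+ 2 - + 2 * K) * 0ℤ) * 1ℤ
              + ((+ 2 - + 2 * K - + 2 * (N - + 2 + (+ 2 - + 2 * K)) * 0ℤ) * 0ℤ + (- (1ℤ * (N - + 2)) * 0ℤ + 0ℤ))
            lem = solve-∀

    row-diag : ∀ N K b → 0ℤ ≡
      (α N + β K * val b) * 1ℤ + ((β K - + 2 * (α N + β K) * val b) * val b + (- ((1ℤ - + 2 * val b) * α N) * 1ℤ + 0ℤ))
    row-diag N K true = lem N K
      where lem : ∀ N K → 0ℤ ≡ (N - + 2 + (+ 2 - + 2 * K) * 1ℤ) * 1ℤ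
              + ((+ 2 - + 2 * K - + 2 * (N - + 2 + (+ 2 - + 2 * K)) * 1ℤ) * 1ℤ + (- (-1ℤ * (N - + 2)) * 1ℤ + 0ℤ))
            lem = solve-∀
    row-diag N K false = lem N K
      where lem : ∀ N K → 0ℤ ≡ (N - + 2 + (+ 2 - + 2 * K) * 0ℤ) * 1ℤ
              + ((+ 2 - + 2 * K - + 2 * (N - + 2 + (+ 2 - + 2 * K)) * 0ℤ) * 0ℤ + (- (1ℤ * (N - + 2)) * 1ℤ + 0ℤ))
            lem = solve-∀

    row-entry : ∀ x y → E x y * (E · E) y x ≡
      (α (+ n) + β k * v x) * 1ℤ + ((β k - + 2 * (α (+ n) + β k) * v x) * v y
        + (- ((1ℤ - + 2 * v x) * α (+ n)) * (δ x y * 1ℤ) + 0ℤ))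
    row-entry x y with x ≟ y
    ... | yes refl = trans (cong (_* (E · E) x x) (trans (cong E⟨ w x , w x ⟩ (δ-diag x)) (E-diag (w x))))
            (trans (row-diag (+ n) k (w x)) (cong (λ d → (α (+ n) + β k * v x) * 1ℤ
              + ((β k - + 2 * (α (+ n) + β k) * v x) * v x + (- ((1ℤ - + 2 * v x) * α (+ n)) * (d * 1ℤ) + 0ℤ)))
              (sym (δ-diag x))))
    ... | no x≢y = trans (cong₂ _*_ (cong E⟨ w x , w y ⟩ (δ-off x≢y))
              (trans (E² y x) (cong (λ d → + n * 1ℤ * 1ℤ + (κ (w y) (w x) * k + (- e₁ (w y) (w x) * 1ℤ
                + (- e₂ (w y) (w x) * 1ℤ + (e₃ (w y) (w x) * d + 0ℤ))))) (δ-off x≢y))))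
            (trans (row (+ n) k (w x) (w y)) (cong (λ d → (α (+ n) + β k * v x) * 1ℤ
              + ((β k - + 2 * (α (+ n) + β k) * v x) * v y + (- ((1ℤ - + 2 * v x) * α (+ n)) * (d * 1ℤ) + 0ℤ)))
              (sym (δ-off x≢y))))

    row-sum : ∀ x → (E · (E · E)) x x ≡
      (α (+ n) + β k * v x) * (+ n * 1ℤ) + ((β k - + 2 * (α (+ n) + β k) * v x) * k
        + (- ((1ℤ - + 2 * v x) * α (+ n)) * 1ℤ + 0ℤ))
    row-sum x = trans (sum-cong (row-entry x)) (trans (sum-linComb ts)
      (cong₂ _+_ (cong ((α (+ n) + β k * v x) *_) (sum-const {n} 1ℤ))
        (cong₂ _+_ (cong ((β k - + 2 * (α (+ n) + β k) * v x) *_) (sum-val w))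
          (cong (λ u → - ((1ℤ - + 2 * v x) * α (+ n)) * u + 0ℤ) (sum-δ x (λ _ → 1ℤ))))))
      where
        ts : Vec (ℤ × (Fin n → ℤ)) 3
        ts = (α (+ n) + β k * v x , λ _ → 1ℤ) ∷ (β k - + 2 * (α (+ n) + β k) * v x , v)
          ∷ (- ((1ℤ - + 2 * v x) * α (+ n)) , λ y → δ x y * 1ℤ) ∷ []

    E³ : tr (E · (E · E)) ≡ triangleSum (+ n) k
    E³ = trans (sum-cong (λ x → trans (row-sum x) (lem₁ (+ n) k (v x)))) (trans (sum-linComb ts)
      (trans (cong₂ (λ a b → (α (+ n) * + n + β k * k - α (+ n)) * a
        + ((β k * + n - + 2 * (α (+ n) + β k) * k + + 2 * α (+ n)) * b + 0ℤ)) (sum-const {n} 1ℤ) (sum-val w))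
        (lem₂ (+ n) k)))
      where
        ts : Vec (ℤ × (Fin n → ℤ)) 2
        ts = (α (+ n) * + n + β k * k - α (+ n) , λ _ → 1ℤ)
          ∷ (β k * + n - + 2 * (α (+ n) + β k) * k + + 2 * α (+ n) , v) ∷ []
        lem₁ : ∀ n k v → let a = n - + 2 ; b = + 2 - + 2 * k in
          (a + b * v) * (n * 1ℤ) + ((b - + 2 * (a + b) * v) * k + (- ((1ℤ - + 2 * v) * a) * 1ℤ + 0ℤ)) ≡
          (a * n + b * k - a) * 1ℤ + ((b * n - + 2 * (a + b) * k + + 2 * a) * v + 0ℤ)
        lem₁ = solve-∀
        lem₂ : ∀ n k → let a = n - + 2 ; b = + 2 - + 2 * k in
          (a * n + b * k - a) * (n * 1ℤ) + ((b * n - + 2 * (a + b) * k + + 2 * a) * k + 0ℤ) ≡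
          (n - + 2) * (n * n) - (n - + 2) * n + + 2 * (n - + 2) * k
            + + 2 * (+ 2 - + 2 * k) * (k * n) - + 2 * ((n - + 2) + (+ 2 - + 2 * k)) * (k * k)
        lem₂ = solve-∀

  -- The switching signs cancel along closed walks.
  triangle-trace : tr (A · (A · A)) ≡ triangleSum (+ n) (+ count w)
  triangle-trace = trans (sum-cong (λ x → sum-cong (λ y → begin
      A x y * (A · A) y x
        ≡⟨ cong₂ _*_ (A-E x y) (trans (sum-cong (λ z → trans (cong₂ _*_ (A-E y z) (A-E z x))
             (lem₁ (r y) (r z) (E y z) (r x) (E z x)))) (trans (sum-cong (λ z →
               trans (cong (λ u → u * (r y * r x) * (E y z * E z x)) (IsSign-sq (r-sign z)))
                 (cong (_* (E y z * E z x)) (*-identityˡ (r y * r x)))))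
             (sum-*ˡ (r y * r x) (λ z → E y z * E z x)))) ⟩
      r x * r y * E x y * (r y * r x * (E · E) y x) ≡⟨ lem₂ (r x) (r y) (E x y) ((E · E) y x) ⟩
      r x * r x * (r y * r y) * (E x y * (E · E) y x)
        ≡⟨ cong₂ (λ a b → a * b * (E x y * (E · E) y x)) (IsSign-sq (r-sign x)) (IsSign-sq (r-sign y)) ⟩
      1ℤ * 1ℤ * (E x y * (E · E) y x) ≡⟨ *-identityˡ (E x y * (E · E) y x) ⟩
      E x y * (E · E) y x ∎))) E³
    where
      lem₁ : ∀ a b e c f → a * b * e * (b * c * f) ≡ b * b * (a * c) * (e * f)
      lem₁ = solve-∀
      lem₂ : ∀ a b e f → a * b * e * (b * a * f) ≡ a * a * (b * b) * (e * f)
      lem₂ = solve-∀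

module _ {n} {A : Matrix n} (F : StandardForm A) where

  open StandardForm F

  count-positive : 1 ℕ.≤ count w
  count-positive = positive-count w (proj₁ inside) (proj₂ inside)
    where
      positive-count : ∀ {n} (w : Fin n → Bool) i → w i ≡ true → 1 ℕ.≤ count w
      positive-count w zero e rewrite e = ℕ.s≤s ℕ.z≤n
      positive-count w (suc i) e = ℕ.≤-trans (positive-count (λ i → w (suc i)) i e) (ℕ.m≤n+m _ (bit (w zero)))

  count-bounded : count w ℕ.< n
  count-bounded = bounded-count w (proj₁ outside) (proj₂ outside)
    where
      bounded-count : ∀ {n} (w : Fin n → Bool) i → w i ≡ false → count w ℕ.< n
      bounded-count w zero e rewrite e = ℕ.s≤s (count≤n (λ i → w (suc i)))
      bounded-count w (suc i) e with w zero
      ... | true  = ℕ.s≤s (bounded-count (λ i → w (suc i)) i e)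
      ... | false = ℕ.m≤n⇒m≤1+n (bounded-count (λ i → w (suc i)) i e)

-- Switching isomorphism

private
  -- Writing 1 ≤ K < L < N with slack variables k, u, v makes the difference 2 (1 + u) (6 + `Q`),
  -- where `Q` has only nonnegative coefficients.
  triangleSum-difference : ∀ {N K L k u v : ℤ} → K ≡ 1ℤ + k → L ≡ 1ℤ + K + u → N ≡ 1ℤ + L + v →
    0ℤ ≤ k → 0ℤ ≤ u → 0ℤ ≤ v → triangleSum N K ≢ triangleSum N L
  triangleSum-difference {k = k} {u} {v} refl refl refl 0≤k 0≤u 0≤v e =
    nonzero (trans (sym (difference k u v)) (i≡j⇒i-j≡0 e))
    where
      Q : ℤ
      Q = + 5 * u + (+ 6 * k + (+ 3 * (k * u) + (u * u + + 3 * (v * (+ 2 * k + + 2 + u)))))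
      difference : ∀ k u v →
        let K = 1ℤ + k ; L = 1ℤ + (1ℤ + k) + u ; N = 1ℤ + (1ℤ + (1ℤ + k) + u) + v in
        ((N - + 2) * (N * N) - (N - + 2) * N + + 2 * (N - + 2) * K
          + + 2 * (+ 2 - + 2 * K) * (K * N) - + 2 * ((N - + 2) + (+ 2 - + 2 * K)) * (K * K))
        - ((N - + 2) * (N * N) - (N - + 2) * N + + 2 * (N - + 2) * L
          + + 2 * (+ 2 - + 2 * L) * (L * N) - + 2 * ((N - + 2) + (+ 2 - + 2 * L)) * (L * L)) ≡
        + 2 * (1ℤ + u) * (+ 6 + (+ 5 * u + (+ 6 * k + (+ 3 * (k * u) + (u * u + + 3 * (v * (+ 2 * k + + 2 + u)))))))
      difference = solve-∀
      _⊗_ : ∀ {x y} → 0ℤ ≤ x → 0ℤ ≤ y → 0ℤ ≤ x * y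
      _⊗_ {x} {y} hx hy = subst (_≤ x * y) (*-zeroʳ x) (*-monoˡ-≤-nonNeg x {{nonNegative hx}} hy)
      0≤+ : ∀ m → 0ℤ ≤ + m
      0≤+ m = +≤+ ℕ.z≤n
      0≤Q : 0ℤ ≤ Q
      0≤Q = +-mono-≤ (0≤+ 5 ⊗ 0≤u) (+-mono-≤ (0≤+ 6 ⊗ 0≤k) (+-mono-≤ (0≤+ 3 ⊗ (0≤k ⊗ 0≤u))
        (+-mono-≤ (0≤u ⊗ 0≤u) (0≤+ 3 ⊗ (0≤v ⊗ (+-mono-≤ (+-mono-≤ (0≤+ 2 ⊗ 0≤k) (0≤+ 2)) 0≤u))))))
      nonzero : + 2 * (1ℤ + u) * (+ 6 + Q) ≢ 0ℤ
      nonzero h with i*j≡0⇒i≡0∨j≡0 (+ 2 * (1ℤ + u)) h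
      ... | inj₂ h′ = contradiction (proj₁ (+-nonneg-zero (0≤+ 6) 0≤Q h′)) (λ ())
      ... | inj₁ h′ with i*j≡0⇒i≡0∨j≡0 (+ 2) h′
      ...   | inj₂ h″ = contradiction (proj₁ (+-nonneg-zero (0≤+ 1) 0≤u h″)) (λ ())

triangleSum-decreasing : ∀ {n k l} → 1 ℕ.≤ k → k ℕ.< l → l ℕ.< n →
  triangleSum (+ n) (+ k) ≢ triangleSum (+ n) (+ l)
triangleSum-decreasing {n} {suc k} {l} _ k<l l<n with ℕ.m≤n⇒∃[o]m+o≡n k<l | ℕ.m≤n⇒∃[o]m+o≡n l<n
... | u , e | v , e′ = triangleSum-difference {+ n} {+ suc k} {+ l} {+ k} {+ u} {+ v}
  refl (cong +_ (sym e)) (cong +_ (sym e′)) (+≤+ ℕ.z≤n) (+≤+ ℕ.z≤n) (+≤+ ℕ.z≤n)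

-- The bounds matter: |Q| = 0 and |Q| = 1 describe the same graph, and |Q| = n - 1 and |Q| = n
-- differ by switching one vertex. The fields `inside` and `outside` of a standard form exclude 0
-- and n.
triangleSum-injective : ∀ {n k l} → 1 ℕ.≤ k → 1 ℕ.≤ l → k ℕ.< n → l ℕ.< n →
  triangleSum (+ n) (+ k) ≡ triangleSum (+ n) (+ l) → k ≡ l
triangleSum-injective {n} {k} {l} 1≤k 1≤l k<n l<n e with ℕ.<-cmp k l
... | tri< k<l _ _ = contradiction e (triangleSum-decreasing {n} {k} {l} 1≤k k<l l<n)
... | tri≈ _ k≡l _ = k≡l
... | tri> _ _ l<k = contradiction (sym e) (triangleSum-decreasing {n} {l} {k} 1≤l l<k k<n)

standard-forms-permuted : ∀ {n} (G H : SignedGraph n) (FG : StandardForm (adj G)) (FH : StandardForm (adj H))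
  (π : Fin n ↔ Fin n) → (∀ x → StandardForm.w FH x ≡ StandardForm.w FG (Inverse.to π x)) → SwitchingIsomorphic G H
standard-forms-permuted {n} G H FG FH π same =
  π , (λ x → FH.r x * FG.r (to x)) , (λ x → IsSign-* (FH.r-sign x) (FG.r-sign (to x))) , switch
  where
    module FG = StandardForm FG
    module FH = StandardForm FH
    to : Fin n → Fin n
    to = Inverse.to π
    to-injective : ∀ {x y} → to x ≡ to y → x ≡ y
    to-injective {x} {y} h = trans (sym (Perm.inverseˡ π)) (trans (cong (Inverse.from π) h) (Perm.inverseˡ π))
    switch : ∀ x y → adj H x y ≡ FH.r x * FG.r (to x) * adj G (to x) (to y) * (FH.r y * FG.r (to y))
    switch x y with x ≟ y
    ... | yes refl = trans (loopless H x) (sym (trans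
            (cong (λ u → FH.r x * FG.r (to x) * u * (FH.r x * FG.r (to x))) (loopless G (to x)))
            (lem (FH.r x * FG.r (to x)))))
      where lem : ∀ a → a * 0ℤ * a ≡ 0ℤ
            lem = solve-∀
    ... | no x≢y = trans (FH.shape x≢y) (sym (trans
            (cong (λ u → FH.r x * FG.r (to x) * u * (FH.r y * FG.r (to y))) (FG.shape (λ h → x≢y (to-injective h))))
            (trans (lem (FH.r x) (FG.r (to x)) (FG.r (to y)) (FH.r y) (ε (FG.w (to x)) (FG.w (to y))))
            (trans (cong₂ (λ a b → a * b * (FH.r x * FH.r y * ε (FG.w (to x)) (FG.w (to y))))
              (IsSign-sq (FG.r-sign (to x))) (IsSign-sq (FG.r-sign (to y))))
            (trans (*-identityˡ (FH.r x * FH.r y * ε (FG.w (to x)) (FG.w (to y))))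
              (sym (cong₂ (λ a b → FH.r x * FH.r y * ε a b) (same x) (same y))))))))
      where lem : ∀ a b c d e → a * b * (b * c * e) * (d * c) ≡ b * b * (c * c) * (a * d * e)
            lem = solve-∀

standard-forms-isomorphic : ∀ {n} (G H : SignedGraph n)
  (SG : SignMatrix (adj G)) (SH : SignMatrix (adj H)) → StandardForm (adj G) → StandardForm (adj H) →
  tr (adj G · (adj G · adj G)) ≡ tr (adj H · (adj H · adj H)) → SwitchingIsomorphic G H
standard-forms-isomorphic {n} G H SG SH FG FH e =
  standard-forms-permuted G H FG FH (proj₁ perm) (proj₂ perm)
  where
    module FG = StandardForm FG
    module FH = StandardForm FH
    perm = count-permutation FG.w FH.w (triangleSum-injective {n} {count FG.w} {count FH.w}
      (count-positive FG) (count-positive FH) (count-bounded FG) (count-bounded FH)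
      (trans (sym (triangle-trace SG FG)) (trans e (triangle-trace SH FH))))

-- Reading the spectral data of both graphs

-- The trace of A² counts the ordered pairs of adjacent vertices, and n (n - 1) is attained only by
-- complete graphs. The number `gap i k` is 1 exactly when i ≠ k are not adjacent and 0 otherwise.
sign-from-trace : ∀ {n} (H : SignedGraph n) → tr (adj H · adj H) ≡ + n * (+ n - 1ℤ) → SignMatrix (adj H)
sign-from-trace {n} H e = record { A-sym = symm H ; A-diag = loopless H ; A-off = off }
  where
    gap : Fin n → Fin n → ℤ
    gap i k = (1ℤ + δ i k * -1ℤ) + -1ℤ * (adj H i k * adj H k i)
    square-gap : ∀ {x} → x ≡ 0ℤ ⊎ (x ≡ 1ℤ ⊎ x ≡ -1ℤ) → 0ℤ ≤ (1ℤ + 0ℤ * -1ℤ) + -1ℤ * (x * x)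
    square-gap (inj₁ refl)        = +≤+ ℕ.z≤n
    square-gap (inj₂ (inj₁ refl)) = +≤+ ℕ.z≤n
    square-gap (inj₂ (inj₂ refl)) = +≤+ ℕ.z≤n
    gap-nonneg : ∀ i k → 0ℤ ≤ gap i k
    gap-nonneg i k with i ≟ k
    ... | yes refl = ≤-reflexive (sym (cong₂ (λ d x → (1ℤ + d * -1ℤ) + -1ℤ * (x * x)) (δ-diag i) (loopless H i)))
    ... | no i≢k = subst (0ℤ ≤_) (cong₂ (λ d x → (1ℤ + d * -1ℤ) + -1ℤ * (adj H i k * x)) (sym (δ-off i≢k)) (symm H i k))
                     (square-gap (entries H i k))
    gap-row : ∀ i → sumFin (gap i) ≡ (+ n - 1ℤ) + -1ℤ * (adj H · adj H) i i
    gap-row i = trans (sum-+ (λ k → 1ℤ + δ i k * -1ℤ) (λ k → -1ℤ * (adj H i k * adj H k i)))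
      (cong₂ _+_ (trans (sum-+ (λ _ → 1ℤ) (λ k → δ i k * -1ℤ))
          (cong₂ _+_ (trans (sum-const {n} 1ℤ) (*-identityʳ (+ n))) (sum-δ i (λ _ → -1ℤ))))
        (sum-*ˡ -1ℤ (λ k → adj H i k * adj H k i)))
    gap-total : sumFin (λ i → sumFin (gap i)) ≡ 0ℤ
    gap-total = trans (sum-cong gap-row) (trans (sum-+ (λ _ → + n - 1ℤ) (λ i → -1ℤ * (adj H · adj H) i i))
      (trans (cong₂ _+_ (sum-const {n} (+ n - 1ℤ)) (trans (sum-*ˡ -1ℤ (λ i → (adj H · adj H) i i)) (cong (-1ℤ *_) e)))
        (lem (+ n * (+ n - 1ℤ)))))
      where lem : ∀ x → x + -1ℤ * x ≡ 0ℤ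
            lem = solve-∀
    off : ∀ {i j} → i ≢ j → IsSign (adj H i j)
    off {i} {j} i≢j with entries H i j
    ... | inj₂ s = s
    ... | inj₁ z = contradiction (trans (sym (cong₂ (λ d x → (1ℤ + d * -1ℤ) + -1ℤ * (x * adj H j i)) (δ-off i≢j) z))
        (sum-nonneg-zero (gap-nonneg i) (sum-nonneg-zero (λ i → sum-nonneg (gap-nonneg i)) gap-total i) j)) (λ ())

entry-bounded : ∀ {n} (G : SignedGraph n) i j → ∣ adj G i j ∣ ℕ.≤ 1
entry-bounded G i j with entries G i j
... | inj₁ e        = subst (λ x → ∣ x ∣ ℕ.≤ 1) (sym e) ℕ.z≤n
... | inj₂ (inj₁ e) = subst (λ x → ∣ x ∣ ℕ.≤ 1) (sym e) (ℕ.s≤s ℕ.z≤n)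
... | inj₂ (inj₂ e) = subst (λ x → ∣ x ∣ ℕ.≤ 1) (sym e) (ℕ.s≤s ℕ.z≤n)

NormalForm : ∀ {n} → SignedGraph n → ℕ → ℕ → ℤ → ℤ → Set
NormalForm {n} G a b c p = a ℕ.+ b ℕ.+ 2 ≡ n ×
  (∀ t → charPolyAt (adj G) t ≡ (t - 1ℤ) ^ a * (t + 1ℤ) ^ b * (t * t - c * t + p))

-- If q has degree below two, factors t - 1 or t + 1 are moved into it until its degree is two;
-- enough of them exist because the order is at least two. The witnesses are read off from the
-- products, such as (t - 1)(t + c₀).
normal-form : ∀ {m} (G : SignedGraph (suc (suc m))) → AllButTwoEigenvaluesPM1 G →
  Σ ℕ λ a → Σ ℕ λ b → Σ ℤ λ c → Σ ℤ λ p → NormalForm G a b c p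
normal-form G (a , b , suc (suc (suc _)) , _ , ℕ.s≤s (ℕ.s≤s ()) , _)
normal-form G (a , b , 2 , size , _ , c₀ ∷ c₁ ∷ [] , h) = a , b , - c₁ , c₀ , size ,
  λ t → trans (h t) (cong ((t - 1ℤ) ^ a * (t + 1ℤ) ^ b *_) (lem t c₀ c₁))
  where lem : ∀ t x y → x + t * (y + t * 1ℤ) ≡ t * t - - y * t + x
        lem = solve-∀
normal-form G (suc a , b , 1 , size , _ , c₀ ∷ [] , h) = a , b , 1ℤ - c₀ , - c₀ ,
  trans (shift (a ℕ.+ b)) size ,
  λ t → trans (h t) (lem t c₀ ((t - 1ℤ) ^ a) ((t + 1ℤ) ^ b))
  where shift : ∀ m → m ℕ.+ 2 ≡ suc m ℕ.+ 1
        shift m = ℕ.+-suc m 1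
        lem : ∀ t x u v → (t - 1ℤ) * u * v * (x + t * 1ℤ) ≡ u * v * (t * t - (1ℤ - x) * t + - x)
        lem = solve-∀
normal-form G (zero , suc b , 1 , size , _ , c₀ ∷ [] , h) = 0 , b , - 1ℤ - c₀ , c₀ ,
  trans (ℕ.+-suc b 1) size ,
  λ t → trans (h t) (lem t c₀ ((t + 1ℤ) ^ b))
  where lem : ∀ t x v → 1ℤ * ((t + 1ℤ) * v) * (x + t * 1ℤ) ≡ 1ℤ * v * (t * t - (- 1ℤ - x) * t + x)
        lem = solve-∀
normal-form G (suc (suc a) , b , 0 , size , _ , [] , h) = a , b , + 2 , 1ℤ ,
  trans (ℕ.+-comm (a ℕ.+ b) 2) (trans (sym (ℕ.+-identityʳ _)) size) ,
  λ t → trans (h t) (lem t ((t - 1ℤ) ^ a) ((t + 1ℤ) ^ b))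
  where lem : ∀ t u v → (t - 1ℤ) * ((t - 1ℤ) * u) * v * 1ℤ ≡ u * v * (t * t - + 2 * t + 1ℤ)
        lem = solve-∀
normal-form G (suc zero , suc b , 0 , size , _ , [] , h) = 0 , b , 0ℤ , -1ℤ ,
  trans (ℕ.+-comm b 2) (trans (sym (ℕ.+-identityʳ _)) size) ,
  λ t → trans (h t) (lem t ((t + 1ℤ) ^ b))
  where lem : ∀ t v → (t - 1ℤ) * 1ℤ * ((t + 1ℤ) * v) * 1ℤ ≡ 1ℤ * v * (t * t - 0ℤ * t + -1ℤ)
        lem = solve-∀
normal-form G (zero , suc (suc b) , 0 , size , _ , [] , h) = 0 , b , - + 2 , 1ℤ ,
  trans (ℕ.+-comm b 2) (trans (sym (ℕ.+-identityʳ _)) size) ,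
  λ t → trans (h t) (lem t ((t + 1ℤ) ^ b))
  where lem : ∀ t v → 1ℤ * ((t + 1ℤ) * ((t + 1ℤ) * v)) * 1ℤ ≡ 1ℤ * v * (t * t - - + 2 * t + 1ℤ)
        lem = solve-∀
normal-form G (zero , zero , 1 , () , _)
normal-form G (zero , zero , 0 , () , _)
normal-form G (suc zero , zero , 0 , () , _)
normal-form G (zero , suc zero , 0 , () , _)

spectral : ∀ {n} (G : SignedGraph n) {a b c p} → NormalForm G a b c p → SignMatrix (adj G) → Spectral (adj G) a b c p
spectral {n} G {a} {b} {c} {p} (size , char) SG = record
  { signMatrix = SG ; size = cong +_ (sym size)
  ; c-val = c-arith {+ a} {+ b} {c} (trans (sym tr₁) (proj₁ traces))
  ; p-val = p-arith {+ a} {+ b} {c} {p} {+ n} (cong +_ (sym size))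
      (c-arith {+ a} {+ b} {c} (trans (sym tr₁) (proj₁ traces))) (trans (sym tr₂) (proj₁ (proj₂ traces)))
  ; root = root ; tr₃ = proj₂ (proj₂ traces) }
  where
    open SignMatrix SG
    open Spectrum (adj G) A-sym (entry-bounded G) a b c p size char using (root; traces)
    c-arith : ∀ {a b c : ℤ} → 0ℤ ≡ a - b + c → c ≡ b - a
    c-arith {a} {b} {c} e = cancel-by c (b - a) (sym e) (lem a b c)
      where lem : ∀ a b c → c - (b - a) ≡ (a - b + c) - 0ℤ
            lem = solve-∀
    p-arith : ∀ {a b c p n : ℤ} → n ≡ a + b + + 2 → c ≡ b - a → n * (n - 1ℤ) ≡ a + b + (c * c - + 2 * p) →
      p ≡ - (+ 2 * (a * b) + a + b + 1ℤ)
    p-arith {a} {b} {p = p} refl refl e = *-cancelˡ-≡ (+ 2) p (- (+ 2 * (a * b) + a + b + 1ℤ))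
      (cancel-by (+ 2 * p) (+ 2 * - (+ 2 * (a * b) + a + b + 1ℤ)) e (lem a b p))
      where lem : ∀ a b p → + 2 * p - + 2 * - (+ 2 * (a * b) + a + b + 1ℤ) ≡
              (a + b + + 2) * (a + b + + 2 - 1ℤ) - (a + b + ((b - a) * (b - a) - + 2 * p))
            lem = solve-∀

theorem6p1 : (n : ℕ) (G : SignedGraph n) → IsComplete G → AllButTwoEigenvaluesPM1 G →
    (H : SignedGraph n) → Cospectral G H → SwitchingIsomorphic G H
-- On fewer than two vertices there are no edges, and no two distinct vertices that could serve as
-- centers; the identity permutation does.
theorem6p1 zero G _ _ H _ = Perm.id , (λ ()) , (λ ()) , λ ()
theorem6p1 (suc zero) G _ _ H _ = Perm.id , (λ _ → 1ℤ) , (λ _ → inj₁ refl) , λ where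
  zero zero → trans (loopless H zero) (sym (cong (λ x → 1ℤ * x * 1ℤ) (loopless G zero)))
theorem6p1 (suc (suc m)) G complete few H cospectral with normal-form G few
... | a , b , c , p , size , charG =
  standard-forms-isomorphic G H SG SH
    (standard-form SG (spectral-center-pair specG)) (standard-form SH (spectral-center-pair specH))
    (trans (Spectral.tr₃ specG) (sym (Spectral.tr₃ specH)))
  where
    charH : ∀ t → charPolyAt (adj H) t ≡ (t - 1ℤ) ^ a * (t + 1ℤ) ^ b * (t * t - c * t + p)
    charH t = trans (sym (cospectral t)) (charG t)
    SG : SignMatrix (adj G)
    SG = record { A-sym = symm G ; A-diag = loopless G ; A-off = off }
      where
        off : ∀ {i j} → i ≢ j → IsSign (adj G i j)
        off {i} {j} i≢j with entries G i j
        ... | inj₁ e = contradiction e (complete i j i≢j)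
        ... | inj₂ s = s
    specG : Spectral (adj G) a b c p
    specG = spectral G (size , charG) SG
    SH : SignMatrix (adj H)
    SH = sign-from-trace H (trans (proj₁ (proj₂ (Spectrum.traces (adj H) (symm H) (entry-bounded H) a b c p size charH)))
      (trans (sym (proj₁ (proj₂ (Spectrum.traces (adj G) (symm G) (entry-bounded G) a b c p size charG))))
        (SignMatrix.tr₂ SG)))
    specH : Spectral (adj H) a b c p
    specH = spectral H (size , charH) SH
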